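{- Let $(a_n)_{n\ge0}$ be the sequence, listed in increasing order, of the non-negative integers $m$ such that $840m+1$ is a perfect square. Then $$\sum_{n=0}^\infty(-1)^{\lfloor (n+4)/8\rfloor}q^{a_n}=\frac{(q^3,q^4,q^7;q^7)_\infty}{(q,q^4;q^5)_\infty}.$$
   Context: Here $q$ is a complex number with $|q|<1$ (equivalently, the identity may be read as an identity of formal power series in $q$). For a complex number $a$, $(a;q)_\infty:=\prod_{i=0}^\infty(1-aq^i)$, and $(a_1,a_2,\dots,a_m;q)_\infty:=\prod_{j=1}^m(a_j;q)_\infty$. $\lfloor x\rfloor$ is the floor function. -}

module Defs where

open import Data.Nat as ℕ using (ℕ; zero; suc; _∸_; _%_; _/_; _≡ᵇ_)
open import Data.Integer using (ℤ; +_; _+_; _*_; -_; _-_)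
open import Data.Nat.Divisibility using (_∣?_)
open import Relation.Nullary.Decidable using (does)
open import Data.Bool using (if_then_else_)

-- Formal power series in q with integer coefficients: n ↦ coefficient of q^n.
PS : Set
PS = ℕ → ℤ

sumTo : ℕ → (ℕ → ℤ) → ℤ
sumTo zero f = f 0
sumTo (suc n) f = sumTo n f + f (suc n)

_⊛_ : PS → PS → PS
(f ⊛ g) n = sumTo n (λ k → f k * g (n ∸ k))
infixl 7 _⊛_

oneS : PS
oneS zero = + 1
oneS (suc n) = + 0

mono : ℕ → PS
mono k n = if n ≡ᵇ k then + 1 else + 0

oneMinus : ℕ → PS
oneMinus k n = oneS n - mono k n

-- the geometric series 1/(1 - q^k) = Σ_j q^{kj}   (used only for k ≥ 1)
geo : ℕ → PS
geo k n = if does (k ∣? n) then + 1 else + 0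

prodTo : ℕ → (ℕ → PS) → PS
prodTo zero F = F 0
prodTo (suc n) F = prodTo n F ⊛ F (suc n)

-- (q^b ; q^c)_∞ = ∏_{i≥0} (1 - q^{b+ci}), for b ≥ 1, c ≥ 1.
-- The coefficient of q^n only depends on the factors with i ≤ n
-- (since b + c i ≥ 1 + i > n for i > n), so it is computed from that finite product.
poch : ℕ → ℕ → PS
poch b c n = prodTo n (λ i → oneMinus (b ℕ.+ c ℕ.* i)) n

-- 1 / (q^b ; q^c)_∞ = ∏_{i≥0} 1/(1 - q^{b+ci}), for b ≥ 1, c ≥ 1 (same truncation remark).
invPoch : ℕ → ℕ → PS
invPoch b c n = prodTo n (λ i → geo (b ℕ.+ c ℕ.* i)) n

signPow : ℕ → ℤ
signPow k = if (k % 2) ≡ᵇ 0 then + 1 else - (+ 1)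

IsSq840 : ℕ → Set
IsSq840 m = Σ ℕ λ k → 840 ℕ.* m ℕ.+ 1 ≡ k ℕ.* k
  where open import Data.Product using (Σ)
        open import Relation.Binary.PropositionalEquality using (_≡_)

-- Coefficient series of Σ_{n≥0} (-1)^{⌊(n+4)/8⌋} q^{a n}, for a strictly increasing
-- sequence a (so a n ≥ n and only n ≤ N can contribute to q^N).
lhsSeries : (ℕ → ℕ) → PS
lhsSeries a N = sumTo N (λ n → if a n ≡ᵇ N then signPow ((n ℕ.+ 4) / 8) else + 0)

rhsSeries : PS
rhsSeries = poch 3 7 ⊛ poch 4 7 ⊛ poch 7 7 ⊛ invPoch 1 5 ⊛ invPoch 4 5

{-# OPTIONS --safe #-}
module Submission where

-- By Jacobi's triple product the claim, multiplied by (q;q)∞, equates products of two theta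
-- series: (q;q)∞ · Σ ± q^{a_n} = (q³,q⁴,q⁷;q⁷)∞ · (q²,q³,q⁵;q⁵)∞.  In suitable coordinates both
-- coefficients of q^M count points (u,t) of 3u² - ut + 3t² = 70M + 3, weighted by
-- w(u,t) = χ₇(u+t) χ₅(u-t), where χ_c is ±1 on the classes ±1 modulo c and 0 elsewhere: the right
-- side sums w over odd u and even t, the left side sums (-1)^t w over odd u prime to 3 (each
-- counted twice).  The difference is the sum of w over odd u and odd t, which vanishes since
-- w(t,u) = -w(u,t), plus the sum of (-1)^t w over odd u = 3v, which vanishes under t ↦ v - t.

open import Defs
open import Algebra.Bundles using (CommutativeRing)
open import Data.Bool using (true; false; if_then_else_)
open import Data.Empty using (⊥-elim)
open import Data.Integer as ℤ using (ℤ; +_; -[1+_]; _+_; _*_; -_; _-_)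
open import Data.Integer.DivMod using (_%ℕ_; _/ℕ_; n%ℕd<d; a≡a%ℕn+[a/ℕn]*n)
open import Data.Integer.Divisibility.Signed as ∣ℤ using (divides)
open import Data.Integer.Properties as ℤP using ()
import Data.Integer.Tactic.RingSolver as ℤ-Solver
open import Data.List using (List; []; _∷_; map)
open import Data.List.Membership.Propositional using (_∈_)
open import Data.List.Membership.Propositional.Properties using (∈-map⁺)
open import Data.List.Relation.Unary.All as All using (All; []; _∷_)
open import Data.List.Relation.Unary.Any using (here; there)
open import Data.List.Relation.Unary.Unique.Propositional using (Unique; []; _∷_)
open import Data.List.Relation.Unary.Unique.Propositional.Properties using (map⁺)
open import Data.Nat as ℕ using (ℕ; zero; suc; _∸_; _≤_; _<_; z≤n; s≤s; _%_; _/_; _≡ᵇ_)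
open import Data.Nat.DivMod using (m≡m%n+[m/n]*n; m%n<n; [m+kn]%n≡m%n; %-distribˡ-*; m/n≡1+[m∸n]/n)
open import Data.Nat.Divisibility as ∣ using (_∣?_)
open import Data.Nat.Properties as ℕP using ()
import Data.Nat.Tactic.RingSolver as ℕ-Solver
open import Data.Product using (Σ; ∃; _×_; _,_; proj₁; proj₂)
open import Data.Sum using (_⊎_; inj₁; inj₂)
open import Function using (_∘_)
open import Level using (0ℓ)
open import Relation.Binary.Definitions using (DecidableEquality; tri<; tri≈; tri>)
open import Relation.Binary.PropositionalEquality using (_≡_; _≢_; refl; sym; trans; cong; cong₂; subst; subst₂; module ≡-Reasoning)
import Relation.Binary.Reasoning.Setoid as SetoidReasoning
open import Relation.Nullary using (Dec; yes; no; does; ¬_; contradiction)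
open import Relation.Nullary.Decidable using (from-no; from-yes; _→-dec_)

-- Finite sums

-- The coordinates come from two diagonalisations of Q = 3u² - ut + 3t², namely 4Q = 5(u + t)² + 7(u
-- - t)² and 12Q = 35u² + (u - 6t)². At Q = 70M + 3 the first, with u + t = 1 + 14n and u - t = 1 +
-- 10m, reads M = (7n² + n)/2 + (5m² + m)/2, the exponents of the two theta series on the right. The
-- second, with u = 1 + 6j and u - 6t = 1 - 6i, reads M = (3j² + j)/2 + a where (6i - 1)² = 840a +
-- 1, the exponents on the left. The two cancelling symmetries are reflections in these systems: the
-- swap of u and t negates u - t, and t ↦ u/3 - t negates u - 6t. The latter is integral exactly on
-- the rows 3 | u, which the left side omits. All sums are compared at a single coefficient M and
-- inside one finite box, so that no convergence enters. For the same reason Jacobi's identity is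
-- derived from its finite form with Gaussian binomials, which is exact up to any prescribed degree.

sumTo-cong≤ : ∀ n {f g} → (∀ k → k ≤ n → f k ≡ g k) → sumTo n f ≡ sumTo n g
sumTo-cong≤ zero    h = h 0 z≤n
sumTo-cong≤ (suc n) h =
  cong₂ _+_ (sumTo-cong≤ n (λ k k≤n → h k (ℕP.m≤n⇒m≤1+n k≤n))) (h (suc n) ℕP.≤-refl)

sumTo-cong : ∀ n {f g} → (∀ k → f k ≡ g k) → sumTo n f ≡ sumTo n g
sumTo-cong n h = sumTo-cong≤ n (λ k _ → h k)

sumTo-0 : ∀ n → sumTo n (λ _ → + 0) ≡ + 0
sumTo-0 zero    = refl
sumTo-0 (suc n) = trans (ℤP.+-identityʳ _) (sumTo-0 n)

sumTo-+ : ∀ n f g → sumTo n (λ k → f k + g k) ≡ sumTo n f + sumTo n g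
sumTo-+ zero    f g = refl
sumTo-+ (suc n) f g =
  trans (cong (_+ (f (suc n) + g (suc n))) (sumTo-+ n f g)) (lemma (sumTo n f) (sumTo n g) (f (suc n)) (g (suc n)))
  where
  lemma : ∀ a b c d → (a + b) + (c + d) ≡ (a + c) + (b + d)
  lemma = ℤ-Solver.solve-∀

sumTo-*ˡ : ∀ n c f → sumTo n (λ k → c * f k) ≡ c * sumTo n f
sumTo-*ˡ zero    c f = refl
sumTo-*ˡ (suc n) c f =
  trans (cong (_+ c * f (suc n)) (sumTo-*ˡ n c f)) (sym (ℤP.*-distribˡ-+ c _ _))

sumTo-head : ∀ n f → sumTo (suc n) f ≡ f 0 + sumTo n (f ∘ suc)
sumTo-head zero    f = refl
sumTo-head (suc n) f =
  trans (cong (_+ f (suc (suc n))) (sumTo-head n f)) (ℤP.+-assoc (f 0) _ _)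

-- The ring of power series

infix  4 _≈_
infixl 6 _⊕_

_≈_ : PS → PS → Set
f ≈ g = ∀ n → f n ≡ g n

_⊕_ : PS → PS → PS
(f ⊕ g) n = f n + g n

⊖_ : PS → PS
(⊖ f) n = - f n

zeroS : PS
zeroS _ = + 0

tail : PS → PS
tail f n = f (suc n)

⊛-cong≤ : ∀ N {f f′ g g′ : PS} → (∀ n → n ≤ N → f n ≡ f′ n) → (∀ n → n ≤ N → g n ≡ g′ n) →
          (f ⊛ g) N ≡ (f′ ⊛ g′) N
⊛-cong≤ N p q = sumTo-cong≤ N (λ k k≤N → cong₂ _*_ (p k k≤N) (q (N ∸ k) (ℕP.m∸n≤m N k)))

⊛-cong : ∀ {f f′ g g′} → f ≈ f′ → g ≈ g′ → f ⊛ g ≈ f′ ⊛ g′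
⊛-cong p q N = ⊛-cong≤ N (λ n _ → p n) (λ n _ → q n)

⊛-congˡ : ∀ f {g g′} → g ≈ g′ → f ⊛ g ≈ f ⊛ g′
⊛-congˡ f = ⊛-cong {f} (λ _ → refl)

⊛-congʳ : ∀ g {f f′} → f ≈ f′ → f ⊛ g ≈ f′ ⊛ g
⊛-congʳ g p = ⊛-cong {g = g} p (λ _ → refl)

-- With its mirror image `⊛-tailʳ` this turns convolution into a recursion on the degree;
-- commutativity and associativity then follow by induction, without reindexing double sums.
⊛-tailˡ : ∀ f g n → (f ⊛ g) (suc n) ≡ f 0 * g (suc n) + (tail f ⊛ g) n
⊛-tailˡ f g n = sumTo-head n (λ k → f k * g (suc n ∸ k))

⊛-tailʳ : ∀ f g n → (f ⊛ g) (suc n) ≡ (f ⊛ tail g) n + f (suc n) * g 0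
⊛-tailʳ f g n = cong₂ _+_
  (sumTo-cong≤ n (λ k k≤n → cong (λ j → f k * g j) (ℕP.+-∸-assoc 1 k≤n)))
  (cong (λ j → f (suc n) * g j) (ℕP.n∸n≡0 n))

⊛-comm : ∀ f g → f ⊛ g ≈ g ⊛ f
⊛-comm f g zero    = ℤP.*-comm (f 0) (g 0)
⊛-comm f g (suc n) = begin
  (f ⊛ g) (suc n)                    ≡⟨ ⊛-tailˡ f g n ⟩
  f 0 * g (suc n) + (tail f ⊛ g) n   ≡⟨ cong₂ _+_ (ℤP.*-comm (f 0) _) (⊛-comm (tail f) g n) ⟩
  g (suc n) * f 0 + (g ⊛ tail f) n   ≡⟨ ℤP.+-comm (g (suc n) * f 0) _ ⟩
  (g ⊛ tail f) n + g (suc n) * f 0   ≡⟨ ⊛-tailʳ g f n ⟨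
  (g ⊛ f) (suc n)                    ∎
  where open ≡-Reasoning

⊛-distribʳ : ∀ h f g → (f ⊕ g) ⊛ h ≈ f ⊛ h ⊕ g ⊛ h
⊛-distribʳ h f g n =
  trans (sumTo-cong n (λ k → ℤP.*-distribʳ-+ (h (n ∸ k)) (f k) (g k))) (sumTo-+ n _ _)

⊛-distribˡ : ∀ h f g → h ⊛ (f ⊕ g) ≈ h ⊛ f ⊕ h ⊛ g
⊛-distribˡ h f g n =
  trans (sumTo-cong n (λ k → ℤP.*-distribˡ-+ (h k) (f (n ∸ k)) (g (n ∸ k)))) (sumTo-+ n _ _)

⊛-scaleˡ : ∀ c f g → (λ n → c * f n) ⊛ g ≈ (λ n → c * (f ⊛ g) n)
⊛-scaleˡ c f g n =
  trans (sumTo-cong n (λ k → ℤP.*-assoc c (f k) (g (n ∸ k)))) (sumTo-*ˡ n c _)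

⊛-assoc : ∀ f g h → (f ⊛ g) ⊛ h ≈ f ⊛ (g ⊛ h)
⊛-assoc f g h zero    = ℤP.*-assoc (f 0) (g 0) (h 0)
⊛-assoc f g h (suc n) = begin
  ((f ⊛ g) ⊛ h) (suc n)
    ≡⟨ ⊛-tailˡ (f ⊛ g) h n ⟩
  f 0 * g 0 * h (suc n) + (tail (f ⊛ g) ⊛ h) n
    ≡⟨ cong (λ z → f 0 * g 0 * h (suc n) + z) (⊛-congʳ h (⊛-tailˡ f g) n) ⟩
  f 0 * g 0 * h (suc n) + (((λ k → f 0 * tail g k) ⊕ (tail f ⊛ g)) ⊛ h) n
    ≡⟨ cong (λ z → f 0 * g 0 * h (suc n) + z) (⊛-distribʳ h (λ k → f 0 * tail g k) (tail f ⊛ g) n) ⟩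
  f 0 * g 0 * h (suc n) + (((λ k → f 0 * tail g k) ⊛ h) n + ((tail f ⊛ g) ⊛ h) n)
    ≡⟨ cong (λ z → f 0 * g 0 * h (suc n) + z)
         (cong₂ _+_ (⊛-scaleˡ (f 0) (tail g) h n) (⊛-assoc (tail f) g h n)) ⟩
  f 0 * g 0 * h (suc n) + (f 0 * (tail g ⊛ h) n + (tail f ⊛ (g ⊛ h)) n)
    ≡⟨ lemma (f 0) (g 0) (h (suc n)) _ _ ⟩
  f 0 * (g 0 * h (suc n) + (tail g ⊛ h) n) + (tail f ⊛ (g ⊛ h)) n
    ≡⟨ cong (λ z → f 0 * z + (tail f ⊛ (g ⊛ h)) n) (⊛-tailˡ g h n) ⟨
  f 0 * (g ⊛ h) (suc n) + (tail f ⊛ (g ⊛ h)) n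
    ≡⟨ ⊛-tailˡ f (g ⊛ h) n ⟨
  (f ⊛ (g ⊛ h)) (suc n) ∎
  where
  open ≡-Reasoning
  lemma : ∀ a b c d e → a * b * c + (a * d + e) ≡ a * (b * c + d) + e
  lemma = ℤ-Solver.solve-∀

⊛-zeroˡ : ∀ f → zeroS ⊛ f ≈ zeroS
⊛-zeroˡ f n = sumTo-0 n

⊛-identityˡ : ∀ f → oneS ⊛ f ≈ f
⊛-identityˡ f zero    = ℤP.*-identityˡ (f 0)
⊛-identityˡ f (suc n) = trans (⊛-tailˡ oneS f n)
  (trans (cong₂ _+_ (ℤP.*-identityˡ (f (suc n))) (⊛-zeroˡ f n)) (ℤP.+-identityʳ _))

⊛-identityʳ : ∀ f → f ⊛ oneS ≈ f
⊛-identityʳ f n = trans (⊛-comm f oneS n) (⊛-identityˡ f n)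

-- Packaged as a ring so that `PS-Solver` can permute the factors of long products.
PS-commutativeRing : CommutativeRing 0ℓ 0ℓ
PS-commutativeRing = record
  { Carrier = PS ; _≈_ = _≈_ ; _+_ = _⊕_ ; _*_ = _⊛_ ; -_ = ⊖_ ; 0# = zeroS ; 1# = oneS
  ; isCommutativeRing = record
    { isRing = record
      { +-isAbelianGroup = record
        { isGroup = record
          { isMonoid = record
            { isSemigroup = record
              { isMagma = record
                { isEquivalence = record
                  { refl = λ _ → refl ; sym = λ p n → sym (p n) ; trans = λ p q n → trans (p n) (q n) }
                ; ∙-cong = λ p q n → cong₂ _+_ (p n) (q n) }
              ; assoc = λ f g h n → ℤP.+-assoc (f n) (g n) (h n) }
            ; identity = (λ f n → ℤP.+-identityˡ (f n)) , (λ f n → ℤP.+-identityʳ (f n)) }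
          ; inverse = (λ f n → ℤP.+-inverseˡ (f n)) , (λ f n → ℤP.+-inverseʳ (f n))
          ; ⁻¹-cong = λ p n → cong -_ (p n) }
        ; comm = λ f g n → ℤP.+-comm (f n) (g n) }
      ; *-cong = ⊛-cong
      ; *-assoc = ⊛-assoc
      ; *-identity = ⊛-identityˡ , ⊛-identityʳ
      ; distrib = ⊛-distribˡ , ⊛-distribʳ }
    ; *-comm = ⊛-comm } }

open CommutativeRing PS-commutativeRing using (setoid; commutativeSemiring) renaming (refl to ≈-refl; sym to ≈-sym; trans to ≈-trans; +-cong to ⊕-cong; +-comm to ⊕-comm)
open import Algebra.Properties.Ring (CommutativeRing.ring PS-commutativeRing) using (-‿distribˡ-*)
open import Algebra.Solver.Ring.NaturalCoefficients.Default commutativeSemiring as PS-Solver using (_:=_; _:+_; _:*_)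
module ≈-Reasoning = SetoidReasoning setoid

-- Monomials, their complements, and truncated products

mono-0 : mono 0 ≈ oneS
mono-0 zero    = refl
mono-0 (suc n) = refl

mono-shift : ∀ k f n → (mono k ⊛ f) (k ℕ.+ n) ≡ f n
mono-shift zero    f n = trans (⊛-congʳ f mono-0 n) (⊛-identityˡ f n)
mono-shift (suc k) f n = trans (⊛-tailˡ (mono (suc k)) f (k ℕ.+ n))
  (trans (ℤP.+-identityˡ _) (mono-shift k f n))

mono-vanish : ∀ k f {n} → n < k → (mono k ⊛ f) n ≡ + 0
mono-vanish (suc k) f {zero}  _         = refl
mono-vanish (suc k) f {suc n} (s≤s n<k) = trans (⊛-tailˡ (mono (suc k)) f n)
  (trans (ℤP.+-identityˡ _) (mono-vanish k f n<k))

mono-self : ∀ k n → mono k (k ℕ.+ n) ≡ mono 0 n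
mono-self zero    n = refl
mono-self (suc k) n = mono-self k n

mono-below : ∀ k {n} → n < k → mono k n ≡ + 0
mono-below (suc k) {zero}  _         = refl
mono-below (suc k) {suc n} (s≤s n<k) = mono-below k n<k

mono-+ : ∀ k l → mono k ⊛ mono l ≈ mono (k ℕ.+ l)
mono-+ zero    l = ≈-trans (⊛-congʳ (mono l) mono-0) (⊛-identityˡ (mono l))
mono-+ (suc k) l zero    = refl
mono-+ (suc k) l (suc n) = trans (⊛-tailˡ (mono (suc k)) (mono l) n)
  (trans (ℤP.+-identityˡ _) (mono-+ k l n))

oneMinus-⊕ : ∀ k → oneMinus k ⊕ mono k ≈ oneS
oneMinus-⊕ k n = lemma (oneS n) (mono k n)
  where
  lemma : ∀ a b → a - b + b ≡ a
  lemma = ℤ-Solver.solve-∀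

oneMinus-below : ∀ k {n} → n < k → oneMinus k n ≡ oneS n
oneMinus-below k {n} n<k =
  trans (cong (λ z → oneS n - z) (mono-below k n<k)) (ℤP.+-identityʳ (oneS n))

⊛-oneMinus : ∀ f k → f ⊛ oneMinus k ≈ f ⊕ (⊖ (f ⊛ mono k))
⊛-oneMinus f k n = trans (rearrange ((f ⊛ oneMinus k) n) ((f ⊛ mono k) n))
  (cong (_- (f ⊛ mono k) n)
    (trans (sym (⊛-distribˡ f (oneMinus k) (mono k) n))
      (trans (⊛-congˡ f (oneMinus-⊕ k) n) (⊛-identityʳ f n))))
  where
  rearrange : ∀ a b → a ≡ a + b - b
  rearrange = ℤ-Solver.solve-∀

geo-below : ∀ k {n} → n < k → geo k n ≡ oneS n
geo-below k {zero}  n<k with k ∣? 0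
... | yes _ = refl
... | no ¬p = ⊥-elim (¬p (k ∣.∣0))
geo-below k {suc n} n<k with k ∣? suc n
... | yes p = ⊥-elim (ℕP.<⇒≱ n<k (∣.∣⇒≤ p))
... | no _ = refl

geo-shift : ∀ k n → geo k (k ℕ.+ n) ≡ geo k n
geo-shift k n with k ∣? (k ℕ.+ n) | k ∣? n
... | yes _ | yes _ = refl
... | yes p | no ¬q = ⊥-elim (¬q (∣.∣m+n∣m⇒∣n p ∣.∣-refl))
... | no ¬p | yes q = ⊥-elim (¬p (∣.∣m∣n⇒∣m+n ∣.∣-refl q))
... | no _  | no _  = refl

-- In degree k + m the difference is `geo k (k + m) - geo k m`, which is 0 because adding k does not
-- affect divisibility by k; below degree k only the constant term of `geo k` is seen.
geo-inverse : ∀ k → 1 ≤ k → geo k ⊛ oneMinus k ≈ oneS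
geo-inverse k 1≤k n = trans (⊛-oneMinus (geo k) k n)
  (trans (cong (λ z → geo k n - z) (⊛-comm (geo k) (mono k) n)) cases)
  where
  cases : geo k n - (mono k ⊛ geo k) n ≡ oneS n
  cases with ℕP.<-≤-connex n k
  ... | inj₁ n<k = trans (cong₂ _-_ (geo-below k n<k) (mono-vanish k (geo k) n<k)) (ℤP.+-identityʳ _)
  ... | inj₂ k≤n with n ∸ k | ℕP.m+[n∸m]≡n k≤n
  ...   | m | refl = trans (cong₂ _-_ (geo-shift k m) (mono-shift k (geo k) m))
                       (trans (ℤP.+-inverseʳ (geo k m)) (sym (oneS-pos (ℕP.≤-trans 1≤k (ℕP.m≤m+n k m)))))
    where
    oneS-pos : ∀ {j} → 1 ≤ j → oneS j ≡ + 0
    oneS-pos (s≤s _) = refl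

infix 4 _≈[_]_

_≈[_]_ : PS → ℕ → PS → Set
f ≈[ L ] g = ∀ n → n ≤ L → f n ≡ g n

≈[]-⊛ : ∀ {L f f′ g g′} → f ≈[ L ] f′ → g ≈[ L ] g′ → f ⊛ g ≈[ L ] f′ ⊛ g′
≈[]-⊛ p q n n≤L = ⊛-cong≤ n (λ k k≤n → p k (ℕP.≤-trans k≤n n≤L)) (λ k k≤n → q k (ℕP.≤-trans k≤n n≤L))

≈⇒≈[] : ∀ {L f g} → f ≈ g → f ≈[ L ] g
≈⇒≈[] p n _ = p n

-- The factor with index i is 1 up to and including degree i, so the coefficient of q^n is settled
-- once the factors 0 to n are multiplied.
Admissible : (ℕ → PS) → Set
Admissible F = ∀ i {n} → n ≤ i → F i n ≡ oneS n

-- `poch` and `invPoch` unfold to this diagonal, so facts about `lim` apply to them directly.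
lim : (ℕ → PS) → PS
lim F n = prodTo n F n

prodTo-stable : ∀ {F} → Admissible F → ∀ m n → prodTo n F ≈[ n ] prodTo (m ℕ.+ n) F
prodTo-stable adm zero    n k k≤n = refl
prodTo-stable {F} adm (suc m) n k k≤n =
  trans (prodTo-stable adm m n k k≤n)
    (sym (trans (⊛-cong≤ k {prodTo (m ℕ.+ n) F} (λ _ _ → refl) (λ j j≤k → adm (suc (m ℕ.+ n))
            (ℕP.≤-trans j≤k (ℕP.≤-trans k≤n (ℕP.m≤n+m n (suc m))))))
      (⊛-identityʳ (prodTo (m ℕ.+ n) F) k)))

lim-prodTo : ∀ {F} → Admissible F → ∀ {L} n → n ≤ L → lim F n ≡ prodTo L F n
lim-prodTo {F} adm {L} n n≤L =
  subst (λ l → lim F n ≡ prodTo l F n) (ℕP.m∸n+n≡m n≤L) (prodTo-stable adm (L ∸ n) n n ℕP.≤-refl)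

prodTo-inverse : ∀ {F G} → (∀ i → F i ⊛ G i ≈ oneS) → ∀ n → prodTo n F ⊛ prodTo n G ≈ oneS
prodTo-inverse h zero    = h 0
prodTo-inverse {F} {G} h (suc n) = begin
  prodTo n F ⊛ F (suc n) ⊛ (prodTo n G ⊛ G (suc n))
    ≈⟨ PS-Solver.solve 4 (λ a b c d → a :* b :* (c :* d) := a :* c :* (b :* d)) ≈-refl
         (prodTo n F) (F (suc n)) (prodTo n G) (G (suc n)) ⟩
  prodTo n F ⊛ prodTo n G ⊛ (F (suc n) ⊛ G (suc n))
    ≈⟨ ⊛-cong (prodTo-inverse h n) (h (suc n)) ⟩
  oneS ⊛ oneS
    ≈⟨ ⊛-identityˡ oneS ⟩
  oneS ∎
  where open ≈-Reasoning

prodTo-cong : ∀ n {F G} → (∀ i → F i ≈ G i) → prodTo n F ≈ prodTo n G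
prodTo-cong zero    h = h 0
prodTo-cong (suc n) h = ⊛-cong (prodTo-cong n h) (h (suc n))

progression> : ∀ b c → 1 ≤ b → 1 ≤ c → ∀ i → i < b ℕ.+ c ℕ.* i
progression> b c 1≤b 1≤c i = ℕP.+-mono-≤ 1≤b (subst (ℕ._≤ c ℕ.* i) (ℕP.*-identityˡ i) (ℕP.*-monoˡ-≤ i 1≤c))

poch-admissible : ∀ b c → 1 ≤ b → 1 ≤ c → Admissible (λ i → oneMinus (b ℕ.+ c ℕ.* i))
poch-admissible b c 1≤b 1≤c i n≤i = oneMinus-below _ (ℕP.≤-<-trans n≤i (progression> b c 1≤b 1≤c i))

invPoch-admissible : ∀ b c → 1 ≤ b → 1 ≤ c → Admissible (λ i → geo (b ℕ.+ c ℕ.* i))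
invPoch-admissible b c 1≤b 1≤c i n≤i = geo-below _ (ℕP.≤-<-trans n≤i (progression> b c 1≤b 1≤c i))

poch-prodTo : ∀ b c → 1 ≤ b → 1 ≤ c → ∀ {L} → poch b c ≈[ L ] prodTo L (λ i → oneMinus (b ℕ.+ c ℕ.* i))
poch-prodTo b c 1≤b 1≤c = lim-prodTo (poch-admissible b c 1≤b 1≤c)

-- Up to degree n both infinite products may be replaced by their truncations at the common length
-- n, whose factors cancel in pairs.
invPoch-inverse : ∀ b c → 1 ≤ b → 1 ≤ c → invPoch b c ⊛ poch b c ≈ oneS
invPoch-inverse b c 1≤b 1≤c n =
  trans (≈[]-⊛ {n} (lim-prodTo (invPoch-admissible b c 1≤b 1≤c)) (poch-prodTo b c 1≤b 1≤c) n ℕP.≤-refl)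
    (prodTo-inverse (λ i → geo-inverse _ (ℕP.≤-trans 1≤b (ℕP.m≤m+n b _))) n n)

-- Dissection of (q;q)∞ modulo 3 and modulo 5

prodTo-3 : ∀ (F : ℕ → PS) L → prodTo (2 ℕ.+ L ℕ.* 3) F ≈
  prodTo L (λ i → F (i ℕ.* 3)) ⊛ prodTo L (λ i → F (1 ℕ.+ i ℕ.* 3)) ⊛ prodTo L (λ i → F (2 ℕ.+ i ℕ.* 3))
prodTo-3 F zero    = ≈-refl
prodTo-3 F (suc L) = begin
  prodTo (2 ℕ.+ L ℕ.* 3) F ⊛ a ⊛ b ⊛ c
    ≈⟨ ⊛-cong (⊛-cong (⊛-cong (prodTo-3 F L) (≈-refl {a})) (≈-refl {b})) (≈-refl {c}) ⟩
  A ⊛ B ⊛ C ⊛ a ⊛ b ⊛ c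
    ≈⟨ PS-Solver.solve 6 (λ A B C a b c → A :* B :* C :* a :* b :* c := A :* a :* (B :* b) :* (C :* c))
         ≈-refl A B C a b c ⟩
  A ⊛ a ⊛ (B ⊛ b) ⊛ (C ⊛ c) ∎
  where
  open ≈-Reasoning
  A = prodTo L (λ i → F (i ℕ.* 3))
  B = prodTo L (λ i → F (1 ℕ.+ i ℕ.* 3))
  C = prodTo L (λ i → F (2 ℕ.+ i ℕ.* 3))
  a = F (3 ℕ.+ L ℕ.* 3)
  b = F (4 ℕ.+ L ℕ.* 3)
  c = F (5 ℕ.+ L ℕ.* 3)

prodTo-5 : ∀ (F : ℕ → PS) L → prodTo (4 ℕ.+ L ℕ.* 5) F ≈
  prodTo L (λ i → F (i ℕ.* 5)) ⊛ prodTo L (λ i → F (1 ℕ.+ i ℕ.* 5)) ⊛ prodTo L (λ i → F (2 ℕ.+ i ℕ.* 5))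
    ⊛ prodTo L (λ i → F (3 ℕ.+ i ℕ.* 5)) ⊛ prodTo L (λ i → F (4 ℕ.+ i ℕ.* 5))
prodTo-5 F zero    = ≈-refl
prodTo-5 F (suc L) = begin
  prodTo (4 ℕ.+ L ℕ.* 5) F ⊛ a ⊛ b ⊛ c ⊛ d ⊛ e
    ≈⟨ ⊛-cong (⊛-cong (⊛-cong (⊛-cong (⊛-cong (prodTo-5 F L) (≈-refl {a})) (≈-refl {b})) (≈-refl {c})) (≈-refl {d})) (≈-refl {e}) ⟩
  A ⊛ B ⊛ C ⊛ D ⊛ E ⊛ a ⊛ b ⊛ c ⊛ d ⊛ e
    ≈⟨ PS-Solver.solve 10 (λ A B C D E a b c d e →
         A :* B :* C :* D :* E :* a :* b :* c :* d :* e :=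
         A :* a :* (B :* b) :* (C :* c) :* (D :* d) :* (E :* e))
         ≈-refl A B C D E a b c d e ⟩
  A ⊛ a ⊛ (B ⊛ b) ⊛ (C ⊛ c) ⊛ (D ⊛ d) ⊛ (E ⊛ e) ∎
  where
  open ≈-Reasoning
  A = prodTo L (λ i → F (i ℕ.* 5))
  B = prodTo L (λ i → F (1 ℕ.+ i ℕ.* 5))
  C = prodTo L (λ i → F (2 ℕ.+ i ℕ.* 5))
  D = prodTo L (λ i → F (3 ℕ.+ i ℕ.* 5))
  E = prodTo L (λ i → F (4 ℕ.+ i ℕ.* 5))
  a = F (5 ℕ.+ L ℕ.* 5)
  b = F (6 ℕ.+ L ℕ.* 5)
  c = F (7 ℕ.+ L ℕ.* 5)
  d = F (8 ℕ.+ L ℕ.* 5)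
  e = F (9 ℕ.+ L ℕ.* 5)

poch-11 : ∀ {L} m → L ≤ m → poch 1 1 ≈[ L ] prodTo m (λ i → oneMinus (1 ℕ.+ 1 ℕ.* i))
poch-11 m L≤m n n≤L = poch-prodTo 1 1 ℕP.≤-refl ℕP.≤-refl n (ℕP.≤-trans n≤L L≤m)

-- The factor of (q;q)∞ with index r + ic has exponent r + 1 + ic, whence the base `suc r` for the
-- residue r.
poch-class : ∀ r c .{{_ : ℕ.NonZero c}} {L} →
  prodTo L (λ i → oneMinus (1 ℕ.+ 1 ℕ.* (r ℕ.+ i ℕ.* c))) ≈[ L ] poch (suc r) c
poch-class r c {L} n n≤L =
  trans (prodTo-cong L (λ i k → cong (λ j → oneMinus j k) (lemma r c i)) n)
    (sym (poch-prodTo (suc r) c (s≤s z≤n) (ℕ.>-nonZero⁻¹ c) n n≤L))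
  where
  lemma : ∀ r c i → 1 ℕ.+ 1 ℕ.* (r ℕ.+ i ℕ.* c) ≡ suc r ℕ.+ c ℕ.* i
  lemma = ℕ-Solver.solve-∀

n≤k+n*c : ∀ n k c .{{_ : ℕ.NonZero c}} → n ≤ k ℕ.+ n ℕ.* c
n≤k+n*c n k c = ℕP.≤-trans (ℕP.m≤m*n n c) (ℕP.m≤n+m (n ℕ.* c) k)

euler-dissection-3 : poch 1 1 ≈ poch 1 3 ⊛ poch 2 3 ⊛ poch 3 3
euler-dissection-3 n =
  -- The indices 0 to 2 + 3n form n + 1 complete blocks of three, so each residue class receives
  -- exactly the factors 0 to n.
  trans (poch-11 {n} (2 ℕ.+ n ℕ.* 3) (n≤k+n*c n 2 3) n ℕP.≤-refl)
  (trans (prodTo-3 (λ i → oneMinus (1 ℕ.+ 1 ℕ.* i)) n n)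
    (≈[]-⊛ (≈[]-⊛ (poch-class 0 3) (poch-class 1 3)) (poch-class 2 3) n ℕP.≤-refl))

euler-dissection-5 : poch 1 1 ≈ poch 1 5 ⊛ poch 2 5 ⊛ poch 3 5 ⊛ poch 4 5 ⊛ poch 5 5
euler-dissection-5 n =
  trans (poch-11 {n} (4 ℕ.+ n ℕ.* 5) (n≤k+n*c n 4 5) n ℕP.≤-refl)
  (trans (prodTo-5 (λ i → oneMinus (1 ℕ.+ 1 ℕ.* i)) n n)
    (≈[]-⊛ (≈[]-⊛ (≈[]-⊛ (≈[]-⊛ (poch-class 0 5) (poch-class 1 5)) (poch-class 2 5)) (poch-class 3 5)) (poch-class 4 5)
      n ℕP.≤-refl))

-- In the dissection modulo 5 the classes 1 and 4 cancel the denominators of `rhsSeries`; the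
-- surviving classes 2, 3 and 5 form a second triple product.
rhs-reduction : rhsSeries ⊛ (poch 1 3 ⊛ poch 2 3 ⊛ poch 3 3) ≈
  (poch 3 7 ⊛ poch 4 7 ⊛ poch 7 7) ⊛ (poch 2 5 ⊛ poch 3 5 ⊛ poch 5 5)
rhs-reduction = begin
  A ⊛ i₁ ⊛ i₄ ⊛ (poch 1 3 ⊛ poch 2 3 ⊛ poch 3 3)
    ≈⟨ ⊛-congˡ (A ⊛ i₁ ⊛ i₄) (≈-trans (≈-sym euler-dissection-3) euler-dissection-5) ⟩
  A ⊛ i₁ ⊛ i₄ ⊛ (p₁ ⊛ p₂ ⊛ p₃ ⊛ p₄ ⊛ p₅)
    ≈⟨ PS-Solver.solve 8 (λ A i₁ i₄ p₁ p₂ p₃ p₄ p₅ →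
         A :* i₁ :* i₄ :* (p₁ :* p₂ :* p₃ :* p₄ :* p₅) :=
         (i₁ :* p₁) :* (i₄ :* p₄) :* (A :* (p₂ :* p₃ :* p₅))) ≈-refl A i₁ i₄ p₁ p₂ p₃ p₄ p₅ ⟩
  (i₁ ⊛ p₁) ⊛ (i₄ ⊛ p₄) ⊛ (A ⊛ (p₂ ⊛ p₃ ⊛ p₅))
    ≈⟨ ⊛-cong (⊛-cong (invPoch-inverse 1 5 (s≤s z≤n) (s≤s z≤n)) (invPoch-inverse 4 5 (s≤s z≤n) (s≤s z≤n)))
         (≈-refl {A ⊛ (p₂ ⊛ p₃ ⊛ p₅)}) ⟩
  oneS ⊛ oneS ⊛ (A ⊛ (p₂ ⊛ p₃ ⊛ p₅))
    ≈⟨ ⊛-cong (⊛-identityˡ oneS) (≈-refl {A ⊛ (p₂ ⊛ p₃ ⊛ p₅)}) ⟩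
  oneS ⊛ (A ⊛ (p₂ ⊛ p₃ ⊛ p₅))
    ≈⟨ ⊛-identityˡ _ ⟩
  A ⊛ (p₂ ⊛ p₃ ⊛ p₅) ∎
  where
  open ≈-Reasoning
  A = poch 3 7 ⊛ poch 4 7 ⊛ poch 7 7
  i₁ = invPoch 1 5
  i₄ = invPoch 4 5
  p₁ = poch 1 5
  p₂ = poch 2 5
  p₃ = poch 3 5
  p₄ = poch 4 5
  p₅ = poch 5 5

-- The common factor is (q;q)∞ by the dissection modulo 3, and `invPoch 1 1` inverts it.
cancel-euler : ∀ f g → f ⊛ (poch 1 3 ⊛ poch 2 3 ⊛ poch 3 3) ≈ g ⊛ (poch 1 3 ⊛ poch 2 3 ⊛ poch 3 3) → f ≈ g
cancel-euler f g h = begin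
  f                                ≈⟨ expand f ⟩
  f ⊛ θ ⊛ invPoch 1 1              ≈⟨ ⊛-cong h (≈-refl {invPoch 1 1}) ⟩
  g ⊛ θ ⊛ invPoch 1 1              ≈⟨ expand g ⟨
  g                                ∎
  where
  open ≈-Reasoning
  θ = poch 1 3 ⊛ poch 2 3 ⊛ poch 3 3
  expand : ∀ f → f ≈ f ⊛ θ ⊛ invPoch 1 1
  expand f = begin
    f                                ≈⟨ ⊛-identityʳ f ⟨
    f ⊛ oneS                         ≈⟨ ⊛-congˡ (f) (invPoch-inverse 1 1 ℕP.≤-refl ℕP.≤-refl) ⟨
    f ⊛ (invPoch 1 1 ⊛ poch 1 1)     ≈⟨ ⊛-congˡ (f) (⊛-comm (invPoch 1 1) (poch 1 1)) ⟩
    f ⊛ (poch 1 1 ⊛ invPoch 1 1)     ≈⟨ ⊛-assoc f (poch 1 1) (invPoch 1 1) ⟨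
    f ⊛ poch 1 1 ⊛ invPoch 1 1       ≈⟨ ⊛-cong (⊛-congˡ (f) euler-dissection-3) (≈-refl {invPoch 1 1}) ⟩
    f ⊛ θ ⊛ invPoch 1 1 ∎

-- Sums of power series

psum : ℕ → (ℕ → PS) → PS
psum zero    H = H 0
psum (suc m) H = psum m H ⊕ H (suc m)

psum-coeff : ∀ m H n → psum m H n ≡ sumTo m (λ k → H k n)
psum-coeff zero    H n = refl
psum-coeff (suc m) H n = cong (_+ H (suc m) n) (psum-coeff m H n)

psum-cong≤ : ∀ m {G H} → (∀ k → k ≤ m → G k ≈ H k) → psum m G ≈ psum m H
psum-cong≤ zero    h = h 0 z≤n
psum-cong≤ (suc m) h =
  ⊕-cong (psum-cong≤ m (λ k k≤m → h k (ℕP.m≤n⇒m≤1+n k≤m))) (h (suc m) ℕP.≤-refl)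

psum-⊛ʳ : ∀ m H f → psum m (λ k → H k ⊛ f) ≈ psum m H ⊛ f
psum-⊛ʳ zero    H f = ≈-refl
psum-⊛ʳ (suc m) H f =
  ≈-trans (⊕-cong (psum-⊛ʳ m H f) ≈-refl) (≈-sym (⊛-distribʳ f (psum m H) (H (suc m))))

psum-⊖ : ∀ m H → psum m (λ k → ⊖ H k) ≈ ⊖ psum m H
psum-⊖ zero    H n = refl
psum-⊖ (suc m) H n =
  trans (cong (_+ - H (suc m) n) (psum-⊖ m H n)) (sym (ℤP.neg-distrib-+ (psum m H n) (H (suc m) n)))

-- The summation pattern of Pascal's rule: every interior term splits into a U part and the V part
-- of the preceding index, while the two end terms contribute one part each.
psum-interleave : ∀ m {T U V} → T 0 ≈ U 0 → (∀ k → k < m → T (suc k) ≈ U (suc k) ⊕ V k) →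
                  T (suc m) ≈ V m → psum (suc m) T ≈ psum m U ⊕ psum m V
psum-interleave m {T} {U} {V} first middle last =
  ≈-trans (⊕-cong {psum m T} ≈-refl last) (partial m ℕP.≤-refl)
  where
  open ≈-Reasoning
  -- The extra `V p` is the part of `T (suc p)` that belongs to the first p + 1 terms of the V sum.
  partial : ∀ p → p ≤ m → psum p T ⊕ V p ≈ psum p U ⊕ psum p V
  partial zero    _   = ⊕-cong first ≈-refl
  partial (suc p) p<m = begin
    psum p T ⊕ T (suc p) ⊕ V (suc p)
      ≈⟨ ⊕-cong (⊕-cong {psum p T} ≈-refl (middle p p<m)) (≈-refl {V (suc p)}) ⟩
    psum p T ⊕ (U (suc p) ⊕ V p) ⊕ V (suc p)
      ≈⟨ PS-Solver.solve 4 (λ t u v w → t :+ (u :+ v) :+ w := (t :+ v) :+ (u :+ w)) ≈-refl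
           (psum p T) (U (suc p)) (V p) (V (suc p)) ⟩
    (psum p T ⊕ V p) ⊕ (U (suc p) ⊕ V (suc p))
      ≈⟨ ⊕-cong (partial p (ℕP.<⇒≤ p<m)) (≈-refl {U (suc p) ⊕ V (suc p)}) ⟩
    (psum p U ⊕ psum p V) ⊕ (U (suc p) ⊕ V (suc p))
      ≈⟨ PS-Solver.solve 4 (λ t u v w → (t :+ u) :+ (v :+ w) := (t :+ v) :+ (u :+ w)) ≈-refl
           (psum p U) (psum p V) (U (suc p)) (V (suc p)) ⟩
    (psum p U ⊕ U (suc p)) ⊕ (psum p V ⊕ V (suc p)) ∎

-- Signs and generalised polygonal exponents

signℕ : ℕ → ℤ
signℕ zero    = + 1
signℕ (suc n) = - signℕ n

signℤ : ℤ → ℤ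
signℤ n = signℕ ℤ.∣ n ∣

-- Defined by cases so that `thetaExp (sucℤ n)` computes on each constructor.
sucℤ : ℤ → ℤ
sucℤ (+ n)          = + suc n
sucℤ -[1+ zero ]    = + 0
sucℤ -[1+ suc n ]   = -[1+ n ]

signℤ-suc : ∀ n → signℤ (sucℤ n) ≡ - signℤ n
signℤ-suc (+ n)        = refl
signℤ-suc -[1+ zero ]  = refl
signℤ-suc -[1+ suc n ] = sym (ℤP.neg-involutive _)

suc-⊖-sucℤ : ∀ k M → suc k ℤ.⊖ M ≡ sucℤ (k ℤ.⊖ M)
suc-⊖-sucℤ k       zero          = refl
suc-⊖-sucℤ zero    (suc zero)    = refl
suc-⊖-sucℤ zero    (suc (suc M)) = refl
suc-⊖-sucℤ (suc k) (suc M)       =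
  trans (ℤP.[1+m]⊖[1+n]≡m⊖n (suc k) M)
    (trans (suc-⊖-sucℤ k M) (cong sucℤ (sym (ℤP.[1+m]⊖[1+n]≡m⊖n k M))))

⊖-view : ∀ k M → (∃ λ p → k ≡ M ℕ.+ p × k ℤ.⊖ M ≡ + p) ⊎ (∃ λ p → M ≡ suc (k ℕ.+ p) × k ℤ.⊖ M ≡ -[1+ p ])
⊖-view k       zero    = inj₁ (k , refl , refl)
⊖-view zero    (suc M) = inj₂ (M , refl , refl)
⊖-view (suc k) (suc M) with ⊖-view k M
... | inj₁ (p , refl , eq) = inj₁ (p , refl , trans (ℤP.[1+m]⊖[1+n]≡m⊖n k M) eq)
... | inj₂ (p , refl , eq) = inj₂ (p , refl , trans (ℤP.[1+m]⊖[1+n]≡m⊖n k M) eq)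

-- This is n (n - 1) / 2, not n (n + 1) / 2.
triangle : ℕ → ℕ
triangle zero    = 0
triangle (suc n) = triangle n ℕ.+ n

-- Jacobi's triple product from its finite form

module Jacobi (a b : ℕ) (1≤a : 1 ≤ a) (1≤b : 1 ≤ b) where

  open ≈-Reasoning

  c : ℕ
  c = a ℕ.+ b

  1≤c : 1 ≤ c
  1≤c = ℕP.≤-trans 1≤a (ℕP.m≤m+n a b)

  -- The exponent (c n² + (a - b) n) / 2 of the theta series, written without division or
  -- subtraction.
  thetaExp : ℤ → ℕ
  thetaExp (+ n)    = a ℕ.* n ℕ.+ c ℕ.* triangle n
  thetaExp -[1+ n ] = b ℕ.* suc n ℕ.+ c ℕ.* triangle (suc n)

  ∣n∣≤thetaExp : ∀ n → ℤ.∣ n ∣ ≤ thetaExp n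
  ∣n∣≤thetaExp (+ n)    = ℕP.≤-trans (ℕP.m≤n*m n a {{ℕ.>-nonZero 1≤a}}) (ℕP.m≤m+n _ _)
  ∣n∣≤thetaExp -[1+ n ] = ℕP.≤-trans (ℕP.m≤n*m (suc n) b {{ℕ.>-nonZero 1≤b}}) (ℕP.m≤m+n _ _)

  -- It has n factors, whereas `prodTo n` has n + 1; the induction for the finite identity starts
  -- from the empty product.
  finPoch : ℕ → ℕ → PS
  finPoch d zero    = oneS
  finPoch d (suc n) = finPoch d n ⊛ oneMinus (d ℕ.+ c ℕ.* n)

  finPoch-stable : ∀ d n m {k} → k < d ℕ.+ c ℕ.* n → finPoch d (m ℕ.+ n) k ≡ finPoch d n k
  finPoch-stable d n zero    k< = refl
  finPoch-stable d n (suc m) {k} k< =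
    trans (⊛-cong≤ k {finPoch d (m ℕ.+ n)} (λ _ _ → refl) (λ j j≤k → oneMinus-below _
             (ℕP.≤-<-trans j≤k (ℕP.<-≤-trans k< (ℕP.+-monoʳ-≤ d (ℕP.*-monoʳ-≤ c (ℕP.m≤n+m n m)))))))
      (trans (⊛-identityʳ (finPoch d (m ℕ.+ n)) k) (finPoch-stable d n m k<))

  prodTo-finPoch : ∀ d n → prodTo n (λ i → oneMinus (d ℕ.+ c ℕ.* i)) ≈ finPoch d (suc n)
  prodTo-finPoch d zero    = ≈-sym (⊛-identityˡ _)
  prodTo-finPoch d (suc n) = ⊛-congʳ (oneMinus (d ℕ.+ c ℕ.* suc n)) (prodTo-finPoch d n)

  poch-finPoch : ∀ d → 1 ≤ d → ∀ n {k} → k < d ℕ.+ c ℕ.* n → poch d c k ≡ finPoch d n k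
  poch-finPoch d 1≤d n {k} k< =
    trans (poch-prodTo d c 1≤d 1≤c {k ℕ.+ n} k (ℕP.m≤m+n k n))
      (trans (prodTo-finPoch d (k ℕ.+ n) k) (finPoch-stable d n (suc k) k<))

  invFinPoch : ℕ → PS
  invFinPoch zero    = oneS
  invFinPoch (suc n) = invFinPoch n ⊛ geo (c ℕ.+ c ℕ.* n)

  invFinPoch-step : ∀ n → invFinPoch (suc n) ⊛ oneMinus (c ℕ.+ c ℕ.* n) ≈ invFinPoch n
  invFinPoch-step n = ≈-trans (⊛-assoc (invFinPoch n) (geo d) (oneMinus d))
    (≈-trans (⊛-congˡ (invFinPoch n) (geo-inverse d (ℕP.≤-trans 1≤c (ℕP.m≤m+n c _)))) (⊛-identityʳ _))
    where d = c ℕ.+ c ℕ.* n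

  finPoch-inverse : ∀ n → finPoch c n ⊛ invFinPoch n ≈ oneS
  finPoch-inverse zero    = ⊛-identityˡ oneS
  finPoch-inverse (suc n) = begin
    finPoch c n ⊛ x ⊛ invFinPoch (suc n)
      ≈⟨ PS-Solver.solve 3 (λ f x i → f :* x :* i := f :* (i :* x)) ≈-refl (finPoch c n) x (invFinPoch (suc n)) ⟩
    finPoch c n ⊛ (invFinPoch (suc n) ⊛ x)
      ≈⟨ ⊛-congˡ (finPoch c n) (invFinPoch-step n) ⟩
    finPoch c n ⊛ invFinPoch n
      ≈⟨ finPoch-inverse n ⟩
    oneS ∎
    where x = oneMinus (c ℕ.+ c ℕ.* n)

  -- The Gaussian binomial coefficient [i + j choose i] in q^c.
  gauss : ℕ → ℕ → PS
  gauss i j = finPoch c (i ℕ.+ j) ⊛ (invFinPoch i ⊛ invFinPoch j)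

  gauss-comm : ∀ i j → gauss i j ≈ gauss j i
  gauss-comm i j rewrite ℕP.+-comm i j =
    ⊛-congˡ (finPoch c (j ℕ.+ i)) (⊛-comm (invFinPoch i) (invFinPoch j))

  gauss-0ˡ : ∀ j → gauss 0 j ≈ oneS
  gauss-0ˡ j = ≈-trans (⊛-congˡ (finPoch c j) (⊛-identityˡ (invFinPoch j))) (finPoch-inverse j)

  gauss-0ʳ : ∀ i → gauss i 0 ≈ oneS
  gauss-0ʳ i = ≈-trans (gauss-comm i 0) (gauss-0ˡ i)

  -- This is 1 - xy = (1 - y) + y (1 - x) for x = q^(c(i+1)) and y = q^(c(j+1)): Pascal's rule
  -- before the division by factorials.
  oneMinus-split : ∀ i j → oneMinus (c ℕ.+ c ℕ.* suc (i ℕ.+ j)) ≈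
    oneMinus (c ℕ.+ c ℕ.* j) ⊕ mono (c ℕ.* suc j) ⊛ oneMinus (c ℕ.+ c ℕ.* i)
  oneMinus-split i j n = sym (trans
    (cong₂ (λ B z → oneS n - B + z) (cong (λ k → mono k n) (sym (ℕP.*-suc c j)))
      (trans (⊛-oneMinus (mono (c ℕ.* suc j)) (c ℕ.+ c ℕ.* i) n)
        (cong (λ z → mono (c ℕ.* suc j) n - z)
          (trans (mono-+ (c ℕ.* suc j) (c ℕ.+ c ℕ.* i) n) (cong (λ k → mono k n) (exponent c i j))))))
    (lemma (oneS n) (mono (c ℕ.* suc j) n) _))
    where
    lemma : ∀ x y z → x - y + (y - z) ≡ x - z
    lemma = ℤ-Solver.solve-∀
    exponent : ∀ c i j → c ℕ.* suc j ℕ.+ (c ℕ.+ c ℕ.* i) ≡ c ℕ.+ c ℕ.* suc (i ℕ.+ j)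
    exponent = ℕ-Solver.solve-∀

  -- The last factor of the numerator is split by `oneMinus-split`, and each summand cancels the
  -- last factor of one of the two denominators.
  gauss-pascal : ∀ i j → gauss (suc i) (suc j) ≈ gauss (suc i) j ⊕ mono (c ℕ.* suc j) ⊛ gauss i (suc j)
  gauss-pascal i j rewrite ℕP.+-suc i j = begin
    R ⊛ oneMinus (c ℕ.+ c ℕ.* suc (i ℕ.+ j)) ⊛ (u ⊛ v)
      ≈⟨ ⊛-congʳ (u ⊛ v) (⊛-congˡ R (oneMinus-split i j)) ⟩
    R ⊛ (y ⊕ B ⊛ x) ⊛ (u ⊛ v)
      ≈⟨ PS-Solver.solve 6 (λ R y B x u v → R :* (y :+ B :* x) :* (u :* v) :=
           R :* (u :* (v :* y)) :+ B :* (R :* ((u :* x) :* v))) ≈-refl R y B x u v ⟩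
    R ⊛ (u ⊛ (v ⊛ y)) ⊕ B ⊛ (R ⊛ ((u ⊛ x) ⊛ v))
      ≈⟨ ⊕-cong (⊛-congˡ R (⊛-congˡ u (invFinPoch-step j)))
           (⊛-congˡ B (⊛-congˡ R (⊛-congʳ v (invFinPoch-step i)))) ⟩
    R ⊛ (u ⊛ invFinPoch j) ⊕ B ⊛ (R ⊛ (invFinPoch i ⊛ v)) ∎
    where
    R = finPoch c (suc (i ℕ.+ j))
    u = invFinPoch (suc i)
    v = invFinPoch (suc j)
    x = oneMinus (c ℕ.+ c ℕ.* i)
    y = oneMinus (c ℕ.+ c ℕ.* j)
    B = mono (c ℕ.* suc j)

  -- The mirror image under exchange of i and j. The first rule serves to enlarge N in
  -- `partialTheta N M`, this one to enlarge M.
  gauss-pascal′ : ∀ i j → gauss (suc i) (suc j) ≈ mono (c ℕ.* suc i) ⊛ gauss (suc i) j ⊕ gauss i (suc j)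
  gauss-pascal′ i j = begin
    gauss (suc i) (suc j)
      ≈⟨ gauss-comm (suc i) (suc j) ⟩
    gauss (suc j) (suc i)
      ≈⟨ gauss-pascal j i ⟩
    gauss (suc j) i ⊕ mono (c ℕ.* suc i) ⊛ gauss j (suc i)
      ≈⟨ ⊕-cong (gauss-comm (suc j) i) (⊛-congˡ (mono (c ℕ.* suc i)) (gauss-comm j (suc i))) ⟩
    gauss i (suc j) ⊕ mono (c ℕ.* suc i) ⊛ gauss (suc i) j
      ≈⟨ ⊕-comm (gauss i (suc j)) _ ⟩
    mono (c ℕ.* suc i) ⊛ gauss (suc i) j ⊕ gauss i (suc j) ∎

  gauss-sum : ℕ → (ℕ → PS) → PS
  gauss-sum m h = psum m (λ k → h k ⊛ gauss k (m ∸ k))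

  suc-∸ : ∀ {k m} → k < m → m ∸ k ≡ suc (m ∸ suc k)
  suc-∸ {zero}  {suc m} _         = refl
  suc-∸ {suc k} {suc m} (s≤s k<m) = suc-∸ k<m

  gauss-sum-suc : ∀ m h → gauss-sum (suc m) h ≈
    gauss-sum m h ⊕ gauss-sum m (λ k → h (suc k) ⊛ mono (c ℕ.* (m ∸ k)))
  gauss-sum-suc m h = psum-interleave m first middle last
    where
    first : h 0 ⊛ gauss 0 (suc m) ≈ h 0 ⊛ gauss 0 m
    first = ⊛-congˡ (h 0) (≈-trans (gauss-0ˡ (suc m)) (≈-sym (gauss-0ˡ m)))
    middle : ∀ k → k < m → h (suc k) ⊛ gauss (suc k) (m ∸ k) ≈
      h (suc k) ⊛ gauss (suc k) (m ∸ suc k) ⊕ h (suc k) ⊛ mono (c ℕ.* (m ∸ k)) ⊛ gauss k (m ∸ k)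
    middle k k<m rewrite suc-∸ k<m = ≈-trans (⊛-congˡ H (gauss-pascal k j))
      (PS-Solver.solve 4 (λ H A B C → H :* (A :+ B :* C) := H :* A :+ H :* B :* C) ≈-refl
        H (gauss (suc k) j) (mono (c ℕ.* suc j)) (gauss k (suc j)))
      where
      H = h (suc k)
      j = m ∸ suc k
    last : h (suc m) ⊛ gauss (suc m) (m ∸ m) ≈ h (suc m) ⊛ mono (c ℕ.* (m ∸ m)) ⊛ gauss m (m ∸ m)
    last rewrite ℕP.n∸n≡0 m | ℕP.*-zeroʳ c = begin
      h (suc m) ⊛ gauss (suc m) 0          ≈⟨ ⊛-congˡ (h (suc m)) (gauss-0ʳ (suc m)) ⟩
      h (suc m) ⊛ oneS                     ≈⟨ ⊛-cong (⊛-identityʳ (h (suc m))) (gauss-0ʳ m) ⟨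
      h (suc m) ⊛ oneS ⊛ gauss m 0         ≈⟨ ⊛-congʳ (gauss m 0) (⊛-congˡ (h (suc m)) mono-0) ⟨
      h (suc m) ⊛ mono 0 ⊛ gauss m 0       ∎

  gauss-sum-suc′ : ∀ m h → gauss-sum (suc m) h ≈
    gauss-sum m (λ k → h k ⊛ mono (c ℕ.* k)) ⊕ gauss-sum m (λ k → h (suc k))
  gauss-sum-suc′ m h = psum-interleave m first middle last
    where
    first : h 0 ⊛ gauss 0 (suc m) ≈ h 0 ⊛ mono (c ℕ.* 0) ⊛ gauss 0 m
    first rewrite ℕP.*-zeroʳ c = begin
      h 0 ⊛ gauss 0 (suc m)      ≈⟨ ⊛-congˡ (h 0) (gauss-0ˡ (suc m)) ⟩
      h 0 ⊛ oneS                 ≈⟨ ⊛-cong (⊛-identityʳ (h 0)) (gauss-0ˡ m) ⟨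
      h 0 ⊛ oneS ⊛ gauss 0 m     ≈⟨ ⊛-congʳ (gauss 0 m) (⊛-congˡ (h 0) mono-0) ⟨
      h 0 ⊛ mono 0 ⊛ gauss 0 m   ∎
    middle : ∀ k → k < m → h (suc k) ⊛ gauss (suc k) (m ∸ k) ≈
      h (suc k) ⊛ mono (c ℕ.* suc k) ⊛ gauss (suc k) (m ∸ suc k) ⊕ h (suc k) ⊛ gauss k (m ∸ k)
    middle k k<m rewrite suc-∸ k<m = ≈-trans (⊛-congˡ H (gauss-pascal′ k j))
      (PS-Solver.solve 4 (λ H A B C → H :* (B :* A :+ C) := H :* B :* A :+ H :* C) ≈-refl
        H (gauss (suc k) j) (mono (c ℕ.* suc k)) (gauss k (suc j)))
      where
      H = h (suc k)
      j = m ∸ suc k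
    last : h (suc m) ⊛ gauss (suc m) (m ∸ m) ≈ h (suc m) ⊛ gauss m (m ∸ m)
    last rewrite ℕP.n∸n≡0 m = ⊛-congˡ (h (suc m)) (≈-trans (gauss-0ʳ (suc m)) (≈-sym (gauss-0ʳ m)))

  thetaTerm : ℤ → PS
  thetaTerm n N = signℤ n * mono (thetaExp n) N

  thetaTerm-mono : ∀ n d → thetaTerm n ⊛ mono d ≈ (λ N → signℤ n * mono (thetaExp n ℕ.+ d) N)
  thetaTerm-mono n d N = trans (⊛-scaleˡ (signℤ n) (mono (thetaExp n)) (mono d) N)
    (cong (signℤ n *_) (mono-+ (thetaExp n) d N))

  thetaTerm-suc : ∀ n d d′ → thetaExp (sucℤ n) ℕ.+ d ≡ thetaExp n ℕ.+ d′ →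
    thetaTerm (sucℤ n) ⊛ mono d ≈ ⊖ (thetaTerm n ⊛ mono d′)
  thetaTerm-suc n d d′ eq N = trans (thetaTerm-mono (sucℤ n) d N)
    (trans (cong₂ (λ s k → s * mono k N) (signℤ-suc n) eq)
      (trans (sym (ℤP.neg-distribˡ-* (signℤ n) _)) (cong -_ (sym (thetaTerm-mono n d′ N)))))

  -- The increment is a + c n. For n = -(p + 1) it equals -(b + c p), so in the natural numbers it
  -- has to be recorded as a decrease.
  thetaExp-suc : ∀ n → (∃ λ p → n ≡ + p × thetaExp (sucℤ n) ≡ thetaExp n ℕ.+ (a ℕ.+ c ℕ.* p))
                     ⊎ (∃ λ p → n ≡ -[1+ p ] × thetaExp n ≡ thetaExp (sucℤ n) ℕ.+ (b ℕ.+ c ℕ.* p))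
  thetaExp-suc (+ p) = inj₁ (p , refl , lemma a c p (triangle p))
    where
    lemma : ∀ a c p t → a ℕ.* suc p ℕ.+ c ℕ.* (t ℕ.+ p) ≡ a ℕ.* p ℕ.+ c ℕ.* t ℕ.+ (a ℕ.+ c ℕ.* p)
    lemma = ℕ-Solver.solve-∀
  thetaExp-suc -[1+ zero ] = inj₂ (0 , refl , lemma a b c)
    where
    lemma : ∀ a b c → b ℕ.* 1 ℕ.+ c ℕ.* 0 ≡ a ℕ.* 0 ℕ.+ c ℕ.* 0 ℕ.+ (b ℕ.+ c ℕ.* 0)
    lemma = ℕ-Solver.solve-∀
  thetaExp-suc -[1+ suc p ] = inj₂ (suc p , refl , lemma b c p (triangle (suc p)))
    where
    lemma : ∀ b c p t → b ℕ.* suc (suc p) ℕ.+ c ℕ.* (t ℕ.+ suc p) ≡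
                        b ℕ.* suc p ℕ.+ c ℕ.* t ℕ.+ (b ℕ.+ c ℕ.* suc p)
    lemma = ℕ-Solver.solve-∀

  -- The exponent grows by a + c (k - M), and the power c (N + M - k) from Pascal's rule removes the
  -- dependence on k. Hence the same power of q comes out of every term of the sum.
  thetaExp-stepˡ : ∀ N M k → k ≤ N ℕ.+ M →
    thetaExp (sucℤ (k ℤ.⊖ M)) ℕ.+ c ℕ.* (N ℕ.+ M ∸ k) ≡ thetaExp (k ℤ.⊖ M) ℕ.+ (a ℕ.+ c ℕ.* N)
  thetaExp-stepˡ N M k k≤ with thetaExp-suc (k ℤ.⊖ M) | ⊖-view k M
  ... | inj₁ (p , eq , step) | inj₁ (p′ , refl , eq′) with trans (sym eq) eq′
  ...   | refl = trans (cong (ℕ._+ c ℕ.* (N ℕ.+ M ∸ (M ℕ.+ p))) step)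
                   (trans (ℕP.+-assoc (thetaExp (M ℕ.+ p ℤ.⊖ M)) _ _)
                     (cong (thetaExp (M ℕ.+ p ℤ.⊖ M) ℕ.+_)
                       (trans (ℕP.+-assoc a _ _) (cong (a ℕ.+_) (trans (sym (ℕP.*-distribˡ-+ c p _))
                         (cong (c ℕ.*_) diff))))))
    where
    diff : p ℕ.+ (N ℕ.+ M ∸ (M ℕ.+ p)) ≡ N
    diff = ℕP.+-cancelˡ-≡ M _ _ (trans (sym (ℕP.+-assoc M p _)) (trans (ℕP.m+[n∸m]≡n k≤) (ℕP.+-comm N M)))
  thetaExp-stepˡ N M k k≤ | inj₂ (p , eq , step) | inj₂ (p′ , refl , eq′) with trans (sym eq) eq′
  ... | refl rewrite step = trans (cong (λ d → E ℕ.+ c ℕ.* d) diff) (lemma a b E N p)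
    where
    E = thetaExp (sucℤ (k ℤ.⊖ suc (k ℕ.+ p)))
    lemma : ∀ a b E N p → E ℕ.+ (a ℕ.+ b) ℕ.* (N ℕ.+ suc p) ≡
      E ℕ.+ (b ℕ.+ (a ℕ.+ b) ℕ.* p) ℕ.+ (a ℕ.+ (a ℕ.+ b) ℕ.* N)
    lemma = ℕ-Solver.solve-∀
    arrange : ∀ N k p → N ℕ.+ suc (k ℕ.+ p) ≡ k ℕ.+ (N ℕ.+ suc p)
    arrange = ℕ-Solver.solve-∀
    diff : N ℕ.+ suc (k ℕ.+ p) ∸ k ≡ N ℕ.+ suc p
    diff = trans (cong (_∸ k) (arrange N k p)) (ℕP.m+n∸m≡n k _)
  thetaExp-stepˡ N M k k≤ | inj₁ (p , eq , step) | inj₂ (p′ , _ , eq′) with trans (sym eq) eq′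
  ... | ()
  thetaExp-stepˡ N M k k≤ | inj₂ (p , eq , step) | inj₁ (p′ , _ , eq′) with trans (sym eq) eq′
  ... | ()

  thetaExp-stepʳ : ∀ M k →
    thetaExp (sucℤ (k ℤ.⊖ suc M)) ℕ.+ (b ℕ.+ c ℕ.* M) ≡ thetaExp (k ℤ.⊖ suc M) ℕ.+ c ℕ.* k
  thetaExp-stepʳ M k with thetaExp-suc (k ℤ.⊖ suc M) | ⊖-view k (suc M)
  ... | inj₁ (p , eq , step) | inj₁ (p′ , refl , eq′) with trans (sym eq) eq′
  ...   | refl rewrite step = lemma a b (thetaExp (suc (M ℕ.+ p) ℤ.⊖ suc M)) M p
    where
    lemma : ∀ a b E M p → E ℕ.+ (a ℕ.+ (a ℕ.+ b) ℕ.* p) ℕ.+ (b ℕ.+ (a ℕ.+ b) ℕ.* M) ≡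
                          E ℕ.+ (a ℕ.+ b) ℕ.* suc (M ℕ.+ p)
    lemma = ℕ-Solver.solve-∀
  thetaExp-stepʳ M k | inj₂ (p , eq , step) | inj₂ (p′ , refl , eq′) with trans (sym eq) eq′
  ... | refl rewrite step = lemma b c (thetaExp (sucℤ (k ℤ.⊖ suc (k ℕ.+ p)))) k p
    where
    lemma : ∀ b c E k p → E ℕ.+ (b ℕ.+ c ℕ.* (k ℕ.+ p)) ≡ E ℕ.+ (b ℕ.+ c ℕ.* p) ℕ.+ c ℕ.* k
    lemma = ℕ-Solver.solve-∀
  thetaExp-stepʳ M k | inj₁ (p , eq , step) | inj₂ (p′ , _ , eq′) with trans (sym eq) eq′
  ... | ()
  thetaExp-stepʳ M k | inj₂ (p , eq , step) | inj₁ (p′ , _ , eq′) with trans (sym eq) eq′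
  ... | ()

  -- The theta series cut to -M ≤ n ≤ N, each term multiplied by the Gaussian binomial
  -- [N + M choose M + n]; the summation index is k = n + M.
  partialTheta : ℕ → ℕ → PS
  partialTheta N M = gauss-sum (N ℕ.+ M) (λ k → thetaTerm (k ℤ.⊖ M))

  gauss-sum-⊖⊛ : ∀ m h f d → (∀ k → k ≤ m → f k ≈ ⊖ (h k ⊛ mono d)) →
    gauss-sum m f ≈ ⊖ (gauss-sum m h ⊛ mono d)
  gauss-sum-⊖⊛ m h f d eq = begin
    psum m (λ k → f k ⊛ gauss k (m ∸ k))
      ≈⟨ psum-cong≤ m (λ k k≤m → ≈-trans (⊛-congʳ (gauss k (m ∸ k)) (eq k k≤m)) (move k)) ⟩
    psum m (λ k → ⊖ (h k ⊛ gauss k (m ∸ k) ⊛ mono d))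
      ≈⟨ psum-⊖ m _ ⟩
    ⊖ psum m (λ k → h k ⊛ gauss k (m ∸ k) ⊛ mono d)
      ≈⟨ (λ n → cong -_ (psum-⊛ʳ m (λ k → h k ⊛ gauss k (m ∸ k)) (mono d) n)) ⟩
    ⊖ (gauss-sum m h ⊛ mono d) ∎
    where
    move : ∀ k → ⊖ (h k ⊛ mono d) ⊛ gauss k (m ∸ k) ≈ ⊖ (h k ⊛ gauss k (m ∸ k) ⊛ mono d)
    move k = ≈-trans (≈-sym (-‿distribˡ-* (h k ⊛ mono d) (gauss k (m ∸ k))))
      (λ n → cong -_ (PS-Solver.solve 3 (λ x y z → x :* y :* z := x :* z :* y) ≈-refl
        (h k) (mono d) (gauss k (m ∸ k)) n))

  partialTheta-sucˡ : ∀ N M → partialTheta (suc N) M ≈ partialTheta N M ⊛ oneMinus (a ℕ.+ c ℕ.* N)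
  partialTheta-sucˡ N M = begin
    gauss-sum (suc (N ℕ.+ M)) h
      ≈⟨ gauss-sum-suc (N ℕ.+ M) h ⟩
    gauss-sum (N ℕ.+ M) h ⊕ gauss-sum (N ℕ.+ M) (λ k → h (suc k) ⊛ mono (c ℕ.* (N ℕ.+ M ∸ k)))
      ≈⟨ ⊕-cong (≈-refl {gauss-sum (N ℕ.+ M) h}) (gauss-sum-⊖⊛ (N ℕ.+ M) h _ (a ℕ.+ c ℕ.* N) shift) ⟩
    gauss-sum (N ℕ.+ M) h ⊕ (⊖ (gauss-sum (N ℕ.+ M) h ⊛ mono (a ℕ.+ c ℕ.* N)))
      ≈⟨ ⊛-oneMinus (gauss-sum (N ℕ.+ M) h) (a ℕ.+ c ℕ.* N) ⟨
    gauss-sum (N ℕ.+ M) h ⊛ oneMinus (a ℕ.+ c ℕ.* N) ∎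
    where
    h : ℕ → PS
    h k = thetaTerm (k ℤ.⊖ M)
    shift : ∀ k → k ≤ N ℕ.+ M → h (suc k) ⊛ mono (c ℕ.* (N ℕ.+ M ∸ k)) ≈ ⊖ (h k ⊛ mono (a ℕ.+ c ℕ.* N))
    shift k k≤ rewrite suc-⊖-sucℤ k M = thetaTerm-suc (k ℤ.⊖ M) _ _ (thetaExp-stepˡ N M k k≤)

  -- Enlarging M lowers all theta indices by one. The shifted half of Pascal's rule is therefore the
  -- old sum, and the unshifted half carries the new power of q.
  partialTheta-sucʳ : ∀ N M → partialTheta N (suc M) ≈ partialTheta N M ⊛ oneMinus (b ℕ.+ c ℕ.* M)
  partialTheta-sucʳ N M rewrite ℕP.+-suc N M = begin
    gauss-sum (suc m) h
      ≈⟨ gauss-sum-suc′ m h ⟩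
    gauss-sum m (λ k → h k ⊛ mono (c ℕ.* k)) ⊕ gauss-sum m (λ k → h (suc k))
      ≈⟨ ⊕-comm (gauss-sum m (λ k → h k ⊛ mono (c ℕ.* k))) (gauss-sum m (λ k → h (suc k))) ⟩
    gauss-sum m (λ k → h (suc k)) ⊕ gauss-sum m (λ k → h k ⊛ mono (c ℕ.* k))
      ≈⟨ ⊕-cong (psum-cong≤ m (λ k _ → ⊛-congʳ (gauss k (m ∸ k)) (same k)))
           (gauss-sum-⊖⊛ m h′ _ (b ℕ.+ c ℕ.* M) (λ k _ → shift k)) ⟩
    gauss-sum m h′ ⊕ (⊖ (gauss-sum m h′ ⊛ mono (b ℕ.+ c ℕ.* M)))
      ≈⟨ ⊛-oneMinus (gauss-sum m h′) (b ℕ.+ c ℕ.* M) ⟨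
    gauss-sum m h′ ⊛ oneMinus (b ℕ.+ c ℕ.* M) ∎
    where
    m = N ℕ.+ M
    h : ℕ → PS
    h k = thetaTerm (k ℤ.⊖ suc M)
    h′ : ℕ → PS
    h′ k = thetaTerm (k ℤ.⊖ M)
    same : ∀ k → h (suc k) ≈ h′ k
    same k n = cong (λ i → thetaTerm i n) (ℤP.[1+m]⊖[1+n]≡m⊖n k M)
    shift : ∀ k → h k ⊛ mono (c ℕ.* k) ≈ ⊖ (h′ k ⊛ mono (b ℕ.+ c ℕ.* M))
    shift k n = trans (sym (ℤP.neg-involutive _)) (cong -_ (sym (trans
      (cong (λ i → (thetaTerm i ⊛ mono (b ℕ.+ c ℕ.* M)) n)
        (trans (sym (ℤP.[1+m]⊖[1+n]≡m⊖n k M)) (suc-⊖-sucℤ k (suc M))))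
      (thetaTerm-suc (k ℤ.⊖ suc M) _ _ (thetaExp-stepʳ M k) n))))

  finite-triple-product : ∀ N M → finPoch a N ⊛ finPoch b M ≈ partialTheta N M
  finite-triple-product zero    zero    = begin
    oneS ⊛ oneS                       ≈⟨ ⊛-cong one (gauss-0ˡ 0) ⟨
    thetaTerm (+ 0) ⊛ gauss 0 0       ∎
    where
    one : thetaTerm (+ 0) ≈ oneS
    one N rewrite ℕP.*-zeroʳ a | ℕP.*-zeroʳ c = trans (ℤP.*-identityˡ (mono 0 N)) (mono-0 N)
  finite-triple-product (suc N) zero    = begin
    finPoch a N ⊛ x ⊛ oneS            ≈⟨ PS-Solver.solve 3 (λ f x o → f :* x :* o := f :* o :* x) ≈-refl (finPoch a N) x oneS ⟩
    finPoch a N ⊛ oneS ⊛ x            ≈⟨ ⊛-congʳ x (finite-triple-product N zero) ⟩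
    partialTheta N 0 ⊛ x              ≈⟨ partialTheta-sucˡ N 0 ⟨
    partialTheta (suc N) 0            ∎
    where x = oneMinus (a ℕ.+ c ℕ.* N)
  finite-triple-product N       (suc M) = begin
    finPoch a N ⊛ (finPoch b M ⊛ x)   ≈⟨ ⊛-assoc (finPoch a N) (finPoch b M) x ⟨
    finPoch a N ⊛ finPoch b M ⊛ x     ≈⟨ ⊛-congʳ x (finite-triple-product N M) ⟩
    partialTheta N M ⊛ x              ≈⟨ partialTheta-sucʳ N M ⟨
    partialTheta N (suc M)            ∎
    where x = oneMinus (b ℕ.+ c ℕ.* M)

  -- Up to degree r the numerator agrees with `finPoch c j` and `poch c c` with `finPoch c i`, and
  -- these cancel the two denominators exactly. This makes precise that Gaussian binomials tend to
  -- 1/(q^c;q^c)∞.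
  gauss⊛poch : ∀ i j {r} → r < c ℕ.+ c ℕ.* i → r < c ℕ.+ c ℕ.* j → (gauss i j ⊛ poch c c) r ≡ oneS r
  gauss⊛poch i j {r} r<i r<j =
    trans (≈[]-⊛ {r} (≈[]-⊛ {r} lower (≈⇒≈[] (≈-refl {I}))) (λ k k≤r → poch-finPoch c 1≤c i (ℕP.≤-<-trans k≤r r<i))
            r ℕP.≤-refl)
      (cancel r)
    where
    I = invFinPoch i ⊛ invFinPoch j
    lower : finPoch c (i ℕ.+ j) ≈[ r ] finPoch c j
    lower k k≤r = finPoch-stable c j i (ℕP.≤-<-trans k≤r r<j)
    cancel : finPoch c j ⊛ I ⊛ finPoch c i ≈ oneS
    cancel = begin
      finPoch c j ⊛ I ⊛ finPoch c i
        ≈⟨ PS-Solver.solve 4 (λ F u v G → F :* (u :* v) :* G := (F :* v) :* (G :* u)) ≈-refl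
             (finPoch c j) (invFinPoch i) (invFinPoch j) (finPoch c i) ⟩
      (finPoch c j ⊛ invFinPoch j) ⊛ (finPoch c i ⊛ invFinPoch i)
        ≈⟨ ⊛-cong (finPoch-inverse j) (finPoch-inverse i) ⟩
      oneS ⊛ oneS
        ≈⟨ ⊛-identityˡ oneS ⟩
      oneS ∎

  -- After the shift by E = `thetaExp n` only degree r = N - E of the Gaussian binomial matters, and
  -- |n| ≤ E keeps r small enough for `gauss⊛poch`.
  thetaTerm-limit : ∀ D k {N} → N ≤ D → k ≤ D ℕ.+ D →
    (thetaTerm (k ℤ.⊖ D) ⊛ gauss k (D ℕ.+ D ∸ k) ⊛ poch c c) N ≡ thetaTerm (k ℤ.⊖ D) N
  thetaTerm-limit D k {N} N≤D k≤ =
    trans (⊛-assoc (thetaTerm n) g (poch c c) N)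
      (trans (⊛-scaleˡ (signℤ n) (mono E) (g ⊛ poch c c) N) (cong (signℤ n *_) cases))
    where
    n = k ℤ.⊖ D
    E = thetaExp n
    g = gauss k (D ℕ.+ D ∸ k)
    -- The entries of the Gaussian binomial are D + n and D - n, both at least r when |n| + r ≤ D.
    bounds : ∀ {r} → ℤ.∣ n ∣ ℕ.+ r ≤ D → r ≤ k × r ≤ D ℕ.+ D ∸ k
    bounds {r} h with ⊖-view k D
    ... | inj₁ (p , refl , eq) rewrite eq =
      ℕP.≤-trans (ℕP.m≤n+m r p) (ℕP.≤-trans h (ℕP.m≤m+n D p)) ,
      subst (r ≤_) (sym (ℕP.[m+n]∸[m+o]≡n∸o D D p)) (ℕP.m+n≤o⇒m≤o∸n r (subst (_≤ D) (ℕP.+-comm p r) h))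
    ... | inj₂ (p , refl , eq) rewrite eq =
      ℕP.+-cancelˡ-≤ (suc p) r k (subst (suc p ℕ.+ r ≤_) (cong suc (ℕP.+-comm k p)) h) ,
      ℕP.≤-trans (ℕP.≤-trans (ℕP.m≤n+m r (suc p)) h)
        (subst (D ≤_) (sym (ℕP.+-∸-assoc D (ℕP.m≤n⇒m≤1+n (ℕP.m≤m+n k p)))) (ℕP.m≤m+n D _))
    cases : (mono E ⊛ (g ⊛ poch c c)) N ≡ mono E N
    cases with ℕP.<-≤-connex N E
    ... | inj₁ N<E = trans (mono-vanish E (g ⊛ poch c c) N<E) (sym (mono-below E N<E))
    ... | inj₂ E≤N with N ∸ E | ℕP.m+[n∸m]≡n E≤N
    ...   | r | refl = trans (mono-shift E (g ⊛ poch c c) r)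
        (trans (gauss⊛poch k (D ℕ.+ D ∸ k)
                  (ℕP.≤-<-trans (proj₁ b′) (progression> c c 1≤c 1≤c k))
                  (ℕP.≤-<-trans (proj₂ b′) (progression> c c 1≤c 1≤c (D ℕ.+ D ∸ k))))
          (sym (trans (mono-self E r) (mono-0 r))))
      where b′ = bounds (ℕP.≤-trans (ℕP.+-monoˡ-≤ r (∣n∣≤thetaExp n)) N≤D)

  triple-product : ∀ D {N} → N ≤ D →
    (poch a c ⊛ poch b c ⊛ poch c c) N ≡ sumTo (D ℕ.+ D) (λ k → thetaTerm (k ℤ.⊖ D) N)
  triple-product D {N} N≤D =
    trans (≈[]-⊛ {D} (≈[]-⊛ {D} (λ k k≤D → poch-finPoch a 1≤a D (ℕP.≤-<-trans k≤D (progression> a c 1≤a 1≤c D)))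
                                (λ k k≤D → poch-finPoch b 1≤b D (ℕP.≤-<-trans k≤D (progression> b c 1≤b 1≤c D))))
             (≈⇒≈[] (≈-refl {poch c c})) N N≤D)
    (trans (⊛-congʳ (poch c c) (finite-triple-product D D) N)
    (trans (sym (psum-⊛ʳ (D ℕ.+ D) (λ k → thetaTerm (k ℤ.⊖ D) ⊛ gauss k (D ℕ.+ D ∸ k)) (poch c c) N))
    (trans (psum-coeff (D ℕ.+ D) _ N)
      (sumTo-cong≤ (D ℕ.+ D) (λ k k≤ → thetaTerm-limit D k N≤D k≤)))))

-- Finitely supported sums

private variable
  I J : Set
  P Q : Set

ind : Dec P → ℤ
ind d = if does d then + 1 else + 0

ind-yes : (d : Dec P) → P → ind d ≡ + 1
ind-yes (yes _) p = refl
ind-yes (no ¬p) p = contradiction p ¬p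

ind-no : (d : Dec P) → ¬ P → ind d ≡ + 0
ind-no (yes p) ¬p = contradiction p ¬p
ind-no (no _)  ¬p = refl

ind-cong : (d : Dec P) (e : Dec Q) → (P → Q) → (Q → P) → ind d ≡ ind e
ind-cong (yes p) e f g = sym (ind-yes e (f p))
ind-cong (no ¬p) e f g = sym (ind-no e (¬p ∘ g))

ind≢0 : (d : Dec P) → ind d ≢ + 0 → P
ind≢0 (yes p) _ = p
ind≢0 (no _)  h = contradiction refl h

*≢0ˡ : ∀ x y → x * y ≢ + 0 → x ≢ + 0
*≢0ˡ x y h refl = h refl

*≢0ʳ : ∀ x y → x * y ≢ + 0 → y ≢ + 0
*≢0ʳ x y h refl = h (ℤP.*-zeroʳ x)

sumOver : List I → (I → ℤ) → ℤ
sumOver []       f = + 0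
sumOver (x ∷ xs) f = f x + sumOver xs f

sumOver-cong : ∀ (xs : List I) {f g} → (∀ i → f i ≡ g i) → sumOver xs f ≡ sumOver xs g
sumOver-cong []       h = refl
sumOver-cong (x ∷ xs) h = cong₂ _+_ (h x) (sumOver-cong xs h)

sumOver-0 : ∀ (xs : List I) {f} → (∀ i → f i ≡ + 0) → sumOver xs f ≡ + 0
sumOver-0 []       h = refl
sumOver-0 (x ∷ xs) h = cong₂ _+_ (h x) (sumOver-0 xs h)

sumOver-+ : ∀ (xs : List I) f g → sumOver xs (λ i → f i + g i) ≡ sumOver xs f + sumOver xs g
sumOver-+ []       f g = refl
sumOver-+ (x ∷ xs) f g = trans (cong (λ z → f x + g x + z) (sumOver-+ xs f g)) (lemma (f x) (g x) (sumOver xs f) (sumOver xs g))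
  where
  lemma : ∀ a b c d → (a + b) + (c + d) ≡ (a + c) + (b + d)
  lemma = ℤ-Solver.solve-∀

sumOver-*ˡ : ∀ (xs : List I) c f → sumOver xs (λ i → c * f i) ≡ c * sumOver xs f
sumOver-*ˡ []       c f = sym (ℤP.*-zeroʳ c)
sumOver-*ˡ (x ∷ xs) c f =
  trans (cong (λ z → c * f x + z) (sumOver-*ˡ xs c f)) (sym (ℤP.*-distribˡ-+ c (f x) _))

sumOver-neg : ∀ (xs : List I) f → sumOver xs (λ i → - f i) ≡ - sumOver xs f
sumOver-neg []       f = refl
sumOver-neg (x ∷ xs) f = trans (cong (λ z → - f x + z) (sumOver-neg xs f)) (sym (ℤP.neg-distrib-+ (f x) _))

sumOver-swap : ∀ (xs : List I) (ys : List J) (f : I → J → ℤ) →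
  sumOver xs (λ i → sumOver ys (f i)) ≡ sumOver ys (λ j → sumOver xs (λ i → f i j))
sumOver-swap []       ys f = sym (sumOver-0 ys (λ _ → refl))
sumOver-swap (x ∷ xs) ys f =
  trans (cong (λ z → sumOver ys (f x) + z) (sumOver-swap xs ys f)) (sym (sumOver-+ ys (f x) _))

sumOver-map : ∀ (g : I → J) xs f → sumOver (map g xs) f ≡ sumOver xs (f ∘ g)
sumOver-map g []       f = refl
sumOver-map g (x ∷ xs) f = cong (λ z → f (g x) + z) (sumOver-map g xs f)

sumOver-absent : ∀ (xs : List I) {f} → All (λ i → f i ≡ + 0) xs → sumOver xs f ≡ + 0
sumOver-absent []       []       = refl
sumOver-absent (x ∷ xs) (p ∷ ps) = cong₂ _+_ p (sumOver-absent xs ps)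

sumOver-single : ∀ {xs : List I} {f} c → Unique xs → c ∈ xs → (∀ i → i ≢ c → f i ≡ + 0) → sumOver xs f ≡ f c
sumOver-single {xs = x ∷ xs} {f} c (x∉ ∷ _) (here refl) h =
  trans (cong (λ z → f x + z) (sumOver-absent xs (All.map (λ x≢i → h _ (x≢i ∘ sym)) x∉))) (ℤP.+-identityʳ (f x))
sumOver-single {xs = x ∷ xs} {f} c (x∉ ∷ u) (there c∈) h =
  trans (cong₂ _+_ (h x (All.lookup x∉ c∈)) (sumOver-single c u c∈ h)) (ℤP.+-identityˡ (f c))

-- Both sides equal the double sum of [φ i = j] G(j).
sumOver-reindex : DecidableEquality J → {xs : List I} {ys : List J} → Unique xs → Unique ys →
  (φ : I → J) {F : I → ℤ} {G : J → ℤ} → (∀ i → F i ≡ G (φ i)) → (∀ {i i′} → φ i ≡ φ i′ → i ≡ i′) →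
  (∀ j → G j ≢ + 0 → j ∈ ys × ∃ λ i → φ i ≡ j × i ∈ xs) → sumOver xs F ≡ sumOver ys G
sumOver-reindex _≟_ {xs} {ys} uxs uys φ {F} {G} FG inj cover = begin
  sumOver xs F                             ≡⟨ sumOver-cong xs (λ i → sym (row i)) ⟩
  sumOver xs (λ i → sumOver ys (δ i))      ≡⟨ sumOver-swap xs ys δ ⟩
  sumOver ys (λ j → sumOver xs (λ i → δ i j)) ≡⟨ sumOver-cong ys column ⟩
  sumOver ys G                             ∎
  where
  open ≡-Reasoning
  δ : _ → _ → ℤ
  δ i j = ind (φ i ≟ j) * G j
  δ-off : ∀ {i j} → φ i ≢ j → δ i j ≡ + 0
  δ-off {i} {j} ne = cong (_* G j) (ind-no (φ i ≟ j) ne)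
  δ-on : ∀ {i j} → φ i ≡ j → δ i j ≡ G j
  δ-on {i} {j} eq = trans (cong (_* G j) (ind-yes (φ i ≟ j) eq)) (ℤP.*-identityˡ (G j))
  δ-0 : ∀ {i j} → G j ≡ + 0 → δ i j ≡ + 0
  δ-0 {i} {j} eq = trans (cong (ind (φ i ≟ j) *_) eq) (ℤP.*-zeroʳ (ind (φ i ≟ j)))
  row : ∀ i → sumOver ys (δ i) ≡ F i
  -- `cover` places φ i in ys only where G does not vanish; where G vanishes, both sides are 0
  -- wherever φ i lies.
  row i with G (φ i) ℤ.≟ + 0
  ... | yes z = trans (sumOver-0 ys vanish) (sym (trans (FG i) z))
    where
    vanish : ∀ j → δ i j ≡ + 0
    vanish j with φ i ≟ j
    ... | yes refl = trans (ℤP.*-identityˡ (G (φ i))) z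
    ... | no _     = refl
  ... | no nz = trans (sumOver-single (φ i) uys (proj₁ (cover (φ i) nz)) (λ j ne → δ-off (ne ∘ sym)))
                  (trans (δ-on refl) (sym (FG i)))
  column : ∀ j → sumOver xs (λ i → δ i j) ≡ G j
  column j with G j ℤ.≟ + 0
  ... | yes z = trans (sumOver-0 xs (λ i → δ-0 {i} z)) (sym z)
  ... | no nz with cover j nz
  ...   | _ , i , φi≡j , i∈xs = trans
    (sumOver-single i uxs i∈xs (λ i′ ne → δ-off (λ eq → ne (inj (trans eq (sym φi≡j)))))) (δ-on φi≡j)

downTo : ℕ → List ℕ
downTo zero    = 0 ∷ []
downTo (suc n) = suc n ∷ downTo n

∈-downTo : ∀ {k n} → k ≤ n → k ∈ downTo n
∈-downTo {n = zero}  z≤n = here refl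
∈-downTo {k} {suc n} k≤ with k ℕ.≟ suc n
... | yes refl = here refl
... | no ne    = there (∈-downTo (ℕP.≤-pred (ℕP.≤∧≢⇒< k≤ ne)))

downTo-< : ∀ {m} n → n < m → All (m ≢_) (downTo n)
downTo-< zero    n<m = (λ { refl → ℕP.<-irrefl refl n<m }) ∷ []
downTo-< (suc n) n<m = (λ { refl → ℕP.<-irrefl refl n<m }) ∷ downTo-< n (ℕP.<-trans (ℕP.n<1+n n) n<m)

downTo-unique : ∀ n → Unique (downTo n)
downTo-unique zero    = [] ∷ []
downTo-unique (suc n) = downTo-< n (ℕP.n<1+n n) ∷ downTo-unique n

sumTo-downTo : ∀ n f → sumTo n f ≡ sumOver (downTo n) f
sumTo-downTo zero    f = sym (ℤP.+-identityʳ (f 0))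
sumTo-downTo (suc n) f = trans (ℤP.+-comm _ (f (suc n))) (cong (λ z → f (suc n) + z) (sumTo-downTo n f))

interval : ℕ → List ℤ
interval D = map (ℤ._⊖ D) (downTo (D ℕ.+ D))

⊖-recover : ∀ k D → k ℤ.⊖ D + + D ≡ + k
⊖-recover k D = trans (cong (_+ + D) (sym (ℤP.m-n≡m⊖n k D))) (lemma (+ k) (+ D))
  where
  lemma : ∀ x y → x - y + y ≡ x
  lemma = ℤ-Solver.solve-∀

interval-unique : ∀ D → Unique (interval D)
interval-unique D = map⁺ inj (downTo-unique (D ℕ.+ D))
  where
  inj : ∀ {k l} → k ℤ.⊖ D ≡ l ℤ.⊖ D → k ≡ l
  inj {k} {l} eq = ℤP.+-injective (trans (sym (⊖-recover k D)) (trans (cong (_+ + D) eq) (⊖-recover l D)))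

∈-interval : ∀ {D} x → ℤ.∣ x ∣ ≤ D → x ∈ interval D
∈-interval {D} (+ n) n≤D =
  subst (_∈ interval D) (trans (ℤP.⊖-≥ (ℕP.m≤n+m D n)) (cong +_ (ℕP.m+n∸n≡m n D)))
    (∈-map⁺ (ℤ._⊖ D) (∈-downTo (ℕP.+-monoˡ-≤ D n≤D)))
∈-interval {D} -[1+ n ] n<D =
  subst (_∈ interval D) (trans (ℤP.⊖-≤ (ℕP.m∸n≤m D (suc n))) (cong (λ k → - + k) (ℕP.m∸[m∸n]≡n n<D)))
    (∈-map⁺ (ℤ._⊖ D) (∈-downTo (ℕP.≤-trans (ℕP.m∸n≤m D (suc n)) (ℕP.m≤m+n D D))))

sumℤ : ℕ → (ℤ → ℤ) → ℤ
sumℤ D = sumOver (interval D)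

sumTo-⊖ : ∀ D f → sumTo (D ℕ.+ D) (λ k → f (k ℤ.⊖ D)) ≡ sumℤ D f
sumTo-⊖ D f = trans (sumTo-downTo (D ℕ.+ D) _) (sym (sumOver-map (ℤ._⊖ D) (downTo (D ℕ.+ D)) f))

-- All sums run over one fixed box, so a change of variables is justified only if the summand
-- vanishes outside the box both before and after it. This is why the lemmas below ask for two such
-- bounds.
SupportedIn : ℕ → (ℤ → ℤ) → Set
SupportedIn D f = ∀ x → f x ≢ + 0 → ℤ.∣ x ∣ ≤ D

sumℤ-reindex : ∀ {D} (φ : ℤ → ℤ) {F G : ℤ → ℤ} → (∀ i → F i ≡ G (φ i)) → (∀ {i i′} → φ i ≡ φ i′ → i ≡ i′) →
  (∀ j → G j ≢ + 0 → ∃ λ i → φ i ≡ j) → SupportedIn D F → SupportedIn D G → sumℤ D F ≡ sumℤ D G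
sumℤ-reindex {D} φ {F} FG inj surj F-supp G-supp =
  sumOver-reindex ℤ._≟_ (interval-unique D) (interval-unique D) φ FG inj λ j nz →
    ∈-interval j (G-supp j nz) , cover j nz
  where
  cover : ∀ j → _ → _
  cover j nz with surj j nz
  ... | i , refl = i , refl , ∈-interval i (F-supp i (λ z → nz (trans (sym (FG i)) z)))

sumℤ-reflect : ∀ {D} c {f : ℤ → ℤ} → SupportedIn D f → SupportedIn D (λ x → f (c - x)) →
  sumℤ D (λ x → f (c - x)) ≡ sumℤ D f
sumℤ-reflect c s s′ = sumℤ-reindex (λ x → c - x) (λ _ → refl)
  (λ {i} {i′} eq → trans (sym (lemma c i)) (trans (cong (λ z → c - z) eq) (lemma c i′)))
  (λ j _ → c - j , lemma c j) s′ s
  where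
  lemma : ∀ c j → c - (c - j) ≡ j
  lemma = ℤ-Solver.solve-∀


self-neg⇒0 : ∀ {x} → x ≡ - x → x ≡ + 0
self-neg⇒0 {+ zero} _ = refl

sumℤ-antisymmetric : ∀ {D} c {f : ℤ → ℤ} → SupportedIn D f → SupportedIn D (λ x → f (c - x)) →
  (∀ x → f (c - x) ≡ - f x) → sumℤ D f ≡ + 0
sumℤ-antisymmetric {D} c {f} s s′ anti = self-neg⇒0 (trans (sym (sumℤ-reflect c s s′))
  (trans (sumOver-cong (interval D) anti) (sumOver-neg (interval D) f)))

sumℤ-translate : ∀ {D} c {f : ℤ → ℤ} → SupportedIn D f → SupportedIn D (λ x → f (x - c)) →
  sumℤ D (λ x → f (x - c)) ≡ sumℤ D f
sumℤ-translate c s s′ = sumℤ-reindex (λ x → x - c) (λ _ → refl)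
  (λ {i} {i′} eq → trans (sym (lemma c i)) (trans (cong (_+ c) eq) (lemma c i′)))
  (λ j _ → j + c , lemma′ c j) s′ s
  where
  lemma : ∀ c j → j - c + c ≡ j
  lemma = ℤ-Solver.solve-∀
  lemma′ : ∀ c j → j + c - c ≡ j
  lemma′ = ℤ-Solver.solve-∀

∣k∣≤∣c*k∣ : ∀ c .{{_ : ℤ.NonZero c}} k → ℤ.∣ k ∣ ≤ ℤ.∣ c * k ∣
∣k∣≤∣c*k∣ c k = subst (ℤ.∣ k ∣ ≤_) (sym (ℤP.abs-* c k)) (ℕP.m≤n*m ℤ.∣ k ∣ ℤ.∣ c ∣)

+ℤ-cancelˡ : ∀ d x y → d + x ≡ d + y → x ≡ y
+ℤ-cancelˡ d x y eq = trans (sym (lemma d x)) (trans (cong (_- d) eq) (lemma d y))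
  where
  lemma : ∀ d x → d + x - d ≡ x
  lemma = ℤ-Solver.solve-∀

-- The indicator of the class of d splits f into two parts. The second class is parametrised
-- downwards, as e - c m, so that negation or the swap of u and t matches its m-th member with the
-- m-th member of the first.
sumℤ-two-classes : ∀ {D} (c : ℤ) .{{_ : ℤ.NonZero c}} (d e : ℤ) → ¬ (c ∣ℤ.∣ e - d) → {f : ℤ → ℤ} →
  (∀ x → f x ≢ + 0 → c ∣ℤ.∣ x - d ⊎ c ∣ℤ.∣ x - e) →
  SupportedIn D f → SupportedIn D (λ m → f (d + c * m)) → SupportedIn D (λ m → f (e - c * m)) →
  sumℤ D f ≡ sumℤ D (λ m → f (d + c * m)) + sumℤ D (λ m → f (e - c * m))
sumℤ-two-classes {D} c d e e≢d {f} classes supp supp-d supp-e = begin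
  sumℤ D f                                     ≡⟨ sumOver-cong (interval D) (λ x → split (χ x) (f x)) ⟩
  sumℤ D (λ x → f₁ x + f₂ x)                   ≡⟨ sumOver-+ (interval D) f₁ f₂ ⟩
  sumℤ D f₁ + sumℤ D f₂                        ≡⟨ cong₂ _+_ first second ⟨
  sumℤ D (λ m → f (d + c * m)) + sumℤ D (λ m → f (e - c * m)) ∎
  where
  open ≡-Reasoning
  χ f₁ f₂ : ℤ → ℤ
  χ x = ind (c ∣ℤ.∣? (x - d))
  f₁ x = χ x * f x
  f₂ x = (+ 1 - χ x) * f x
  split : ∀ χ y → y ≡ χ * y + (+ 1 - χ) * y
  split = ℤ-Solver.solve-∀
  cancel : ∀ x c m → x + c * m - x ≡ m * c
  cancel = ℤ-Solver.solve-∀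
  first : sumℤ D (λ m → f (d + c * m)) ≡ sumℤ D f₁
  first = sumℤ-reindex (λ m → d + c * m)
    (λ m → sym (trans (cong (_* f (d + c * m)) (ind-yes (c ∣ℤ.∣? (d + c * m - d)) (divides m (cancel d c m))))
      (ℤP.*-identityˡ _)))
    (λ {i} {i′} eq → ℤP.*-cancelˡ-≡ c i i′ (+ℤ-cancelˡ d (c * i) (c * i′) eq))
    (λ x nz → preimage x (ind≢0 (c ∣ℤ.∣? (x - d)) (*≢0ˡ (χ x) (f x) nz)))
    supp-d (λ x nz → supp x (*≢0ʳ (χ x) (f x) nz))
    where
    preimage : ∀ x → c ∣ℤ.∣ x - d → ∃ λ m → d + c * m ≡ x
    preimage x (divides m eq) = m , trans (cong (λ z → d + z) (trans (ℤP.*-comm c m) (sym eq))) (lemma d x)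
      where
      lemma : ∀ d x → d + (x - d) ≡ x
      lemma = ℤ-Solver.solve-∀
  second : sumℤ D (λ m → f (e - c * m)) ≡ sumℤ D f₂
  second = sumℤ-reindex (λ m → e - c * m)
    (λ m → sym (trans (cong (λ z → (+ 1 - z) * f (e - c * m)) (ind-no (c ∣ℤ.∣? (e - c * m - d)) (off m)))
      (ℤP.*-identityˡ _)))
    (λ {i} {i′} eq → ℤP.*-cancelˡ-≡ c i i′ (ℤP.neg-injective (+ℤ-cancelˡ e (- (c * i)) (- (c * i′)) eq)))
    (λ x nz → preimage x nz (classes x (*≢0ʳ (+ 1 - χ x) (f x) nz)))
    supp-e (λ x nz → supp x (*≢0ʳ (+ 1 - χ x) (f x) nz))
    where
    off : ∀ m → ¬ (c ∣ℤ.∣ e - c * m - d)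
    off m (divides q eq) = e≢d (divides (q + m) (trans (lemma e c m d) (trans (cong (_+ m * c) eq) (sym (ℤP.*-distribʳ-+ c q m)))))
      where
      lemma : ∀ e c m d → e - d ≡ e - c * m - d + m * c
      lemma = ℤ-Solver.solve-∀
    preimage : ∀ x → f₂ x ≢ + 0 → c ∣ℤ.∣ x - d ⊎ c ∣ℤ.∣ x - e → ∃ λ m → e - c * m ≡ x
    preimage x nz (inj₁ p) =
      contradiction (cong (λ z → (+ 1 - z) * f x) (ind-yes (c ∣ℤ.∣? (x - d)) p)) nz
    preimage x nz (inj₂ (divides m eq)) = - m , trans (lemma e c m) (trans (cong (λ z → e + z) (sym eq)) (lemma′ e x))
      where
      lemma : ∀ e c m → e - c * - m ≡ e + m * c
      lemma = ℤ-Solver.solve-∀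
      lemma′ : ∀ d x → d + (x - d) ≡ x
      lemma′ = ℤ-Solver.solve-∀

-- Products of series given as weighted sums of monomials

sumOver-⊛ : ∀ (xs : List I) (H : I → PS) g →
  (λ n → sumOver xs (λ i → H i n)) ⊛ g ≈ (λ n → sumOver xs (λ i → (H i ⊛ g) n))
sumOver-⊛ []       H g n = ⊛-zeroˡ g n
sumOver-⊛ (x ∷ xs) H g n = trans (⊛-distribʳ g (H x) (λ k → sumOver xs (λ i → H i k)) n)
  (cong (λ z → (H x ⊛ g) n + z) (sumOver-⊛ xs H g n))

⊛-expand : ∀ {M f g} (xs : List I) (ys : List J) (v : I → ℤ) (k : I → ℕ) (w : J → ℤ) (l : J → ℕ) →
  f ≈[ M ] (λ n → sumOver xs (λ i → v i * mono (k i) n)) →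
  g ≈[ M ] (λ n → sumOver ys (λ j → w j * mono (l j) n)) →
  (f ⊛ g) M ≡ sumOver xs (λ i → sumOver ys (λ j → v i * w j * mono (k i ℕ.+ l j) M))
⊛-expand {M = M} {f} {g} xs ys v k w l f≈ g≈ = begin
  (f ⊛ g) M
    ≡⟨ ≈[]-⊛ f≈ g≈ M ℕP.≤-refl ⟩
  ((λ n → sumOver xs (λ i → v i * mono (k i) n)) ⊛ g′) M
    ≡⟨ sumOver-⊛ xs (λ i n → v i * mono (k i) n) g′ M ⟩
  sumOver xs (λ i → ((λ n → v i * mono (k i) n) ⊛ g′) M)
    ≡⟨ sumOver-cong xs (λ i → ⊛-comm (term i) g′ M) ⟩
  sumOver xs (λ i → (g′ ⊛ (λ n → v i * mono (k i) n)) M)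
    ≡⟨ sumOver-cong xs (λ i → sumOver-⊛ ys (λ j n → w j * mono (l j) n) (term i) M) ⟩
  sumOver xs (λ i → sumOver ys (λ j → ((λ n → w j * mono (l j) n) ⊛ (λ n → v i * mono (k i) n)) M))
    ≡⟨ sumOver-cong xs (λ i → sumOver-cong ys (λ j → product i j)) ⟩
  sumOver xs (λ i → sumOver ys (λ j → v i * w j * mono (k i ℕ.+ l j) M)) ∎
  where
  open ≡-Reasoning
  g′ : PS
  g′ n = sumOver ys (λ j → w j * mono (l j) n)
  term : _ → PS
  term i n = v i * mono (k i) n
  product : ∀ i j → ((λ n → w j * mono (l j) n) ⊛ term i) M ≡ v i * w j * mono (k i ℕ.+ l j) M
  product i j = begin
    ((λ n → w j * mono (l j) n) ⊛ term i) M
      ≡⟨ ⊛-scaleˡ (w j) (mono (l j)) (term i) M ⟩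
    w j * (mono (l j) ⊛ term i) M
      ≡⟨ cong (w j *_) (trans (⊛-comm (mono (l j)) (term i) M) (⊛-scaleˡ (v i) (mono (k i)) (mono (l j)) M)) ⟩
    w j * (v i * (mono (k i) ⊛ mono (l j)) M)
      ≡⟨ cong (λ z → w j * (v i * z)) (mono-+ (k i) (l j) M) ⟩
    w j * (v i * mono (k i ℕ.+ l j) M)
      ≡⟨ lemma (w j) (v i) _ ⟩
    v i * w j * mono (k i ℕ.+ l j) M ∎
    where
    lemma : ∀ w v m → w * (v * m) ≡ v * w * m
    lemma = ℤ-Solver.solve-∀

mono-ind : ∀ k n → mono k n ≡ ind (k ℕ.≟ n)
mono-ind zero    zero    = refl
mono-ind zero    (suc n) = refl
mono-ind (suc k) zero    = refl
mono-ind (suc k) (suc n) = trans (mono-ind k n) (ind-cong (k ℕ.≟ n) (suc k ℕ.≟ suc n) (cong suc) ℕP.suc-injective)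

-- The sign character and odd residue characters

sucℤ-+1 : ∀ x → sucℤ x ≡ x + + 1
sucℤ-+1 (+ n)        = cong +_ (ℕP.+-comm 1 n)
sucℤ-+1 -[1+ zero ]  = refl
sucℤ-+1 -[1+ suc n ] = refl

signℕ² : ∀ n → signℕ n * signℕ n ≡ + 1
signℕ² zero    = refl
signℕ² (suc n) = trans (lemma (signℕ n)) (signℕ² n)
  where
  lemma : ∀ s → - s * - s ≡ s * s
  lemma = ℤ-Solver.solve-∀

signℤ² : ∀ x → signℤ x * signℤ x ≡ + 1
signℤ² x = signℕ² ℤ.∣ x ∣

signℤ-+ℕ : ∀ x n → signℤ (x + + n) ≡ signℤ x * signℕ n
signℤ-+ℕ x zero    = trans (cong signℤ (ℤP.+-identityʳ x)) (sym (ℤP.*-identityʳ (signℤ x)))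
signℤ-+ℕ x (suc n) = begin
  signℤ (x + + suc n)       ≡⟨ cong signℤ (trans (cong (λ k → x + + k) (ℕP.+-comm 1 n)) (sym (ℤP.+-assoc x (+ n) (+ 1)))) ⟩
  signℤ (x + + n + + 1)     ≡⟨ cong signℤ (sucℤ-+1 (x + + n)) ⟨
  signℤ (sucℤ (x + + n))    ≡⟨ signℤ-suc (x + + n) ⟩
  - signℤ (x + + n)         ≡⟨ cong -_ (signℤ-+ℕ x n) ⟩
  - (signℤ x * signℕ n)     ≡⟨ ℤP.neg-distribʳ-* (signℤ x) (signℕ n) ⟩
  signℤ x * - signℕ n       ∎
  where open ≡-Reasoning

signℤ-neg : ∀ x → signℤ (- x) ≡ signℤ x
signℤ-neg x = cong signℕ (ℤP.∣-i∣≡∣i∣ x)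

signℤ-+ : ∀ x y → signℤ (x + y) ≡ signℤ x * signℤ y
signℤ-+ x (+ n)    = signℤ-+ℕ x n
signℤ-+ x -[1+ n ] = begin
  signℤ y                           ≡⟨ ℤP.*-identityʳ (signℤ y) ⟨
  signℤ y * + 1                     ≡⟨ cong (signℤ y *_) (signℕ² (suc n)) ⟨
  signℤ y * (s * s)                 ≡⟨ ℤP.*-assoc (signℤ y) s s ⟨
  signℤ y * s * s                   ≡⟨ cong (_* s) (signℤ-+ℕ y (suc n)) ⟨
  signℤ (y + + suc n) * s           ≡⟨ cong (λ z → signℤ z * s) (lemma x (+ suc n)) ⟩
  signℤ x * s                       ∎
  where
  open ≡-Reasoning
  y = x + -[1+ n ]
  s = signℕ (suc n)
  lemma : ∀ x z → x - z + z ≡ x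
  lemma = ℤ-Solver.solve-∀

signℤ-minus : ∀ x y → signℤ (x - y) ≡ signℤ x * signℤ y
signℤ-minus x y = trans (signℤ-+ x (- y)) (cong (signℤ x *_) (signℤ-neg y))

signℤ-2* : ∀ k → signℤ (+ 2 * k) ≡ + 1
signℤ-2* k = trans (cong signℤ (lemma k)) (trans (signℤ-+ k k) (signℤ² k))
  where
  lemma : ∀ k → + 2 * k ≡ k + k
  lemma = ℤ-Solver.solve-∀

signℤ-mod2 : ∀ x y k → x ≡ y + + 2 * k → signℤ x ≡ signℤ y
signℤ-mod2 x y k refl =
  trans (signℤ-+ y (+ 2 * k)) (trans (cong (signℤ y *_) (signℤ-2* k)) (ℤP.*-identityʳ (signℤ y)))

parity : ∀ x → (∃ λ k → x ≡ + 2 * k) ⊎ (∃ λ k → x ≡ + 1 + + 2 * k)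
parity x with x %ℕ 2 | n%ℕd<d x 2 | a≡a%ℕn+[a/ℕn]*n x 2
... | 0 | _ | eq = inj₁ (x /ℕ 2 , trans eq (lemma (x /ℕ 2)))
  where
  lemma : ∀ q → + 0 + q * + 2 ≡ + 2 * q
  lemma = ℤ-Solver.solve-∀
... | 1 | _ | eq = inj₂ (x /ℕ 2 , trans eq (cong (λ z → + 1 + z) (ℤP.*-comm (x /ℕ 2) (+ 2))))
... | suc (suc _) | s≤s (s≤s ()) | _

1-sign≢0⇒odd : ∀ x → + 1 - signℤ x ≢ + 0 → ∃ λ k → x ≡ + 1 + + 2 * k
1-sign≢0⇒odd x h with parity x
... | inj₁ (k , refl) = contradiction (cong (λ z → + 1 - z) (signℤ-2* k)) h
... | inj₂ odd        = odd

1+sign≢0⇒even : ∀ x → + 1 + signℤ x ≢ + 0 → ∃ λ k → x ≡ + 2 * k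
1+sign≢0⇒even x h with parity x
... | inj₁ even       = even
... | inj₂ (k , refl) = contradiction (cong (λ z → + 1 + z) (signℤ-mod2 (+ 1 + + 2 * k) (+ 1) k refl)) h

χ : ℤ → ℤ → ℤ
χ c x = ind (c ∣ℤ.∣? (x - + 1)) - ind (c ∣ℤ.∣? (x + + 1))

χ-mod : ∀ c x y k → x ≡ y + c * k → χ c x ≡ χ c y
χ-mod c x y k refl = cong₂ _-_
  (ind-cong (c ∣ℤ.∣? (x - + 1)) (c ∣ℤ.∣? (y - + 1)) (lower (- + 1)) (raise (- + 1)))
  (ind-cong (c ∣ℤ.∣? (x + + 1)) (c ∣ℤ.∣? (y + + 1)) (lower (+ 1)) (raise (+ 1)))
  where
  lower : ∀ r → c ∣ℤ.∣ y + c * k + r → c ∣ℤ.∣ y + r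
  lower r (divides q eq) = divides (q - k) (trans (lemma y c k r) (trans (cong (_- c * k) eq) (lemma′ q k c)))
    where
    lemma : ∀ y c k r → y + r ≡ y + c * k + r - c * k
    lemma = ℤ-Solver.solve-∀
    lemma′ : ∀ q k c → q * c - c * k ≡ (q - k) * c
    lemma′ = ℤ-Solver.solve-∀
  raise : ∀ r → c ∣ℤ.∣ y + r → c ∣ℤ.∣ y + c * k + r
  raise r (divides q eq) = divides (q + k) (trans (lemma y c k r) (trans (cong (_+ c * k) eq) (lemma′ q k c)))
    where
    lemma : ∀ y c k r → y + c * k + r ≡ y + r + c * k
    lemma = ℤ-Solver.solve-∀
    lemma′ : ∀ q k c → q * c + c * k ≡ (q + k) * c
    lemma′ = ℤ-Solver.solve-∀

χ-neg : ∀ c x → χ c (- x) ≡ - χ c x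
χ-neg c x = trans (cong₂ _-_
  (ind-cong (c ∣ℤ.∣? (- x - + 1)) (c ∣ℤ.∣? (x + + 1)) (λ p → subst (c ∣ℤ.∣_) (l₁ x) (flip p)) (λ p → subst (c ∣ℤ.∣_) (l₂ x) (flip p)))
  (ind-cong (c ∣ℤ.∣? (- x + + 1)) (c ∣ℤ.∣? (x - + 1)) (λ p → subst (c ∣ℤ.∣_) (l₃ x) (flip p)) (λ p → subst (c ∣ℤ.∣_) (l₄ x) (flip p))))
  (swap (ind (c ∣ℤ.∣? (x + + 1))) (ind (c ∣ℤ.∣? (x - + 1))))
  where
  flip : ∀ {y} → c ∣ℤ.∣ y → c ∣ℤ.∣ - y
  flip (divides q eq) = divides (- q) (trans (cong -_ eq) (ℤP.neg-distribˡ-* q c))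
  l₁ : ∀ x → - (- x - + 1) ≡ x + + 1
  l₁ = ℤ-Solver.solve-∀
  l₂ : ∀ x → - (x + + 1) ≡ - x - + 1
  l₂ = ℤ-Solver.solve-∀
  l₃ : ∀ x → - (- x + + 1) ≡ x - + 1
  l₃ = ℤ-Solver.solve-∀
  l₄ : ∀ x → - (x - + 1) ≡ - x + + 1
  l₄ = ℤ-Solver.solve-∀
  swap : ∀ a b → a - b ≡ - (b - a)
  swap = ℤ-Solver.solve-∀

χ≢0 : ∀ c x → χ c x ≢ + 0 → (∃ λ k → x - + 1 ≡ k * c) ⊎ (∃ λ k → x + + 1 ≡ k * c)
χ≢0 c x h = go (c ∣ℤ.∣? (x - + 1)) (c ∣ℤ.∣? (x + + 1)) h
  where
  go : (p : Dec (c ∣ℤ.∣ x - + 1)) (q : Dec (c ∣ℤ.∣ x + + 1)) → ind p - ind q ≢ + 0 →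
       (∃ λ k → x - + 1 ≡ k * c) ⊎ (∃ λ k → x + + 1 ≡ k * c)
  go (yes (divides k eq)) _                  _ = inj₁ (k , eq)
  go (no _)               (yes (divides k eq)) _ = inj₂ (k , eq)
  go (no _)               (no _)             h = contradiction refl h

sumOver≢0 : ∀ {I : Set} (xs : List I) {f} → sumOver xs f ≢ + 0 → ∃ λ i → f i ≢ + 0
sumOver≢0 []       h = contradiction refl h
sumOver≢0 (x ∷ xs) {f} h with f x ℤ.≟ + 0
... | no nz = x , nz
... | yes z = sumOver≢0 xs (λ eq → h (cong₂ _+_ z eq))

-- The binary quadratic form 3u² - ut + 3t²

form : ℤ → ℤ → ℤ
form u t = + 3 * (u * u) - u * t + + 3 * (t * t)

sum² : ℕ → (ℤ → ℤ → ℤ) → ℤ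
sum² D f = sumℤ D (λ u → sumℤ D (f u))

sum²-cong : ∀ D {f g} → (∀ u t → f u t ≡ g u t) → sum² D f ≡ sum² D g
sum²-cong D h = sumOver-cong (interval D) (λ u → sumOver-cong (interval D) (h u))

sum²-+ : ∀ D f g → sum² D (λ u t → f u t + g u t) ≡ sum² D f + sum² D g
sum²-+ D f g = trans (sumOver-cong (interval D) (λ u → sumOver-+ (interval D) (f u) (g u)))
  (sumOver-+ (interval D) (λ u → sumℤ D (f u)) (λ u → sumℤ D (g u)))

sum²-antisymmetric : ∀ D f → (∀ u t → f t u ≡ - f u t) → sum² D f ≡ + 0
sum²-antisymmetric D f anti = self-neg⇒0 (begin
  sum² D f                            ≡⟨ sumOver-swap (interval D) (interval D) f ⟩
  sum² D (λ u t → f t u)              ≡⟨ sum²-cong D anti ⟩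
  sum² D (λ u t → - f u t)            ≡⟨ sumOver-cong (interval D) (λ u → sumOver-neg (interval D) (f u)) ⟩
  sumℤ D (λ u → - sumℤ D (f u))       ≡⟨ sumOver-neg (interval D) (λ u → sumℤ D (f u)) ⟩
  - sum² D f                          ∎)
  where open ≡-Reasoning

-- Twice 70M + 3. As 2Q is at least 5u² + 5t², it bounds u² and t², hence also |u| and |t|.
radius : ℕ → ℕ
radius M = 140 ℕ.* M ℕ.+ 6

-- The box has to contain u and t, their sum and difference, and the quotients of x - 1 for |x| ≤ 2R
-- that index the theta series; 2R < D is enough for all of these.
module Lattice (M D : ℕ) (big : radius M ℕ.+ radius M < D) where

  target : ℤ
  target = + 70 * + M + + 3

  onForm : ℤ → ℤ → ℤ
  onForm u t = ind (form u t ℤ.≟ target)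

  R : ℕ
  R = radius M

  square-abs : ∀ u → u * u ≡ + (ℤ.∣ u ∣ ℕ.* ℤ.∣ u ∣)
  square-abs (+ n)    = sym (ℤP.pos-* n n)
  square-abs -[1+ n ] = refl

  n≤n² : ∀ n → n ≤ n ℕ.* n
  n≤n² zero    = z≤n
  n≤n² (suc n) = ℕP.m≤m*n (suc n) (suc n)

  -- 2 (3u² - ut + 3t²) = 5u² + 5t² + (u - t)²
  form-bound : ∀ u t → form u t ≡ target → ℤ.∣ u ∣ ≤ R × ℤ.∣ t ∣ ≤ R
  form-bound u t eq =
    ℕP.≤-trans (n≤n² ℤ.∣ u ∣) (subst (sq u ≤_) inℕ (ℕP.≤-trans (ℕP.m≤n*m (sq u) 5) (ℕP.≤-trans (ℕP.m≤m+n _ _) (ℕP.m≤m+n _ _)))) ,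
    ℕP.≤-trans (n≤n² ℤ.∣ t ∣) (subst (sq t ≤_) inℕ (ℕP.≤-trans (ℕP.m≤n*m (sq t) 5) (ℕP.≤-trans (ℕP.m≤n+m _ (5 ℕ.* sq u)) (ℕP.m≤m+n _ _))))
    where
    sq : ℤ → ℕ
    sq x = ℤ.∣ x ∣ ℕ.* ℤ.∣ x ∣
    lemma : ∀ u t → + 5 * (u * u) + + 5 * (t * t) + (u - t) * (u - t) ≡ + 2 * (+ 3 * (u * u) - u * t + + 3 * (t * t))
    lemma = ℤ-Solver.solve-∀
    lemma′ : ∀ m → + 2 * (+ 70 * m + + 3) ≡ + 140 * m + + 6
    lemma′ = ℤ-Solver.solve-∀
    open ≡-Reasoning
    inℕ : 5 ℕ.* sq u ℕ.+ 5 ℕ.* sq t ℕ.+ sq (u - t) ≡ R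
    inℕ = ℤP.+-injective (begin
      + (5 ℕ.* sq u ℕ.+ 5 ℕ.* sq t ℕ.+ sq (u - t))
        ≡⟨ trans (ℤP.pos-+ (5 ℕ.* sq u ℕ.+ 5 ℕ.* sq t) (sq (u - t))) (cong (_+ + sq (u - t)) (ℤP.pos-+ (5 ℕ.* sq u) (5 ℕ.* sq t))) ⟩
      + (5 ℕ.* sq u) + + (5 ℕ.* sq t) + + sq (u - t)
        ≡⟨ cong₂ (λ a b → a + b + + sq (u - t)) (ℤP.pos-* 5 (sq u)) (ℤP.pos-* 5 (sq t)) ⟩
      + 5 * + sq u + + 5 * + sq t + + sq (u - t)
        ≡⟨ cong₂ (λ a b → + 5 * a + + 5 * b + + sq (u - t)) (square-abs u) (square-abs t) ⟨
      + 5 * (u * u) + + 5 * (t * t) + + sq (u - t)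
        ≡⟨ cong (λ z → + 5 * (u * u) + + 5 * (t * t) + z) (square-abs (u - t)) ⟨
      + 5 * (u * u) + + 5 * (t * t) + (u - t) * (u - t)
        ≡⟨ lemma u t ⟩
      + 2 * form u t
        ≡⟨ cong (+ 2 *_) eq ⟩
      + 2 * target
        ≡⟨ lemma′ (+ M) ⟩
      + 140 * + M + + 6
        ≡⟨ cong (_+ + 6) (ℤP.pos-* 140 M) ⟨
      + (140 ℕ.* M) + + 6
        ≡⟨ ℤP.pos-+ (140 ℕ.* M) 6 ⟨
      + R ∎)

  weight : ℤ → ℤ → ℤ
  weight u t = χ (+ 7) (u + t) * χ (+ 5) (u - t) * onForm u t

  form-swap : ∀ u t → form t u ≡ form u t
  form-swap = lemma
    where
    lemma : ∀ u t → + 3 * (t * t) - t * u + + 3 * (u * u) ≡ + 3 * (u * u) - u * t + + 3 * (t * t)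
    lemma = ℤ-Solver.solve-∀

  form-neg : ∀ u t → form (- u) (- t) ≡ form u t
  form-neg = lemma
    where
    lemma : ∀ u t → + 3 * (- u * - u) - - u * - t + + 3 * (- t * - t) ≡ + 3 * (u * u) - u * t + + 3 * (t * t)
    lemma = ℤ-Solver.solve-∀

  onForm-cong : ∀ {u t u′ t′} → form u t ≡ form u′ t′ → onForm u t ≡ onForm u′ t′
  onForm-cong eq = cong (λ z → ind (z ℤ.≟ target)) eq

  weight-swap : ∀ u t → weight t u ≡ - weight u t
  weight-swap u t = begin
    χ (+ 7) (t + u) * χ (+ 5) (t - u) * onForm t u
      ≡⟨ cong₂ (λ a b → a * χ (+ 5) (t - u) * b) (cong (χ (+ 7)) (ℤP.+-comm t u)) (onForm-cong {t} {u} {u} {t} (form-swap u t)) ⟩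
    χ (+ 7) (u + t) * χ (+ 5) (t - u) * onForm u t
      ≡⟨ cong (λ z → χ (+ 7) (u + t) * z * onForm u t) (trans (cong (χ (+ 5)) (lemma t u)) (χ-neg (+ 5) (u - t))) ⟩
    χ (+ 7) (u + t) * - χ (+ 5) (u - t) * onForm u t
      ≡⟨ lemma′ (χ (+ 7) (u + t)) (χ (+ 5) (u - t)) (onForm u t) ⟩
    - weight u t ∎
    where
    open ≡-Reasoning
    lemma : ∀ t u → t - u ≡ - (u - t)
    lemma = ℤ-Solver.solve-∀
    lemma′ : ∀ a b c → a * - b * c ≡ - (a * b * c)
    lemma′ = ℤ-Solver.solve-∀

  weight-neg : ∀ u t → weight (- u) (- t) ≡ weight u t
  weight-neg u t = begin
    χ (+ 7) (- u + - t) * χ (+ 5) (- u - - t) * onForm (- u) (- t)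
      ≡⟨ cong₂ (λ a b → a * b * onForm (- u) (- t))
           (trans (cong (χ (+ 7)) (sym (ℤP.neg-distrib-+ u t))) (χ-neg (+ 7) (u + t)))
           (trans (cong (χ (+ 5)) (sym (ℤP.neg-distrib-+ u (- t)))) (χ-neg (+ 5) (u - t))) ⟩
    - χ (+ 7) (u + t) * - χ (+ 5) (u - t) * onForm (- u) (- t)
      ≡⟨ cong (- χ (+ 7) (u + t) * - χ (+ 5) (u - t) *_) (onForm-cong { - u} { - t} {u} {t} (form-neg u t)) ⟩
    - χ (+ 7) (u + t) * - χ (+ 5) (u - t) * onForm u t
      ≡⟨ lemma (χ (+ 7) (u + t)) (χ (+ 5) (u - t)) (onForm u t) ⟩
    weight u t ∎
    where
    open ≡-Reasoning
    lemma : ∀ a b c → - a * - b * c ≡ a * b * c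
    lemma = ℤ-Solver.solve-∀

  -- With u = 3v, the old and new values of u + t add up to 2u + v = 7v, those of u - t to 2u - v =
  -- 5v. So both characters change sign, and the signs cancel.
  weight-reflect : ∀ v t → weight (v * + 3) (v - t) ≡ weight (v * + 3) t
  weight-reflect v t = begin
    χ (+ 7) (v * + 3 + (v - t)) * χ (+ 5) (v * + 3 - (v - t)) * onForm (v * + 3) (v - t)
      ≡⟨ cong₂ (λ a b → a * b * onForm (v * + 3) (v - t))
           (trans (χ-mod (+ 7) _ (- (v * + 3 + t)) v (l₇ v t)) (χ-neg (+ 7) (v * + 3 + t)))
           (trans (χ-mod (+ 5) _ (- (v * + 3 - t)) v (l₅ v t)) (χ-neg (+ 5) (v * + 3 - t))) ⟩
    - χ (+ 7) (v * + 3 + t) * - χ (+ 5) (v * + 3 - t) * onForm (v * + 3) (v - t)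
      ≡⟨ cong (- χ (+ 7) (v * + 3 + t) * - χ (+ 5) (v * + 3 - t) *_) (onForm-cong {v * + 3} {v - t} {v * + 3} {t} (l v t)) ⟩
    - χ (+ 7) (v * + 3 + t) * - χ (+ 5) (v * + 3 - t) * onForm (v * + 3) t
      ≡⟨ lemma (χ (+ 7) (v * + 3 + t)) (χ (+ 5) (v * + 3 - t)) (onForm (v * + 3) t) ⟩
    weight (v * + 3) t ∎
    where
    open ≡-Reasoning
    l₇ : ∀ v t → v * + 3 + (v - t) ≡ - (v * + 3 + t) + + 7 * v
    l₇ = ℤ-Solver.solve-∀
    l₅ : ∀ v t → v * + 3 - (v - t) ≡ - (v * + 3 - t) + + 5 * v
    l₅ = ℤ-Solver.solve-∀
    l : ∀ v t → + 3 * (v * + 3 * (v * + 3)) - v * + 3 * (v - t) + + 3 * ((v - t) * (v - t)) ≡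
                + 3 * (v * + 3 * (v * + 3)) - v * + 3 * t + + 3 * (t * t)
    l = ℤ-Solver.solve-∀
    lemma : ∀ a b c → - a * - b * c ≡ a * b * c
    lemma = ℤ-Solver.solve-∀

  weight-bound : ∀ u t → weight u t ≢ + 0 → ℤ.∣ u ∣ ≤ R × ℤ.∣ t ∣ ≤ R
  weight-bound u t nz = form-bound u t (ind≢0 (form u t ℤ.≟ target) (*≢0ʳ (χ (+ 7) (u + t) * χ (+ 5) (u - t)) _ nz))

  R≤D : R ≤ D
  R≤D = ℕP.≤-trans (ℕP.m≤m+n R R) (ℕP.<⇒≤ big)

  ∣u+t∣≤2R : ∀ {u t} → ℤ.∣ u ∣ ≤ R × ℤ.∣ t ∣ ≤ R → ℤ.∣ u + t ∣ ≤ R ℕ.+ R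
  ∣u+t∣≤2R {u} {t} (bu , bt) = ℕP.≤-trans (ℤP.∣i+j∣≤∣i∣+∣j∣ u t) (ℕP.+-mono-≤ bu bt)

  ∣u-t∣≤2R : ∀ {u t} → ℤ.∣ u ∣ ≤ R × ℤ.∣ t ∣ ≤ R → ℤ.∣ u - t ∣ ≤ R ℕ.+ R
  ∣u-t∣≤2R {u} {t} (bu , bt) = ℕP.≤-trans (ℤP.∣i-j∣≤∣i∣+∣j∣ u t) (ℕP.+-mono-≤ bu bt)

  quotient-bound : ∀ c .{{_ : ℤ.NonZero c}} {x} k → c * k ≡ x - + 1 → ℤ.∣ x ∣ ≤ R ℕ.+ R → ℤ.∣ k ∣ ≤ D
  quotient-bound c {x} k eq b = ℕP.≤-trans (∣k∣≤∣c*k∣ c k) (subst (λ z → ℤ.∣ z ∣ ≤ D) (sym eq)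
    (ℕP.≤-trans (ℤP.∣i-j∣≤∣i∣+∣j∣ x (+ 1)) (subst (_≤ D) (ℕP.+-comm 1 ℤ.∣ x ∣) (ℕP.≤-trans (s≤s b) big))))

  -- Since 1 ± signℤ is 0 or 2, this is four times the weight on odd u and even t.
  oddEven : ℤ → ℤ → ℤ
  oddEven u t = (+ 1 - signℤ u) * (+ 1 + signℤ t) * weight u t

  -- The factor 2 brings this to the normalisation of `oddEven`: four times the signed weight on the
  -- points kept.
  prime6 : ℤ → ℤ → ℤ
  prime6 u t = + 2 * (+ 1 - signℤ u) * (+ 1 - ind (+ 3 ∣ℤ.∣? u)) * signℤ t * weight u t

  oddOdd : ℤ → ℤ → ℤ
  oddOdd u t = (+ 1 - signℤ u) * (+ 1 - signℤ t) * weight u t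

  triple : ℤ → ℤ → ℤ
  triple u t = + 2 * (+ 1 - signℤ u) * ind (+ 3 ∣ℤ.∣? u) * signℤ t * weight u t

  sum-oddOdd : sum² D oddOdd ≡ + 0
  sum-oddOdd = sum²-antisymmetric D oddOdd (λ u t →
    trans (cong ((+ 1 - signℤ t) * (+ 1 - signℤ u) *_) (weight-swap u t)) (lemma (signℤ t) (signℤ u) (weight u t)))
    where
    lemma : ∀ a b w → (+ 1 - a) * (+ 1 - b) * - w ≡ - ((+ 1 - b) * (+ 1 - a) * w)
    lemma = ℤ-Solver.solve-∀

  triple-support : ∀ u t → triple u t ≢ + 0 → ℤ.∣ u ∣ ≤ R × ℤ.∣ t ∣ ≤ R
  triple-support u t nz = weight-bound u t (*≢0ʳ (+ 2 * (+ 1 - signℤ u) * ind (+ 3 ∣ℤ.∣? u) * signℤ t) _ nz)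

  -- Each row vanishes separately. For odd u = 3v also v is odd, so t ↦ v - t reverses (-1)^t while
  -- `weight-reflect` preserves the weight.
  sum-triple : ∀ u → sumℤ D (triple u) ≡ + 0
  sum-triple u = go (+ 3 ∣ℤ.∣? u)
    where
    go : Dec (+ 3 ∣ℤ.∣ u) → sumℤ D (triple u) ≡ + 0
    go (no ¬3∣u) = sumOver-0 (interval D) (λ t →
      trans (cong (λ z → + 2 * (+ 1 - signℤ u) * z * signℤ t * weight u t) (ind-no (+ 3 ∣ℤ.∣? u) ¬3∣u))
        (lemma (+ 2 * (+ 1 - signℤ u)) (signℤ t) (weight u t)))
      where
      lemma : ∀ a b c → a * + 0 * b * c ≡ + 0
      lemma = ℤ-Solver.solve-∀
    go (yes (divides v refl)) = sumℤ-antisymmetric v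
      (λ t nz → ℕP.≤-trans (proj₂ (triple-support (v * + 3) t nz)) R≤D)
      (λ t nz → bound t (triple-support (v * + 3) (v - t) nz))
      anti
      where
      bound : ∀ t → ℤ.∣ v * + 3 ∣ ≤ R × ℤ.∣ v - t ∣ ≤ R → ℤ.∣ t ∣ ≤ D
      bound t (bv , bvt) = subst (λ z → ℤ.∣ z ∣ ≤ D) (lemma v t)
        (ℕP.<⇒≤ (ℕP.≤-<-trans (∣u-t∣≤2R {v} {v - t} (ℕP.≤-trans (subst (λ z → ℤ.∣ v ∣ ≤ ℤ.∣ z ∣) (ℤP.*-comm (+ 3) v) (∣k∣≤∣c*k∣ (+ 3) v)) bv , bvt)) big))
        where
        lemma : ∀ v t → v - (v - t) ≡ t
        lemma = ℤ-Solver.solve-∀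
      τ = ind (+ 3 ∣ℤ.∣? (v * + 3))
      -- (1 - s) s = -(1 - s) for a sign s
      lemma : ∀ d s s² r w → s² ≡ + 1 → s² ≡ s * s → + 2 * (+ 1 - s) * d * (s * r) * w ≡ - (+ 2 * (+ 1 - s) * d * r * w)
      lemma d s .(+ 1) r w refl eq = trans (l₁ d s r w) (trans (cong (λ z → + 2 * d * (s - z) * r * w) (sym eq)) (l₂ d s r w))
        where
        l₁ : ∀ d s r w → + 2 * (+ 1 - s) * d * (s * r) * w ≡ + 2 * d * (s - s * s) * r * w
        l₁ = ℤ-Solver.solve-∀
        l₂ : ∀ d s r w → + 2 * d * (s - + 1) * r * w ≡ - (+ 2 * (+ 1 - s) * d * r * w)
        l₂ = ℤ-Solver.solve-∀
      v*3 : ∀ v → v * + 3 ≡ v + + 2 * v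
      v*3 = ℤ-Solver.solve-∀
      anti : ∀ t → triple (v * + 3) (v - t) ≡ - triple (v * + 3) t
      anti t = trans
        (cong₂ (λ s w → + 2 * (+ 1 - signℤ (v * + 3)) * τ * s * w)
          (trans (signℤ-minus v t) (cong (_* signℤ t) (sym (signℤ-mod2 (v * + 3) v v (v*3 v)))))
          (weight-reflect v t))
        (lemma τ (signℤ (v * + 3)) _ (signℤ t) (weight (v * + 3) t) (signℤ² (v * + 3)) refl)

  sum-oddEven≡sum-prime6 : sum² D oddEven ≡ sum² D prime6
  sum-oddEven≡sum-prime6 = begin
    sum² D oddEven
      ≡⟨ sum²-cong D (λ u t → split (signℤ u) (signℤ t) (ind (+ 3 ∣ℤ.∣? u)) (weight u t)) ⟩
    sum² D (λ u t → prime6 u t + (oddOdd u t + triple u t))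
      ≡⟨ sum²-+ D prime6 (λ u t → oddOdd u t + triple u t) ⟩
    sum² D prime6 + sum² D (λ u t → oddOdd u t + triple u t)
      ≡⟨ cong (λ z → sum² D prime6 + z) (sum²-+ D oddOdd triple) ⟩
    sum² D prime6 + (sum² D oddOdd + sum² D triple)
      ≡⟨ cong₂ (λ a b → sum² D prime6 + (a + b)) sum-oddOdd (sumOver-0 (interval D) sum-triple) ⟩
    sum² D prime6 + + 0
      ≡⟨ ℤP.+-identityʳ _ ⟩
    sum² D prime6 ∎
    where
    open ≡-Reasoning
    -- Here a = (-1)^u, b = (-1)^t and d is the indicator of 3 | u. The identity is 1 + b = (1 - b)
    -- + 2b, with 2b divided according to d.
    split : ∀ a b d w → (+ 1 - a) * (+ 1 + b) * w ≡
      + 2 * (+ 1 - a) * (+ 1 - d) * b * w + ((+ 1 - a) * (+ 1 - b) * w + + 2 * (+ 1 - a) * d * b * w)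
    split = ℤ-Solver.solve-∀

-- Theta products as sums over lattice points

triangle-double : ∀ n → + 2 * + triangle n ≡ + n * + n - + n
triangle-double zero    = refl
triangle-double (suc n) = trans (ℤP.*-distribˡ-+ (+ 2) (+ triangle n) (+ n))
  (trans (cong (_+ + 2 * + n) (triangle-double n)) (lemma (+ n)))
  where
  lemma : ∀ n → n * n - n + + 2 * n ≡ (+ 1 + n) * (+ 1 + n) - (+ 1 + n)
  lemma = ℤ-Solver.solve-∀

thetaExp-double : ∀ a b (1≤a : 1 ≤ a) (1≤b : 1 ≤ b) n →
  + 2 * + Jacobi.thetaExp a b 1≤a 1≤b n ≡ (+ a + + b) * (n * n) + (+ a - + b) * n
thetaExp-double a b _ _ (+ n) = trans
  (cong₂ (λ x y → + 2 * (x + y)) (ℤP.pos-* a n) (ℤP.pos-* (a ℕ.+ b) (triangle n)))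
  (trans (l₁ (+ a) (+ b) (+ n) (+ triangle n))
    (trans (cong (λ z → + 2 * (+ a * + n) + (+ a + + b) * z) (triangle-double n)) (l₂ (+ a) (+ b) (+ n))))
  where
  l₁ : ∀ a b n t → + 2 * (a * n + (a + b) * t) ≡ + 2 * (a * n) + (a + b) * (+ 2 * t)
  l₁ = ℤ-Solver.solve-∀
  l₂ : ∀ a b n → + 2 * (a * n) + (a + b) * (n * n - n) ≡ (a + b) * (n * n) + (a - b) * n
  l₂ = ℤ-Solver.solve-∀
thetaExp-double a b _ _ -[1+ n ] = trans
  (cong₂ (λ x y → + 2 * (x + y)) (ℤP.pos-* b (suc n)) (ℤP.pos-* (a ℕ.+ b) (triangle (suc n))))
  (trans (l₁ (+ a) (+ b) (+ suc n) (+ triangle (suc n)))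
    (trans (cong (λ z → + 2 * (+ b * + suc n) + (+ a + + b) * z) (triangle-double (suc n))) (l₂ (+ a) (+ b) (+ suc n))))
  where
  l₁ : ∀ a b n t → + 2 * (b * n + (a + b) * t) ≡ + 2 * (b * n) + (a + b) * (+ 2 * t)
  l₁ = ℤ-Solver.solve-∀
  l₂ : ∀ a b n → + 2 * (b * n) + (a + b) * (n * n - n) ≡ (a + b) * (- n * - n) + (a - b) * - n
  l₂ = ℤ-Solver.solve-∀

-- The larger exponent comes first so that a - b = 1, and all three theta exponents have the shape
-- (c n² + n) / 2.
module J₇ = Jacobi 4 3 (s≤s z≤n) (s≤s z≤n)
module J₅ = Jacobi 3 2 (s≤s z≤n) (s≤s z≤n)
module J₃ = Jacobi 2 1 (s≤s z≤n) (s≤s z≤n)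

module ThetaSums (M D : ℕ) (big : radius M ℕ.+ radius M < D) where

  open Lattice M D big

  onForm-mono : ∀ u t k → form u t ≡ + 70 * + k + + 3 → onForm u t ≡ mono k M
  onForm-mono u t k eq = trans
    (ind-cong (form u t ℤ.≟ target) (k ℕ.≟ M)
      (λ p → ℤP.+-injective (ℤP.*-cancelˡ-≡ (+ 70) (+ k) (+ M)
        (+ℤ-cancelˡ (+ 3) _ _ (trans (ℤP.+-comm (+ 3) (+ 70 * + k)) (trans (sym eq) (trans p (ℤP.+-comm (+ 70 * + M) (+ 3))))))))
      (λ { refl → eq }))
    (sym (mono-ind k M))

  oddEven-bound : ∀ u t → oddEven u t ≢ + 0 → ℤ.∣ u ∣ ≤ R × ℤ.∣ t ∣ ≤ R
  oddEven-bound u t nz = weight-bound u t (*≢0ʳ ((+ 1 - signℤ u) * (+ 1 + signℤ t)) _ nz)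

  oddEven-neg : ∀ u t → oddEven (- u) (- t) ≡ oddEven u t
  oddEven-neg u t = cong₂ _*_
    (cong₂ (λ a b → (+ 1 - a) * (+ 1 + b)) (signℤ-neg u) (signℤ-neg t)) (weight-neg u t)

  diagonal : ℤ → ℤ
  diagonal x = sumℤ D (λ u → oddEven u (x - u))

  u+[x-u] : ∀ u x → u + (x - u) ≡ x
  u+[x-u] = ℤ-Solver.solve-∀

  antidiagonal-bound : ∀ u x → oddEven u (x - u) ≢ + 0 → ℤ.∣ x ∣ ≤ R ℕ.+ R
  antidiagonal-bound u x nz =
    subst (λ z → ℤ.∣ z ∣ ≤ R ℕ.+ R) (u+[x-u] u x) (∣u+t∣≤2R {u} {x - u} (oddEven-bound u (x - u) nz))

  diagonal-bound : ∀ x → diagonal x ≢ + 0 → ℤ.∣ x ∣ ≤ R ℕ.+ R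
  diagonal-bound x nz with sumOver≢0 (interval D) nz
  ... | u , nz′ = antidiagonal-bound u x nz′

  sum-oddEven-diagonal : sum² D oddEven ≡ sumℤ D diagonal
  sum-oddEven-diagonal = trans
    (sumOver-cong (interval D) (λ u → sym (sumℤ-translate u
      (λ t nz → ℕP.≤-trans (proj₂ (oddEven-bound u t nz)) R≤D)
      (λ x nz → ℕP.<⇒≤ (ℕP.≤-<-trans (antidiagonal-bound u x nz) big)))))
    (sumOver-swap (interval D) (interval D) (λ u x → oddEven u (x - u)))

  -- The sum x = u + t of an odd and an even number is odd, and χ₇ makes it ±1 modulo 7. The two
  -- facts are joined by y = 7y - 6y for y = x - 1 or x + 1: parity enters the first term,
  -- divisibility by 7 the second.
  diagonal-classes : ∀ x → diagonal x ≢ + 0 → + 14 ∣ℤ.∣ x - + 1 ⊎ + 14 ∣ℤ.∣ x - -[1+ 0 ]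
  diagonal-classes x nz with sumOver≢0 (interval D) nz
  ... | u , nz′ = go (1-sign≢0⇒odd u (*≢0ˡ (+ 1 - signℤ u) _ s)) (1+sign≢0⇒even (x - u) (*≢0ʳ (+ 1 - signℤ u) _ s))
                     (χ≢0 (+ 7) x (subst (λ z → χ (+ 7) z ≢ + 0) (u+[x-u] u x) (*≢0ˡ _ (χ (+ 5) (u - (x - u))) w)))
    where
    s : (+ 1 - signℤ u) * (+ 1 + signℤ (x - u)) ≢ + 0
    s = *≢0ˡ _ (weight u (x - u)) nz′
    w : χ (+ 7) (u + (x - u)) * χ (+ 5) (u - (x - u)) ≢ + 0
    w = *≢0ˡ _ (onForm u (x - u)) (*≢0ʳ ((+ 1 - signℤ u) * (+ 1 + signℤ (x - u))) _ nz′)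
    go : (∃ λ k → u ≡ + 1 + + 2 * k) → (∃ λ l → x - u ≡ + 2 * l) →
         (∃ λ q → x - + 1 ≡ q * + 7) ⊎ (∃ λ q → x + + 1 ≡ q * + 7) → + 14 ∣ℤ.∣ x - + 1 ⊎ + 14 ∣ℤ.∣ x - -[1+ 0 ]
    go (k , u≡) (l , x-u≡) (inj₁ (q , x≡)) = inj₁ (divides (k + l - + 3 * q) (trans (l₁ u x)
      (trans (cong₂ _-_ (cong₂ (λ a b → + 7 * (a - + 1 + b)) u≡ x-u≡) (cong (+ 6 *_) x≡)) (l₂ k l q))))
      where
      l₁ : ∀ u x → x - + 1 ≡ + 7 * (u - + 1 + (x - u)) - + 6 * (x - + 1)
      l₁ = ℤ-Solver.solve-∀
      l₂ : ∀ k l q → + 7 * (+ 1 + + 2 * k - + 1 + + 2 * l) - + 6 * (q * + 7) ≡ (k + l - + 3 * q) * + 14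
      l₂ = ℤ-Solver.solve-∀
    go (k , u≡) (l , x-u≡) (inj₂ (q , x≡)) = inj₂ (divides (k + l + + 1 - + 3 * q) (trans (l₁ u x)
      (trans (cong₂ _-_ (cong₂ (λ a b → + 7 * (a + + 1 + b)) u≡ x-u≡) (cong (+ 6 *_) x≡)) (l₂ k l q))))
      where
      l₁ : ∀ u x → x + + 1 ≡ + 7 * (u + + 1 + (x - u)) - + 6 * (x + + 1)
      l₁ = ℤ-Solver.solve-∀
      l₂ : ∀ k l q → + 7 * (+ 1 + + 2 * k + + 1 + + 2 * l) - + 6 * (q * + 7) ≡ (k + l + + 1 - + 3 * q) * + 14
      l₂ = ℤ-Solver.solve-∀

  diagonal-neg : ∀ x → diagonal (- x) ≡ diagonal x
  diagonal-neg x = trans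
    (sym (sumℤ-reflect (+ 0) {λ u → oddEven u (- x - u)}
      (λ u nz → ℕP.≤-trans (proj₁ (oddEven-bound u _ nz)) R≤D)
      (λ u nz → ℕP.≤-trans (subst (_≤ R) (trans (cong ℤ.∣_∣ (ℤP.+-identityˡ (- u))) (ℤP.∣-i∣≡∣i∣ u)) (proj₁ (oddEven-bound (+ 0 - u) _ nz))) R≤D)))
    (sumOver-cong (interval D) (λ u → trans (cong₂ oddEven (ℤP.+-identityˡ (- u)) (lemma x u)) (oddEven-neg u (x - u))))
    where
    lemma : ∀ x u → - x - (+ 0 - u) ≡ - (x - u)
    lemma = ℤ-Solver.solve-∀

  thetaPair : ℤ → ℤ → ℤ
  thetaPair n m = signℤ n * signℤ m * mono (J₇.thetaExp n ℕ.+ J₅.thetaExp m) M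

  -- On the line u + t = 1 + 14n the character χ₅ leaves two classes of u modulo 5, exchanged by the
  -- swap of u and t: the m-th points are (u,t) and (t,u). Exactly one of them has odd first and
  -- even second entry. Which one depends on the parity of n + m, and the antisymmetry of the weight
  -- turns this choice into the theta sign (-1)^(n+m).
  diagonal-14 : ∀ n → diagonal (+ 1 + + 14 * n) ≡ + 4 * sumℤ D (thetaPair n)
  diagonal-14 n = begin
    sumℤ D g
      ≡⟨ sumℤ-two-classes (+ 5) d e ¬5∣ classes
           (λ u nz → ℕP.≤-trans (proj₁ (oddEven-bound u _ nz)) R≤D)
           (λ m nz → quotient-bound (+ 10) {d + + 5 * m - (x - (d + + 5 * m))} m (b₁ n m)
              (∣u-t∣≤2R {d + + 5 * m} (oddEven-bound (d + + 5 * m) (x - (d + + 5 * m)) nz)))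
           (λ m nz → quotient-bound (+ 10) {x - (e - + 5 * m) - (e - + 5 * m)} m (b₂ n m)
              (subst (_≤ R ℕ.+ R) (ℤP.∣i-j∣≡∣j-i∣ (e - + 5 * m) (x - (e - + 5 * m)))
                (∣u-t∣≤2R {e - + 5 * m} (oddEven-bound (e - + 5 * m) (x - (e - + 5 * m)) nz)))) ⟩
    sumℤ D (λ m → g (d + + 5 * m)) + sumℤ D (λ m → g (e - + 5 * m))
      ≡⟨ sumOver-+ (interval D) _ _ ⟨
    sumℤ D (λ m → g (d + + 5 * m) + g (e - + 5 * m))
      ≡⟨ sumOver-cong (interval D) combine ⟩
    sumℤ D (λ m → + 4 * thetaPair n m)
      ≡⟨ sumOver-*ˡ (interval D) (+ 4) (thetaPair n) ⟩
    + 4 * sumℤ D (thetaPair n) ∎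
    where
    open ≡-Reasoning
    x d e : ℤ
    x = + 1 + + 14 * n
    d = + 1 + + 7 * n
    e = + 7 * n
    g : ℤ → ℤ
    g u = oddEven u (x - u)
    ¬5∣ : ¬ (+ 5 ∣ℤ.∣ e - d)
    ¬5∣ p = from-no (+ 5 ∣ℤ.∣? -[1+ 0 ]) (subst (+ 5 ∣ℤ.∣_) (lemma n) p)
      where
      lemma : ∀ n → + 7 * n - (+ 1 + + 7 * n) ≡ -[1+ 0 ]
      lemma = ℤ-Solver.solve-∀
    b₁ : ∀ n m → + 10 * m ≡ + 1 + + 7 * n + + 5 * m - (+ 1 + + 14 * n - (+ 1 + + 7 * n + + 5 * m)) - + 1
    b₁ = ℤ-Solver.solve-∀
    b₂ : ∀ n m → + 10 * m ≡ + 1 + + 14 * n - (+ 7 * n - + 5 * m) - (+ 7 * n - + 5 * m) - + 1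
    b₂ = ℤ-Solver.solve-∀
    classes : ∀ u → g u ≢ + 0 → + 5 ∣ℤ.∣ u - d ⊎ + 5 ∣ℤ.∣ u - e
    classes u nz with χ≢0 (+ 5) (u - (x - u)) (*≢0ʳ (χ (+ 7) (u + (x - u))) _ (*≢0ˡ _ (onForm u (x - u)) (*≢0ʳ ((+ 1 - signℤ u) * (+ 1 + signℤ (x - u))) _ nz)))
    -- Here 2 (u - d) = u - (x - u) - 1 is divisible by 5, and 3 inverts 2 modulo 5.
    ... | inj₁ (q , eq) = inj₁ (divides (+ 3 * q - (u - d)) (trans (l₁ u n) (trans (cong (λ z → + 3 * z - + 5 * (u - d)) eq) (l₂ q (u - d)))))
      where
      l₁ : ∀ u n → u - (+ 1 + + 7 * n) ≡ + 3 * (u - (+ 1 + + 14 * n - u) - + 1) - + 5 * (u - (+ 1 + + 7 * n))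
      l₁ = ℤ-Solver.solve-∀
      l₂ : ∀ q y → + 3 * (q * + 5) - + 5 * y ≡ (+ 3 * q - y) * + 5
      l₂ = ℤ-Solver.solve-∀
    ... | inj₂ (q , eq) = inj₂ (divides (+ 3 * q - (u - e)) (trans (l₁ u n) (trans (cong (λ z → + 3 * z - + 5 * (u - e)) eq) (l₂ q (u - e)))))
      where
      l₁ : ∀ u n → u - + 7 * n ≡ + 3 * (u - (+ 1 + + 14 * n - u) + + 1) - + 5 * (u - + 7 * n)
      l₁ = ℤ-Solver.solve-∀
      l₂ : ∀ q y → + 3 * (q * + 5) - + 5 * y ≡ (+ 3 * q - y) * + 5
      l₂ = ℤ-Solver.solve-∀
    combine : ∀ m → g (d + + 5 * m) + g (e - + 5 * m) ≡ + 4 * thetaPair n m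
    combine m = begin
      oddEven u (x - u) + oddEven t (x - t)
        ≡⟨ cong₂ (λ y z → oddEven u y + oddEven t z) (p₁ n m) (p₂ n m) ⟩
      oddEven u t + oddEven t u
        ≡⟨ cong (λ z → oddEven u t + (+ 1 - signℤ t) * (+ 1 + signℤ u) * z) (weight-swap u t) ⟩
      oddEven u t + (+ 1 - signℤ t) * (+ 1 + signℤ u) * - weight u t
        ≡⟨ cong₂ (λ a b → (+ 1 - a) * (+ 1 + b) * weight u t + (+ 1 - b) * (+ 1 + a) * - weight u t) su st ⟩
      (+ 1 - - s) * (+ 1 + s) * weight u t + (+ 1 - s) * (+ 1 + - s) * - weight u t
        ≡⟨ cong (λ w → (+ 1 - - s) * (+ 1 + s) * w + (+ 1 - s) * (+ 1 + - s) * - w) wt ⟩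
      (+ 1 - - s) * (+ 1 + s) * k + (+ 1 - s) * (+ 1 + - s) * - k
        ≡⟨ final s k ⟩
      + 4 * (s * k) ∎
      where
      u t s k : ℤ
      u = d + + 5 * m
      t = e - + 5 * m
      s = signℤ n * signℤ m
      k = mono (J₇.thetaExp n ℕ.+ J₅.thetaExp m) M
      p₁ : ∀ n m → + 1 + + 14 * n - (+ 1 + + 7 * n + + 5 * m) ≡ + 7 * n - + 5 * m
      p₁ = ℤ-Solver.solve-∀
      p₂ : ∀ n m → + 1 + + 14 * n - (+ 7 * n - + 5 * m) ≡ + 1 + + 7 * n + + 5 * m
      p₂ = ℤ-Solver.solve-∀
      final : ∀ s k → (+ 1 - - s) * (+ 1 + s) * k + (+ 1 - s) * (+ 1 + - s) * - k ≡ + 4 * (s * k)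
      final = ℤ-Solver.solve-∀
      st : signℤ t ≡ s
      st = trans (signℤ-mod2 t (n + m) (+ 3 * n - + 3 * m) (lemma n m)) (signℤ-+ n m)
        where
        lemma : ∀ n m → + 7 * n - + 5 * m ≡ n + m + + 2 * (+ 3 * n - + 3 * m)
        lemma = ℤ-Solver.solve-∀
      su : signℤ u ≡ - s
      su = trans (signℤ-mod2 u (n + m + + 1) (+ 3 * n + + 2 * m) (lemma n m))
        (trans (signℤ-+ (n + m) (+ 1)) (trans (cong (_* -[1+ 0 ]) (signℤ-+ n m)) (lemma′ s)))
        where
        lemma : ∀ n m → + 1 + + 7 * n + + 5 * m ≡ n + m + + 1 + + 2 * (+ 3 * n + + 2 * m)
        lemma = ℤ-Solver.solve-∀
        lemma′ : ∀ s → s * -[1+ 0 ] ≡ - s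
        lemma′ = ℤ-Solver.solve-∀
      wt : weight u t ≡ k
      wt = trans (cong₂ (λ a b → a * b * onForm u t) (χ-mod (+ 7) (u + t) (+ 1) (+ 2 * n) (l₇ n m)) (χ-mod (+ 5) (u - t) (+ 1) (+ 2 * m) (l₅ n m)))
        (trans (ℤP.*-identityˡ (onForm u t)) (onForm-mono u t _ (trans (l n m) (trans
          (cong₂ (λ a b → + 35 * a + + 35 * b + + 3)
            (sym (thetaExp-double 4 3 (s≤s z≤n) (s≤s z≤n) n)) (sym (thetaExp-double 3 2 (s≤s z≤n) (s≤s z≤n) m)))
          (l′ (+ J₇.thetaExp n) (+ J₅.thetaExp m))))))
        where
        l₇ : ∀ n m → + 1 + + 7 * n + + 5 * m + (+ 7 * n - + 5 * m) ≡ + 1 + + 7 * (+ 2 * n)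
        l₇ = ℤ-Solver.solve-∀
        l₅ : ∀ n m → + 1 + + 7 * n + + 5 * m - (+ 7 * n - + 5 * m) ≡ + 1 + + 5 * (+ 2 * m)
        l₅ = ℤ-Solver.solve-∀
        l : ∀ n m → + 3 * ((+ 1 + + 7 * n + + 5 * m) * (+ 1 + + 7 * n + + 5 * m))
                      - (+ 1 + + 7 * n + + 5 * m) * (+ 7 * n - + 5 * m)
                      + + 3 * ((+ 7 * n - + 5 * m) * (+ 7 * n - + 5 * m))
                    ≡ + 35 * ((+ 4 + + 3) * (n * n) + (+ 4 - + 3) * n) + + 35 * ((+ 3 + + 2) * (m * m) + (+ 3 - + 2) * m) + + 3
        l = ℤ-Solver.solve-∀
        l′ : ∀ a b → + 35 * (+ 2 * a) + + 35 * (+ 2 * b) + + 3 ≡ + 70 * (a + b) + + 3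
        l′ = ℤ-Solver.solve-∀

  sum-two-equal : ∀ {f g h : ℤ → ℤ} c → (∀ n → f n ≡ c * h n) → (∀ n → g n ≡ c * h n) →
    sumℤ D f + sumℤ D g ≡ + 2 * c * sumℤ D h
  sum-two-equal {f} {g} {h} c p q = trans (cong₂ _+_ (side f p) (side g q)) (lemma c (sumℤ D h))
    where
    side : ∀ f → (∀ n → f n ≡ c * h n) → sumℤ D f ≡ c * sumℤ D h
    side f p = trans (sumOver-cong (interval D) p) (sumOver-*ˡ (interval D) c h)
    lemma : ∀ c x → c * x + c * x ≡ + 2 * c * x
    lemma = ℤ-Solver.solve-∀

  -- Negation of (u,t) exchanges the classes 1 and -1 modulo 14, which doubles the factor 4 of
  -- `diagonal-14`.
  sum-oddEven : sum² D oddEven ≡ + 8 * sum² D thetaPair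
  sum-oddEven = begin
    sum² D oddEven
      ≡⟨ sum-oddEven-diagonal ⟩
    sumℤ D diagonal
      ≡⟨ sumℤ-two-classes (+ 14) (+ 1) -[1+ 0 ] (from-no (+ 14 ∣ℤ.∣? -[1+ 1 ])) diagonal-classes
           (λ x nz → ℕP.<⇒≤ (ℕP.≤-<-trans (diagonal-bound x nz) big))
           (λ n nz → quotient-bound (+ 14) {+ 1 + + 14 * n} n (b₁ n) (diagonal-bound (+ 1 + + 14 * n) nz))
           (λ n nz → quotient-bound (+ 14) {+ 1 + + 14 * n} n (b₁ n) (diagonal-bound (+ 1 + + 14 * n) (λ z → nz (trans (negated n) z)))) ⟩
    sumℤ D (λ n → diagonal (+ 1 + + 14 * n)) + sumℤ D (λ n → diagonal (-[1+ 0 ] - + 14 * n))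
      ≡⟨ sum-two-equal {h = λ n → sumℤ D (thetaPair n)} (+ 4) diagonal-14 (λ n → trans (negated n) (diagonal-14 n)) ⟩
    + 8 * sum² D thetaPair ∎
    where
    open ≡-Reasoning
    b₁ : ∀ n → + 14 * n ≡ + 1 + + 14 * n - + 1
    b₁ = ℤ-Solver.solve-∀
    negated : ∀ n → diagonal (-[1+ 0 ] - + 14 * n) ≡ diagonal (+ 1 + + 14 * n)
    negated n = trans (cong diagonal (lemma n)) (diagonal-neg (+ 1 + + 14 * n))
      where
      lemma : ∀ n → -[1+ 0 ] - + 14 * n ≡ - (+ 1 + + 14 * n)
      lemma = ℤ-Solver.solve-∀

-- The integers m for which 840 m + 1 is a square

-- The n-th positive integer whose square is 1 modulo 840 is 1 + 2 halfRoot n;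
-- such integers have period 210.
halfRoot : ℕ → ℕ
halfRoot 0 = 0
halfRoot 1 = 14
halfRoot 2 = 20
halfRoot 3 = 35
halfRoot 4 = 69
halfRoot 5 = 84
halfRoot 6 = 90
halfRoot 7 = 104
halfRoot (suc (suc (suc (suc (suc (suc (suc (suc n)))))))) = 105 ℕ.+ halfRoot n

root : ℕ → ℕ
root n = 1 ℕ.+ 2 ℕ.* halfRoot n

-- For h = `halfRoot n` this is h (h + 1) / 210, since (1 + 2h)² - 1 = 4h (h + 1). Raising h by 105
-- adds 53 + h.
index : ℕ → ℕ
index 0 = 0
index 1 = 1
index 2 = 2
index 3 = 6
index 4 = 23
index 5 = 34
index 6 = 39
index 7 = 52
index (suc (suc (suc (suc (suc (suc (suc (suc n)))))))) = 53 ℕ.+ halfRoot n ℕ.+ index n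

-- The sign for which direction n · root n ≡ -1 modulo 6.
direction : ℕ → ℤ
direction 0 = -[1+ 0 ]
direction 1 = + 1
direction 2 = + 1
direction 3 = + 1
direction 4 = -[1+ 0 ]
direction 5 = -[1+ 0 ]
direction 6 = -[1+ 0 ]
direction 7 = + 1
direction (suc (suc (suc (suc (suc (suc (suc (suc n)))))))) = direction n

-- 6 position n - 1 = direction n · root n
position : ℕ → ℤ
position 0 = + 0
position 1 = + 5
position 2 = + 7
position 3 = + 12
position 4 = -[1+ 22 ]
position 5 = -[1+ 27 ]
position 6 = -[1+ 29 ]
position 7 = + 35
position (suc (suc (suc (suc (suc (suc (suc (suc n)))))))) = position n + + 35 * direction n

by-eights : (P : ℕ → Set) → P 0 → P 1 → P 2 → P 3 → P 4 → P 5 → P 6 → P 7 →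
            (∀ n → P n → P (8 ℕ.+ n)) → ∀ n → P n
by-eights P p₀ p₁ p₂ p₃ p₄ p₅ p₆ p₇ step = go
  where
  go : ∀ n → P n
  go 0 = p₀
  go 1 = p₁
  go 2 = p₂
  go 3 = p₃
  go 4 = p₄
  go 5 = p₅
  go 6 = p₆
  go 7 = p₇
  go (suc (suc (suc (suc (suc (suc (suc (suc n)))))))) = step n (go n)

root² : ∀ n → 840 ℕ.* index n ℕ.+ 1 ≡ root n ℕ.* root n
root² = by-eights _ refl refl refl refl refl refl refl refl
  (λ n eq → trans (l₁ (halfRoot n) (index n)) (trans (cong (λ z → 420 ℕ.* (2 ℕ.* halfRoot n ℕ.+ 106) ℕ.+ z) eq) (l₂ (halfRoot n))))
  where
  l₁ : ∀ h i → 840 ℕ.* (53 ℕ.+ h ℕ.+ i) ℕ.+ 1 ≡ 420 ℕ.* (2 ℕ.* h ℕ.+ 106) ℕ.+ (840 ℕ.* i ℕ.+ 1)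
  l₁ = ℕ-Solver.solve-∀
  l₂ : ∀ h → 420 ℕ.* (2 ℕ.* h ℕ.+ 106) ℕ.+ (1 ℕ.+ 2 ℕ.* h) ℕ.* (1 ℕ.+ 2 ℕ.* h) ≡
             (1 ℕ.+ 2 ℕ.* (105 ℕ.+ h)) ℕ.* (1 ℕ.+ 2 ℕ.* (105 ℕ.+ h))
  l₂ = ℕ-Solver.solve-∀

root-periodic : ∀ p r → root (p ℕ.* 8 ℕ.+ r) ≡ root r ℕ.+ p ℕ.* 210
root-periodic zero    r = sym (ℕP.+-identityʳ (root r))
root-periodic (suc p) r =
  trans (l₁ (halfRoot (p ℕ.* 8 ℕ.+ r))) (trans (cong (210 ℕ.+_) (root-periodic p r)) (l₂ (root r) (p ℕ.* 210)))
  where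
  l₁ : ∀ h → 1 ℕ.+ 2 ℕ.* (105 ℕ.+ h) ≡ 210 ℕ.+ (1 ℕ.+ 2 ℕ.* h)
  l₁ = ℕ-Solver.solve-∀
  l₂ : ∀ x y → 210 ℕ.+ (x ℕ.+ y) ≡ x ℕ.+ (210 ℕ.+ y)
  l₂ = ℕ-Solver.solve-∀

StrictlyIncreasing : (ℕ → ℕ) → Set
StrictlyIncreasing f = ∀ n → f n < f (suc n)

halfRoot-increasing : StrictlyIncreasing halfRoot
halfRoot-increasing = by-eights _
  (from-yes (0 ℕ.<? 14)) (from-yes (14 ℕ.<? 20)) (from-yes (20 ℕ.<? 35)) (from-yes (35 ℕ.<? 69))
  (from-yes (69 ℕ.<? 84)) (from-yes (84 ℕ.<? 90)) (from-yes (90 ℕ.<? 104)) (from-yes (104 ℕ.<? 105))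
  (λ n h → ℕP.+-monoʳ-< 105 h)

index-increasing : StrictlyIncreasing index
index-increasing = by-eights _
  (from-yes (0 ℕ.<? 1)) (from-yes (1 ℕ.<? 2)) (from-yes (2 ℕ.<? 6)) (from-yes (6 ℕ.<? 23))
  (from-yes (23 ℕ.<? 34)) (from-yes (34 ℕ.<? 39)) (from-yes (39 ℕ.<? 52)) (from-yes (52 ℕ.<? 53))
  (λ n h → ℕP.+-mono-≤-< (ℕP.+-monoʳ-≤ 53 (ℕP.<⇒≤ (halfRoot-increasing n))) h)

increasing-< : ∀ {f} → StrictlyIncreasing f → ∀ {m n} → m < n → f m < f n
increasing-< inc {m} {suc n} (s≤s m≤n) with ℕP.m≤n⇒m<n∨m≡n m≤n
... | inj₁ m<n  = ℕP.<-trans (increasing-< inc m<n) (inc n)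
... | inj₂ refl = inc n

increasing-injective : ∀ {f} → StrictlyIncreasing f → ∀ {m n} → f m ≡ f n → m ≡ n
increasing-injective inc {m} {n} eq with ℕP.<-cmp m n
... | tri< m<n _ _ = contradiction eq (ℕP.<⇒≢ (increasing-< inc m<n))
... | tri≈ _ m≡n _ = m≡n
... | tri> _ _ n<m = contradiction (sym eq) (ℕP.<⇒≢ (increasing-< inc n<m))

increasing-reflects : ∀ {f} → StrictlyIncreasing f → ∀ {m n} → f m < f n → m < n
increasing-reflects {f} inc {m} {n} lt with ℕP.<-≤-connex m n
... | inj₁ m<n = m<n
... | inj₂ n≤m with ℕP.m≤n⇒m<n∨m≡n n≤m
...   | inj₁ n<m  = contradiction lt (ℕP.<-asym (increasing-< inc n<m))
...   | inj₂ refl = contradiction lt (ℕP.<-irrefl refl)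

n≤increasing : ∀ {f} → StrictlyIncreasing f → ∀ n → n ≤ f n
n≤increasing inc zero    = z≤n
n≤increasing inc (suc n) = ℕP.≤-<-trans (n≤increasing inc n) (inc n)

-- Writing f n = g (σ n), the map σ is strictly increasing, so n ≤ σ n and g n ≤ g (σ n). Applied in
-- both directions, it identifies two increasing sequences with the same range.
enumeration-≤ : ∀ {f g} → StrictlyIncreasing f → StrictlyIncreasing g →
  (∀ n → ∃ λ m → g m ≡ f n) → ∀ n → g n ≤ f n
enumeration-≤ {f} {g} f-inc g-inc sub n = subst (g n ≤_) (proj₂ (sub n)) (g-mono (n≤increasing σ-inc n))
  where
  σ : ℕ → ℕ
  σ n = proj₁ (sub n)
  σ-inc : StrictlyIncreasing σ
  σ-inc n = increasing-reflects g-inc (subst₂ _<_ (sym (proj₂ (sub n))) (sym (proj₂ (sub (suc n)))) (f-inc n))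
  g-mono : ∀ {m n} → m ≤ n → g m ≤ g n
  g-mono m≤n with ℕP.m≤n⇒m<n∨m≡n m≤n
  ... | inj₁ m<n  = ℕP.<⇒≤ (increasing-< g-inc m<n)
  ... | inj₂ refl = ℕP.≤-refl

abstract
  -- An exhaustive check, kept abstract so that it is not evaluated again. The modulus 210 already
  -- leaves only eight residues: one modulo 2 and two for each of 3, 5 and 7.
  root-residues : ∀ {r} → r < 210 → (r ℕ.* r) % 210 ≡ 1 → ∃ λ j → j < 8 × root j ≡ r
  root-residues = from-yes (ℕP.allUpTo? (λ r → ((r ℕ.* r) % 210 ℕ.≟ 1) →-dec ℕP.anyUpTo? (λ j → root j ℕ.≟ r) 8) 210)

root-complete : ∀ m k → 840 ℕ.* m ℕ.+ 1 ≡ k ℕ.* k → ∃ λ n → root n ≡ k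
root-complete m k eq = lift (root-residues (m%n<n k 210) residue)
  where
  lemma : ∀ m → 840 ℕ.* m ℕ.+ 1 ≡ 1 ℕ.+ 4 ℕ.* m ℕ.* 210
  lemma = ℕ-Solver.solve-∀
  residue : (k % 210 ℕ.* (k % 210)) % 210 ≡ 1
  residue = trans (sym (%-distribˡ-* k k 210))
    (trans (cong (_% 210) (trans (sym eq) (lemma m))) ([m+kn]%n≡m%n 1 (4 ℕ.* m) 210))
  lift : (∃ λ j → j < 8 × root j ≡ k % 210) → ∃ λ n → root n ≡ k
  lift (j , _ , root-j) = (k / 210) ℕ.* 8 ℕ.+ j ,
    trans (root-periodic (k / 210) j) (trans (cong (ℕ._+ k / 210 ℕ.* 210) root-j) (sym (m≡m%n+[m/n]*n k 210)))

index-complete : ∀ m → IsSq840 m → ∃ λ n → index n ≡ m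
index-complete m (k , eq) = lift (root-complete m k eq)
  where
  cancel : ∀ c x y .{{_ : ℕ.NonZero c}} → c ℕ.* x ℕ.+ 1 ≡ c ℕ.* y ℕ.+ 1 → x ≡ y
  cancel c x y h = ℕP.*-cancelˡ-≡ x y c (ℕP.+-cancelʳ-≡ 1 (c ℕ.* x) (c ℕ.* y) h)
  lift : (∃ λ n → root n ≡ k) → ∃ λ n → index n ≡ m
  lift (n , root-n) = n , cancel 840 (index n) m (trans (root² n) (trans (cong₂ ℕ._*_ root-n root-n) (sym eq)))

position-root : ∀ n → + 6 * position n - + 1 ≡ direction n * + root n
position-root = by-eights _ refl refl refl refl refl refl refl refl
  (λ n eq → trans (l₁ (position n) (direction n)) (trans (cong (_+ + 210 * direction n) eq)
    (trans (l₂ (direction n) (+ root n)) (cong (direction n *_) (sym (root-8 n))))))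
  where
  root-8 : ∀ n → + root (8 ℕ.+ n) ≡ + root n + + 210
  root-8 n = cong +_ (root-periodic 1 n)
  l₁ : ∀ i d → + 6 * (i + + 35 * d) - + 1 ≡ + 6 * i - + 1 + + 210 * d
  l₁ = ℤ-Solver.solve-∀
  l₂ : ∀ d r → d * r + + 210 * d ≡ d * (r + + 210)
  l₂ = ℤ-Solver.solve-∀

direction-± : ∀ n → direction n ≡ + 1 ⊎ direction n ≡ -[1+ 0 ]
direction-± = by-eights _ (inj₂ refl) (inj₁ refl) (inj₁ refl) (inj₁ refl) (inj₂ refl) (inj₂ refl) (inj₂ refl) (inj₁ refl)
  (λ n h → h)

∣direction*∣ : ∀ n x → ℤ.∣ direction n * x ∣ ≡ ℤ.∣ x ∣
∣direction*∣ n x with direction n | direction-± n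
... | _ | inj₁ refl = cong ℤ.∣_∣ (ℤP.*-identityˡ x)
... | _ | inj₂ refl = trans (cong ℤ.∣_∣ (ℤP.-1*i≡-i x)) (ℤP.∣-i∣≡∣i∣ x)

direction² : ∀ n x → direction n * x * (direction n * x) ≡ x * x
direction² n x with direction n | direction-± n
... | _ | inj₁ refl = cong₂ _*_ (ℤP.*-identityˡ x) (ℤP.*-identityˡ x)
... | _ | inj₂ refl = lemma x
  where
  lemma : ∀ x → -[1+ 0 ] * x * (-[1+ 0 ] * x) ≡ x * x
  lemma = ℤ-Solver.solve-∀

position-injective : ∀ {m n} → position m ≡ position n → m ≡ n
position-injective {m} {n} eq = increasing-injective halfRoot-increasing
  (ℕP.*-cancelˡ-≡ (halfRoot m) (halfRoot n) 2 (ℕP.suc-injective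
    (trans (sym (∣direction*∣ m (+ root m))) (trans (cong ℤ.∣_∣
      (trans (sym (position-root m)) (trans (cong (λ i → + 6 * i - + 1) eq) (position-root n))))
      (∣direction*∣ n (+ root n))))))

-- Completing the square: for i = `position n`, 12 (3i² - i) = (6i - 1)² - 1, and (6i - 1)² is the
-- square of `root n`.
position-index : ∀ n → + 3 * (position n * position n) - position n ≡ + 70 * + index n
position-index n = ℤP.*-cancelˡ-≡ (+ 12) (+ 3 * (position n * position n) - position n) (+ 70 * + index n) (trans (l₁ (position n)) (trans (cong (_- + 1) squares) (l₂ (+ index n))))
  where
  l₁ : ∀ i → + 12 * (+ 3 * (i * i) - i) ≡ (+ 6 * i - + 1) * (+ 6 * i - + 1) - + 1
  l₁ = ℤ-Solver.solve-∀
  l₂ : ∀ i → + 840 * i + + 1 - + 1 ≡ + 12 * (+ 70 * i)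
  l₂ = ℤ-Solver.solve-∀
  squares : (+ 6 * position n - + 1) * (+ 6 * position n - + 1) ≡ + 840 * + index n + + 1
  squares = trans (cong (λ z → z * z) (position-root n)) (trans (direction² n (+ root n))
    (trans (sym (ℤP.pos-* (root n) (root n))) (trans (cong +_ (sym (root² n))) (cong (_+ + 1) (ℤP.pos-* 840 (index n))))))

direction-periodic : ∀ p r → direction (p ℕ.* 8 ℕ.+ r) ≡ direction r
direction-periodic zero    r = refl
direction-periodic (suc p) r = direction-periodic p r

position-periodic : ∀ p r → position (p ℕ.* 8 ℕ.+ r) ≡ position r + + 35 * (direction r * + p)
position-periodic zero    r = lemma (position r) (direction r)
  where
  lemma : ∀ x d → x ≡ x + + 35 * (d * + 0)
  lemma = ℤ-Solver.solve-∀
position-periodic (suc p) r = trans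
  (cong₂ (λ x d → x + + 35 * d) (position-periodic p r) (direction-periodic p r)) (lemma (position r) (direction r) (+ p))
  where
  lemma : ∀ x d p → x + + 35 * (d * p) + + 35 * d ≡ x + + 35 * (d * (+ 1 + p))
  lemma = ℤ-Solver.solve-∀

position-from : ∀ {i} p r → i ≡ position r + + 35 * (direction r * + p) → ∃ λ n → position n ≡ i
position-from p r eq = p ℕ.* 8 ℕ.+ r , trans (position-periodic p r) (sym eq)

-- The eight arithmetic progressions of `position` are the ascending and descending halves of the
-- classes 0, 5, 7 and 12 modulo 35. In class 0 the value 0 itself starts the descending half.
position-class : ∀ {i} (q : ℤ) → (i ≡ + 35 * q ⊎ i ≡ + 35 * q + + 5) ⊎ (i ≡ + 35 * q + + 7 ⊎ i ≡ + 35 * q + + 12) →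
  ∃ λ n → position n ≡ i
position-class (+ zero)  (inj₁ (inj₁ refl)) = 0 , refl
position-class (+ suc p) (inj₁ (inj₁ refl)) = position-from p 7 (lemma (+ p))
  where
  lemma : ∀ p → + 35 * (+ 1 + p) ≡ + 35 + + 35 * (+ 1 * p)
  lemma = ℤ-Solver.solve-∀
position-class -[1+ p ]  (inj₁ (inj₁ refl)) = position-from (suc p) 0 (lemma (+ suc p))
  where
  lemma : ∀ p → + 35 * - p ≡ + 0 + + 35 * (-[1+ 0 ] * p)
  lemma = ℤ-Solver.solve-∀
position-class (+ p)     (inj₁ (inj₂ refl)) = position-from p 1 (lemma (+ p))
  where
  lemma : ∀ p → + 35 * p + + 5 ≡ + 5 + + 35 * (+ 1 * p)
  lemma = ℤ-Solver.solve-∀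
position-class -[1+ p ]  (inj₁ (inj₂ refl)) = position-from p 6 (lemma (+ p))
  where
  lemma : ∀ p → + 35 * - (+ 1 + p) + + 5 ≡ -[1+ 29 ] + + 35 * (-[1+ 0 ] * p)
  lemma = ℤ-Solver.solve-∀
position-class (+ p)     (inj₂ (inj₁ refl)) = position-from p 2 (lemma (+ p))
  where
  lemma : ∀ p → + 35 * p + + 7 ≡ + 7 + + 35 * (+ 1 * p)
  lemma = ℤ-Solver.solve-∀
position-class -[1+ p ]  (inj₂ (inj₁ refl)) = position-from p 5 (lemma (+ p))
  where
  lemma : ∀ p → + 35 * - (+ 1 + p) + + 7 ≡ -[1+ 27 ] + + 35 * (-[1+ 0 ] * p)
  lemma = ℤ-Solver.solve-∀
position-class (+ p)     (inj₂ (inj₂ refl)) = position-from p 3 (lemma (+ p))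
  where
  lemma : ∀ p → + 35 * p + + 12 ≡ + 12 + + 35 * (+ 1 * p)
  lemma = ℤ-Solver.solve-∀
position-class -[1+ p ]  (inj₂ (inj₂ refl)) = position-from p 4 (lemma (+ p))
  where
  lemma : ∀ p → + 35 * - (+ 1 + p) + + 12 ≡ -[1+ 22 ] + + 35 * (-[1+ 0 ] * p)
  lemma = ℤ-Solver.solve-∀

-- i = 15 i - 14 i combines the residues modulo 7 and 5.
position-surjective : ∀ i → χ (+ 7) (+ 1 + i) ≢ + 0 → χ (+ 5) (+ 1 - i) ≢ + 0 → ∃ λ n → position n ≡ i
position-surjective i nz₇ nz₅ with χ≢0 (+ 7) (+ 1 + i) nz₇ | χ≢0 (+ 5) (+ 1 - i) nz₅
... | inj₁ (k , e₇) | inj₁ (l , e₅) = position-class (+ 3 * k + + 2 * l) (inj₁ (inj₁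
        (trans (l₁ i) (trans (cong₂ (λ a b → + 15 * a + + 14 * b) e₇ e₅) (l₂ k l)))))
  where
  l₁ : ∀ i → i ≡ + 15 * (+ 1 + i - + 1) + + 14 * (+ 1 - i - + 1)
  l₁ = ℤ-Solver.solve-∀
  l₂ : ∀ k l → + 15 * (k * + 7) + + 14 * (l * + 5) ≡ + 35 * (+ 3 * k + + 2 * l)
  l₂ = ℤ-Solver.solve-∀
... | inj₁ (k , e₇) | inj₂ (l , e₅) = position-class (+ 3 * k + + 2 * l - + 1) (inj₂ (inj₁
        (trans (l₁ i) (trans (cong₂ (λ a b → + 15 * a + + 14 * b - + 28) e₇ e₅) (l₂ k l)))))
  where
  l₁ : ∀ i → i ≡ + 15 * (+ 1 + i - + 1) + + 14 * (+ 1 - i + + 1) - + 28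
  l₁ = ℤ-Solver.solve-∀
  l₂ : ∀ k l → + 15 * (k * + 7) + + 14 * (l * + 5) - + 28 ≡ + 35 * (+ 3 * k + + 2 * l - + 1) + + 7
  l₂ = ℤ-Solver.solve-∀
... | inj₂ (k , e₇) | inj₁ (l , e₅) = position-class (+ 3 * k + + 2 * l - + 1) (inj₁ (inj₂
        (trans (l₁ i) (trans (cong₂ (λ a b → + 15 * a + + 14 * b - + 30) e₇ e₅) (l₂ k l)))))
  where
  l₁ : ∀ i → i ≡ + 15 * (+ 1 + i + + 1) + + 14 * (+ 1 - i - + 1) - + 30
  l₁ = ℤ-Solver.solve-∀
  l₂ : ∀ k l → + 15 * (k * + 7) + + 14 * (l * + 5) - + 30 ≡ + 35 * (+ 3 * k + + 2 * l - + 1) + + 5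
  l₂ = ℤ-Solver.solve-∀
... | inj₂ (k , e₇) | inj₂ (l , e₅) = position-class (+ 3 * k + + 2 * l - + 2) (inj₂ (inj₂
        (trans (l₁ i) (trans (cong₂ (λ a b → + 15 * a + + 14 * b - + 58) e₇ e₅) (l₂ k l)))))
  where
  l₁ : ∀ i → i ≡ + 15 * (+ 1 + i + + 1) + + 14 * (+ 1 - i + + 1) - + 58
  l₁ = ℤ-Solver.solve-∀
  l₂ : ∀ k l → + 15 * (k * + 7) + + 14 * (l * + 5) - + 58 ≡ + 35 * (+ 3 * k + + 2 * l - + 2) + + 12
  l₂ = ℤ-Solver.solve-∀

signPow-suc : ∀ k → signPow (suc k) ≡ - signPow k
signPow-suc zero          = refl
signPow-suc (suc zero)    = refl
signPow-suc (suc (suc k)) = signPow-suc k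

coefficient : ℕ → ℤ
coefficient n = signPow ((n ℕ.+ 4) / 8)

coefficient-8 : ∀ n → coefficient (8 ℕ.+ n) ≡ - coefficient n
coefficient-8 n = trans (cong signPow (m/n≡1+[m∸n]/n {8 ℕ.+ (n ℕ.+ 4)} {8} (ℕP.m≤m+n 8 (n ℕ.+ 4))))
  (signPow-suc ((n ℕ.+ 4) / 8))

-- The first eight values are checked directly. Eight steps further i moves by 35 up or down, which
-- fixes its residues modulo 7 and 5 and flips its parity, just as ⌊(n + 4)/8⌋ grows by one.
coefficient-position : ∀ n → let i = position n in
  coefficient n ≡ signℤ i * χ (+ 7) (+ 1 + i) * χ (+ 5) (+ 1 - i)
coefficient-position = by-eights _ refl refl refl refl refl refl refl refl
  (λ n eq → trans (coefficient-8 n) (trans (cong -_ eq) (sym (flip (position n) (direction n) (direction-± n)))))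
  where
  value : ℤ → ℤ
  value i = signℤ i * χ (+ 7) (+ 1 + i) * χ (+ 5) (+ 1 - i)
  odd-shift : ∀ i d → signℤ (+ 35 * d) ≡ -[1+ 0 ] → value (i + + 35 * d) ≡ - value i
  odd-shift i d eq = trans
    (cong₂ _*_ (cong₂ _*_ (trans (signℤ-+ i (+ 35 * d)) (cong (signℤ i *_) eq))
        (χ-mod (+ 7) _ (+ 1 + i) (+ 5 * d) (l₇ i d)))
      (χ-mod (+ 5) _ (+ 1 - i) (- (+ 7 * d)) (l₅ i d)))
    (lemma (signℤ i) (χ (+ 7) (+ 1 + i)) (χ (+ 5) (+ 1 - i)))
    where
    l₇ : ∀ i d → + 1 + (i + + 35 * d) ≡ + 1 + i + + 7 * (+ 5 * d)
    l₇ = ℤ-Solver.solve-∀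
    l₅ : ∀ i d → + 1 - (i + + 35 * d) ≡ + 1 - i + + 5 * - (+ 7 * d)
    l₅ = ℤ-Solver.solve-∀
    lemma : ∀ a b c → a * -[1+ 0 ] * b * c ≡ - (a * b * c)
    lemma = ℤ-Solver.solve-∀
  flip : ∀ i d → d ≡ + 1 ⊎ d ≡ -[1+ 0 ] → value (i + + 35 * d) ≡ - value i
  flip i _ (inj₁ refl) = odd-shift i (+ 1) refl
  flip i _ (inj₂ refl) = odd-shift i -[1+ 0 ] refl

-- The left-hand product as a sum over lattice points

module PrimeSums (M D : ℕ) (big : radius M ℕ.+ radius M < D) where

  open Lattice M D big
  open ThetaSums M D big

  M≤D : M ≤ D
  M≤D = ℕP.≤-trans (ℕP.≤-trans (ℕP.m≤n*m M 140) (ℕP.m≤m+n (140 ℕ.* M) 6)) R≤D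

  prime6-bound : ∀ u t → prime6 u t ≢ + 0 → ℤ.∣ u ∣ ≤ R × ℤ.∣ t ∣ ≤ R
  prime6-bound u t nz = weight-bound u t (*≢0ʳ (+ 2 * (+ 1 - signℤ u) * (+ 1 - ind (+ 3 ∣ℤ.∣? u)) * signℤ t) _ nz)

  row : ℤ → ℤ
  row u = sumℤ D (prime6 u)

  row-bound : ∀ u → row u ≢ + 0 → ℤ.∣ u ∣ ≤ R ℕ.+ R
  row-bound u nz with sumOver≢0 (interval D) nz
  ... | t , nz′ = ℕP.≤-trans (proj₁ (prime6-bound u t nz′)) (ℕP.m≤m+n R R)

  row-classes : ∀ u → row u ≢ + 0 → + 6 ∣ℤ.∣ u - + 1 ⊎ + 6 ∣ℤ.∣ u - -[1+ 0 ]
  row-classes u nz with sumOver≢0 (interval D) nz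
  ... | t , nz′ = go (1-sign≢0⇒odd u (*≢0ʳ (+ 2) (+ 1 - signℤ u) (*≢0ˡ (+ 2 * (+ 1 - signℤ u)) _ nz″)))
                     (u %ℕ 3) (n%ℕd<d u 3) (a≡a%ℕn+[a/ℕn]*n u 3)
    where
    nz″ : + 2 * (+ 1 - signℤ u) * (+ 1 - ind (+ 3 ∣ℤ.∣? u)) ≢ + 0
    nz″ = *≢0ˡ _ (signℤ t) (*≢0ˡ _ (weight u t) nz′)
    ¬3∣u : ¬ (+ 3 ∣ℤ.∣ u)
    ¬3∣u p = *≢0ʳ (+ 2 * (+ 1 - signℤ u)) (+ 1 - ind (+ 3 ∣ℤ.∣? u)) nz″ (cong (λ z → + 1 - z) (ind-yes (+ 3 ∣ℤ.∣? u) p))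
    q = u /ℕ 3
    go : (∃ λ k → u ≡ + 1 + + 2 * k) → ∀ r → r < 3 → u ≡ + r + q * + 3 → + 6 ∣ℤ.∣ u - + 1 ⊎ + 6 ∣ℤ.∣ u - -[1+ 0 ]
    go _ 0 _ eq = contradiction (divides q (trans eq (ℤP.+-identityˡ (q * + 3)))) ¬3∣u
    go (k , e₂) 1 _ e₃ = inj₁ (divides (k - q) (trans (l₁ u) (trans (cong₂ (λ a b → + 3 * (a - + 1) - + 2 * (b - + 1)) e₂ e₃) (l₂ k q))))
      where
      l₁ : ∀ u → u - + 1 ≡ + 3 * (u - + 1) - + 2 * (u - + 1)
      l₁ = ℤ-Solver.solve-∀
      l₂ : ∀ k q → + 3 * (+ 1 + + 2 * k - + 1) - + 2 * (+ 1 + q * + 3 - + 1) ≡ (k - q) * + 6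
      l₂ = ℤ-Solver.solve-∀
    go (k , e₂) 2 _ e₃ = inj₂ (divides (k - q) (trans (l₁ u) (trans (cong₂ (λ a b → + 3 * (a + + 1) - + 2 * (b + + 1)) e₂ e₃) (l₂ k q))))
      where
      l₁ : ∀ u → u + + 1 ≡ + 3 * (u + + 1) - + 2 * (u + + 1)
      l₁ = ℤ-Solver.solve-∀
      l₂ : ∀ k q → + 3 * (+ 1 + + 2 * k + + 1) - + 2 * (+ 2 + q * + 3 + + 1) ≡ (k - q) * + 6
      l₂ = ℤ-Solver.solve-∀
    go _ (suc (suc (suc _))) (s≤s (s≤s (s≤s ()))) _

  prime6-neg : ∀ u t → prime6 (- u) (- t) ≡ prime6 u t
  prime6-neg u t = cong₂ _*_
    (cong₂ _*_ (cong₂ (λ a b → + 2 * (+ 1 - a) * (+ 1 - b)) (signℤ-neg u)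
      (ind-cong (+ 3 ∣ℤ.∣? (- u)) (+ 3 ∣ℤ.∣? u) (λ p → subst (+ 3 ∣ℤ.∣_) (ℤP.neg-involutive u) (flip p)) flip))
      (signℤ-neg t))
    (weight-neg u t)
    where
    flip : ∀ {y} → + 3 ∣ℤ.∣ y → + 3 ∣ℤ.∣ - y
    flip (divides q eq) = divides (- q) (trans (cong -_ eq) (ℤP.neg-distribˡ-* q (+ 3)))

  row-neg : ∀ u → row (- u) ≡ row u
  row-neg u = trans
    (sym (sumℤ-reflect (+ 0) {prime6 (- u)}
      (λ t nz → ℕP.≤-trans (proj₂ (prime6-bound (- u) t nz)) R≤D)
      (λ t nz → ℕP.≤-trans (subst (_≤ R) (trans (cong ℤ.∣_∣ (ℤP.+-identityˡ (- t))) (ℤP.∣-i∣≡∣i∣ t)) (proj₂ (prime6-bound (- u) (+ 0 - t) nz))) R≤D)))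
    (sumOver-cong (interval D) (λ t → trans (cong (prime6 (- u)) (ℤP.+-identityˡ (- t))) (prime6-neg u t)))

  squarePair : ℤ → ℕ → ℤ
  squarePair j n = signℤ j * coefficient n * mono (J₃.thetaExp j ℕ.+ index n) M

  -- For u = 1 + 6j the substitution t = i + j separates the form into j and i.
  shifted-weight : ∀ j i → weight (+ 1 + + 6 * j) (i + j) ≡
    χ (+ 7) (+ 1 + i) * χ (+ 5) (+ 1 - i) * onForm (+ 1 + + 6 * j) (i + j)
  shifted-weight j i = cong₂ (λ a b → a * b * onForm (+ 1 + + 6 * j) (i + j))
    (χ-mod (+ 7) _ (+ 1 + i) j (l₇ i j)) (χ-mod (+ 5) _ (+ 1 - i) j (l₅ i j))
    where
    l₇ : ∀ i j → + 1 + + 6 * j + (i + j) ≡ + 1 + i + + 7 * j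
    l₇ = ℤ-Solver.solve-∀
    l₅ : ∀ i j → + 1 + + 6 * j - (i + j) ≡ + 1 - i + + 5 * j
    l₅ = ℤ-Solver.solve-∀

  onForm-position : ∀ j n → onForm (+ 1 + + 6 * j) (position n + j) ≡ mono (J₃.thetaExp j ℕ.+ index n) M
  onForm-position j n = onForm-mono (+ 1 + + 6 * j) (position n + j) (J₃.thetaExp j ℕ.+ index n)
    (trans (l (position n) j) (trans
      (cong₂ (λ a b → + 35 * a + b + + 3) (sym (thetaExp-double 2 1 (s≤s z≤n) (s≤s z≤n) j)) (position-index n))
      (l′ (+ J₃.thetaExp j) (+ index n))))
    where
    l : ∀ i j → + 3 * ((+ 1 + + 6 * j) * (+ 1 + + 6 * j)) - (+ 1 + + 6 * j) * (i + j) + + 3 * ((i + j) * (i + j)) ≡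
                + 35 * ((+ 2 + + 1) * (j * j) + (+ 2 - + 1) * j) + (+ 3 * (i * i) - i) + + 3
    l = ℤ-Solver.solve-∀
    l′ : ∀ a b → + 35 * (+ 2 * a) + + 70 * b + + 3 ≡ + 70 * (a + b) + + 3
    l′ = ℤ-Solver.solve-∀

  -- The substitution t = i + j is a bijection onto the support of the row, because `position` runs
  -- once through every i at which neither character vanishes. A nonzero term has n ≤ `index n` ≤ M,
  -- so its n lies in the range of summation.
  sum-squarePair : ∀ j → sumOver (downTo D) (squarePair j) ≡ sumℤ D (λ t → signℤ t * weight (+ 1 + + 6 * j) t)
  sum-squarePair j = sumOver-reindex ℤ._≟_ (downTo-unique D) (interval-unique D) (λ n → position n + j)
    match (λ {n} {n′} eq → position-injective (+ℤ-cancelˡ j (position n) (position n′) (trans (ℤP.+-comm j (position n)) (trans eq (ℤP.+-comm (position n′) j)))))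
    cover
    where
    G : ℤ → ℤ
    G t = signℤ t * weight (+ 1 + + 6 * j) t
    match : ∀ n → squarePair j n ≡ G (position n + j)
    match n = trans
      (cong₂ (λ a b → signℤ j * a * b) (coefficient-position n) (sym (onForm-position j n)))
      (trans (lemma (signℤ j) (signℤ i) (χ (+ 7) (+ 1 + i)) (χ (+ 5) (+ 1 - i)) (onForm (+ 1 + + 6 * j) (i + j)))
        (sym (cong₂ _*_ (signℤ-+ i j) (shifted-weight j i))))
      where
      i = position n
      lemma : ∀ s r a b w → s * (r * a * b) * w ≡ r * s * (a * b * w)
      lemma = ℤ-Solver.solve-∀
    cover : ∀ t → G t ≢ + 0 → _
    cover t nz = ∈-interval t (ℕP.≤-trans (proj₂ (weight-bound (+ 1 + + 6 * j) t (*≢0ʳ (signℤ t) _ nz))) R≤D) ,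
      preimage (position-surjective i (*≢0ˡ _ (χ (+ 5) (+ 1 - i)) w) (*≢0ʳ (χ (+ 7) (+ 1 + i)) _ w))
      where
      i = t - j
      i+j≡t : ∀ t j → t - j + j ≡ t
      i+j≡t = ℤ-Solver.solve-∀
      nz′ : χ (+ 7) (+ 1 + i) * χ (+ 5) (+ 1 - i) * onForm (+ 1 + + 6 * j) (i + j) ≢ + 0
      nz′ z = *≢0ʳ (signℤ t) _ nz (trans (cong (weight (+ 1 + + 6 * j)) (sym (i+j≡t t j))) (trans (shifted-weight j i) z))
      w : χ (+ 7) (+ 1 + i) * χ (+ 5) (+ 1 - i) ≢ + 0
      w = *≢0ˡ _ (onForm (+ 1 + + 6 * j) (i + j)) nz′
      preimage : (∃ λ n → position n ≡ i) → ∃ λ n → position n + j ≡ t × n ∈ downTo D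
      preimage (n , eq) = n , trans (cong (_+ j) eq) (i+j≡t t j) , ∈-downTo (ℕP.≤-trans n≤M M≤D)
        where
        on : mono (J₃.thetaExp j ℕ.+ index n) M ≢ + 0
        on z = *≢0ʳ (χ (+ 7) (+ 1 + i) * χ (+ 5) (+ 1 - i)) _ nz′
          (trans (cong (λ y → onForm (+ 1 + + 6 * j) (y + j)) (sym eq)) (trans (onForm-position j n) z))
        n≤M : n ≤ M
        n≤M = ℕP.≤-trans (n≤increasing index-increasing n) (subst (index n ≤_)
          (ind≢0 (J₃.thetaExp j ℕ.+ index n ℕ.≟ M) (λ z → on (trans (mono-ind (J₃.thetaExp j ℕ.+ index n) M) z)))
          (ℕP.m≤n+m (index n) (J₃.thetaExp j)))

  row-6 : ∀ j → row (+ 1 + + 6 * j) ≡ + 4 * sumOver (downTo D) (squarePair j)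
  row-6 j = trans (sumOver-cong (interval D) (λ t → trans
      (cong₂ (λ a b → + 2 * (+ 1 - a) * (+ 1 - b) * signℤ t * weight u t)
        (signℤ-mod2 u (+ 1) (+ 3 * j) (l₂ j)) (ind-no (+ 3 ∣ℤ.∣? u) ¬3∣u))
      (ℤP.*-assoc (+ 4) (signℤ t) (weight u t))))
    (trans (sumOver-*ˡ (interval D) (+ 4) (λ t → signℤ t * weight u t)) (cong (+ 4 *_) (sym (sum-squarePair j))))
    where
    u = + 1 + + 6 * j
    l₂ : ∀ j → + 1 + + 6 * j ≡ + 1 + + 2 * (+ 3 * j)
    l₂ = ℤ-Solver.solve-∀
    ¬3∣u : ¬ (+ 3 ∣ℤ.∣ + 1 + + 6 * j)
    ¬3∣u (divides q eq) = from-no (+ 3 ∣ℤ.∣? + 1) (divides (q - + 2 * j)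
      (trans (lemma j) (trans (cong (_- + 6 * j) eq) (lemma′ q j))))
      where
      lemma : ∀ j → + 1 ≡ + 1 + + 6 * j - + 6 * j
      lemma = ℤ-Solver.solve-∀
      lemma′ : ∀ q j → q * + 3 - + 6 * j ≡ (q - + 2 * j) * + 3
      lemma′ = ℤ-Solver.solve-∀

  sum-prime6 : sum² D prime6 ≡ + 8 * sumℤ D (λ j → sumOver (downTo D) (squarePair j))
  sum-prime6 = begin
    sumℤ D row
      ≡⟨ sumℤ-two-classes (+ 6) (+ 1) -[1+ 0 ] (from-no (+ 6 ∣ℤ.∣? -[1+ 1 ])) row-classes
           (λ u nz → ℕP.<⇒≤ (ℕP.≤-<-trans (row-bound u nz) big))
           (λ j nz → quotient-bound (+ 6) {+ 1 + + 6 * j} j (b₁ j) (row-bound (+ 1 + + 6 * j) nz))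
           (λ j nz → quotient-bound (+ 6) {+ 1 + + 6 * j} j (b₁ j) (row-bound (+ 1 + + 6 * j) (λ z → nz (trans (negated j) z)))) ⟩
    sumℤ D (λ j → row (+ 1 + + 6 * j)) + sumℤ D (λ j → row (-[1+ 0 ] - + 6 * j))
      ≡⟨ sum-two-equal {h = λ j → sumOver (downTo D) (squarePair j)} (+ 4) row-6 (λ j → trans (negated j) (row-6 j)) ⟩
    + 8 * sumℤ D (λ j → sumOver (downTo D) (squarePair j)) ∎
    where
    open ≡-Reasoning
    b₁ : ∀ n → + 6 * n ≡ + 1 + + 6 * n - + 1
    b₁ = ℤ-Solver.solve-∀
    negated : ∀ n → row (-[1+ 0 ] - + 6 * n) ≡ row (+ 1 + + 6 * n)
    negated n = trans (cong row (lemma n)) (row-neg (+ 1 + + 6 * n))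
      where
      lemma : ∀ n → -[1+ 0 ] - + 6 * n ≡ - (+ 1 + + 6 * n)
      lemma = ℤ-Solver.solve-∀

  -- Both lattice sums count every term eight times, and the common factor is cancelled in the
  -- integers.
  sum-squarePair≡sum-thetaPair : sumℤ D (λ j → sumOver (downTo D) (squarePair j)) ≡ sum² D thetaPair
  sum-squarePair≡sum-thetaPair = ℤP.*-cancelˡ-≡ (+ 8) (sumℤ D (λ j → sumOver (downTo D) (squarePair j))) (sum² D thetaPair)
    (trans (sym sum-prime6) (trans (sym sum-oddEven≡sum-prime6) sum-oddEven))

-- Comparison of the two products and identification of the sequence

θ₃ θ₅ θ₇ : PS
θ₃ = poch 2 3 ⊛ poch 1 3 ⊛ poch 3 3
θ₅ = poch 3 5 ⊛ poch 2 5 ⊛ poch 5 5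
θ₇ = poch 4 7 ⊛ poch 3 7 ⊛ poch 7 7

swap-θ : ∀ f g h → f ⊛ g ⊛ h ≈ g ⊛ f ⊛ h
swap-θ f g h = ⊛-congʳ h (⊛-comm f g)

squareSeries : PS
squareSeries N = sumTo N (λ n → coefficient n * mono (index n) N)

squareSeries-extend : ∀ d N → sumTo (d ℕ.+ N) (λ n → coefficient n * mono (index n) N) ≡ squareSeries N
squareSeries-extend zero    N = refl
squareSeries-extend (suc d) N = trans
  (cong₂ _+_ (squareSeries-extend d N)
    (trans (cong (coefficient (suc (d ℕ.+ N)) *_) (mono-below (index (suc (d ℕ.+ N)))
        (ℕP.<-≤-trans (s≤s (ℕP.m≤n+m N d)) (n≤increasing index-increasing (suc (d ℕ.+ N))))))
      (ℤP.*-zeroʳ (coefficient (suc (d ℕ.+ N))))))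
  (ℤP.+-identityʳ (squareSeries N))

squareSeries-downTo : ∀ D {N} → N ≤ D → squareSeries N ≡ sumOver (downTo D) (λ n → coefficient n * mono (index n) N)
squareSeries-downTo D {N} N≤D = trans (sym (squareSeries-extend (D ∸ N) N))
  (trans (cong (λ k → sumTo k (λ n → coefficient n * mono (index n) N)) (ℕP.m∸n+n≡m N≤D)) (sumTo-downTo D _))

squareSeries⊛θ₃ : squareSeries ⊛ θ₃ ≈ θ₇ ⊛ θ₅
squareSeries⊛θ₃ M = begin
  (squareSeries ⊛ θ₃) M
    ≡⟨ ⊛-expand (downTo D) (interval D) coefficient index signℤ J₃.thetaExp
         (λ N N≤M → squareSeries-downTo D (ℕP.≤-trans N≤M M≤D))
         (λ N N≤M → trans (J₃.triple-product D (ℕP.≤-trans N≤M M≤D)) (sumTo-⊖ D (λ j → J₃.thetaTerm j N))) ⟩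
  sumOver (downTo D) (λ n → sumℤ D (λ j → coefficient n * signℤ j * mono (index n ℕ.+ J₃.thetaExp j) M))
    ≡⟨ sumOver-swap (downTo D) (interval D) (λ n j → coefficient n * signℤ j * mono (index n ℕ.+ J₃.thetaExp j) M) ⟩
  sumℤ D (λ j → sumOver (downTo D) (λ n → coefficient n * signℤ j * mono (index n ℕ.+ J₃.thetaExp j) M))
    ≡⟨ sumOver-cong (interval D) (λ j → sumOver-cong (downTo D) (λ n →
         cong₂ (λ a k → a * mono k M) (ℤP.*-comm (coefficient n) (signℤ j)) (ℕP.+-comm (index n) (J₃.thetaExp j)))) ⟩
  sumℤ D (λ j → sumOver (downTo D) (squarePair j))
    ≡⟨ sum-squarePair≡sum-thetaPair ⟩
  sum² D thetaPair
    ≡⟨ ⊛-expand (interval D) (interval D) signℤ J₇.thetaExp signℤ J₅.thetaExp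
         (λ N N≤M → trans (J₇.triple-product D (ℕP.≤-trans N≤M M≤D)) (sumTo-⊖ D (λ j → J₇.thetaTerm j N)))
         (λ N N≤M → trans (J₅.triple-product D (ℕP.≤-trans N≤M M≤D)) (sumTo-⊖ D (λ j → J₅.thetaTerm j N))) ⟨
  (θ₇ ⊛ θ₅) M ∎
  where
  open ≡-Reasoning
  -- The smallest box that the lattice arguments permit, so the bound on D holds by reflexivity.
  D = suc (radius M ℕ.+ radius M)
  open Lattice M D ℕP.≤-refl
  open ThetaSums M D ℕP.≤-refl
  open PrimeSums M D ℕP.≤-refl

squareSeries≈rhsSeries : squareSeries ≈ rhsSeries
squareSeries≈rhsSeries = cancel-euler squareSeries rhsSeries (begin
  squareSeries ⊛ (poch 1 3 ⊛ poch 2 3 ⊛ poch 3 3)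
    ≈⟨ ⊛-congˡ squareSeries (swap-θ (poch 1 3) (poch 2 3) (poch 3 3)) ⟩
  squareSeries ⊛ θ₃
    ≈⟨ squareSeries⊛θ₃ ⟩
  θ₇ ⊛ θ₅
    ≈⟨ ⊛-cong (swap-θ (poch 4 7) (poch 3 7) (poch 7 7)) (swap-θ (poch 3 5) (poch 2 5) (poch 5 5)) ⟩
  (poch 3 7 ⊛ poch 4 7 ⊛ poch 7 7) ⊛ (poch 2 5 ⊛ poch 3 5 ⊛ poch 5 5)
    ≈⟨ rhs-reduction ⟨
  rhsSeries ⊛ (poch 1 3 ⊛ poch 2 3 ⊛ poch 3 3) ∎)
  where open ≈-Reasoning

lhsSeries-cong : ∀ a → (∀ n → a n ≡ index n) → lhsSeries a ≈ squareSeries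
lhsSeries-cong a eq N = sumTo-cong N term
  where
  term : ∀ n → (if a n ≡ᵇ N then coefficient n else + 0) ≡ coefficient n * mono (index n) N
  term n rewrite eq n = trans (select (index n) N (coefficient n)) (cong (coefficient n *_) (sym (mono-ind (index n) N)))
    where
    select : ∀ k N x → (if k ≡ᵇ N then x else + 0) ≡ x * ind (k ℕ.≟ N)
    select k N x with k ≡ᵇ N
    ... | true  = sym (ℤP.*-identityʳ x)
    ... | false = sym (ℤP.*-zeroʳ x)

theorem5 : (a : ℕ → ℕ) →
    (∀ n → a n < a (suc n)) →
    (∀ m → (IsSq840 m → Σ ℕ λ n → a n ≡ m) × ((Σ ℕ λ n → a n ≡ m) → IsSq840 m)) →
    ∀ N → lhsSeries a N ≡ rhsSeries N
theorem5 a a-inc a-range N = trans (lhsSeries-cong a a≡index N) (squareSeries≈rhsSeries N)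
  where
  a≡index : ∀ n → a n ≡ index n
  -- The two inclusions between the ranges of a and `index` yield the two inequalities.
  a≡index n = ℕP.≤-antisym
    (enumeration-≤ index-increasing a-inc (λ n → proj₁ (a-range (index n)) (root n , root² n)) n)
    (enumeration-≤ a-inc index-increasing (λ n → index-complete (a n) (proj₂ (a-range (a n)) (n , refl))) n)
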